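{- The shift action of $\mathrm{Diff}([0,1])$ on $\mathcal{H}^+([0,1])$, given by $g \cdot h = g \circ h$, is turbulent.
   Context: $\mathcal{H}^+([0,1])$ is the Polish group of increasing homeomorphisms of $[0,1]$ onto itself, with the supremum metric. $\mathrm{Diff}([0,1]) = \{f \in \mathcal{H}^+([0,1]) : f' \in \mathcal{C}([0,1]),\ (f^{ -1})' \in \mathcal{C}([0,1])\}$ (one-sided derivatives at the endpoints), considered as a Polish group with the topology of the metric $d_{\mathrm{Diff}}(f,g) = \sup_{t\in[0,1]}|f(t)-g(t)| + \sup_{t\in[0,1]}|f'(t)-g'(t)|$. Let a Polish group $G$ act continuously on a Polish space $X$. For $x \in X$, $U \subset X$ open with $x\in U$, and $V \subset G$ open with $1_G \in V$, the local $U$-$V$-orbit $\mathcal{O}(x,U,V)$ is the set of $y \in U$ for which there exist $l \in \mathbb{N}$, points $x = x_1, x_2, \dots, x_l = y$ in $U$ and $g_1,\dots,g_{l-1}\in V$ such that $x_{i+1} = g_i \cdot x_i$ for $i<l$. The action is turbulent if (T1) every orbit is meager, (T2) every orbit is dense, and (T3) every local orbit is somewhere dense, i.e. for all open $U\subset X$, $x \in U$, and open $V \subset G$ with $1_G\in V$, the set $\mathcal{O}(x,U,V)$ is somewhere dense. -}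

module Defs where

open import Algebra.Bundles using (CommutativeRing; Group)
open import Axiom.ExcludedMiddle using (ExcludedMiddle)
open import Data.Empty using (⊥-elim)
open import Data.Fin.Base using (Fin; zero; suc; inject₁; fromℕ)
open import Data.Nat.Base using (ℕ; suc)
open import Data.Product.Base using (Σ; ∃; _×_; _,_; proj₁; proj₂)
open import Data.Sum.Base using (_⊎_; inj₁; inj₂)
open import Function.Base using (_∘_)
open import Function.Bundles using (Inverse)
import Function.Construct.Composition as Comp
import Function.Construct.Identity as Ident
import Function.Construct.Symmetry as Symm
open import Function.Metric.Structures using (IsGeneralMetric)
open import Level using (0ℓ)
open import Relation.Binary.Bundles using (Setoid; StrictTotalOrder)
open import Relation.Binary.Core using (Rel)
open import Relation.Binary.Definitions using (Tri; tri<; tri≈; tri>)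
open import Relation.Binary.Structures using (IsStrictTotalOrder)
open import Relation.Nullary using (¬_; yes; no)
open import Relation.Unary using (Pred; _∈_; _⊆_; Empty; Satisfiable; ⋃)
import Algebra.Construct.NaturalChoice.Max as Max
import Algebra.Properties.Ring as RingProperties
import Relation.Binary.Construct.On as On
import Relation.Binary.Construct.StrictToNonStrict as StrictToNonStrict
import Relation.Binary.Properties.StrictTotalOrder as StrictTotalOrderProperties
import Relation.Binary.Reasoning.StrictPartialOrder as StrictReasoning

-- The library has no real numbers. They are determined up to isomorphism
-- as the complete ordered field, and everything below is parametrised by
-- an arbitrary such field (with a setoid equality).

record CompleteOrderedField : Set₁ where
  infix 4 _<_ _≤_

  field
    commutativeRing : CommutativeRing 0ℓ 0ℓ

  open CommutativeRing commutativeRing public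

  field
    _<_                : Rel Carrier 0ℓ
    isStrictTotalOrder : IsStrictTotalOrder _≈_ _<_
    0<1                : 0# < 1#
    +-monoˡ-<          : ∀ {x y} z → x < y → x + z < y + z
    *-pos              : ∀ {x y} → 0# < x → 0# < y → 0# < x * y
    inverse            : ∀ x → ¬ x ≈ 0# → ∃ λ y → x * y ≈ 1#

  _≤_ : Rel Carrier 0ℓ
  _≤_ = StrictToNonStrict._≤_ _≈_ _<_

  IsUpperBound : Pred Carrier 0ℓ → Carrier → Set
  IsUpperBound P b = ∀ {x} → P x → x ≤ b

  field
    supremum : (P : Pred Carrier 0ℓ) → ∃ P → ∃ (IsUpperBound P) →
               ∃ λ s → IsUpperBound P s × (∀ {b} → IsUpperBound P b → s ≤ b)

  recip : ∀ x → ¬ x ≈ 0# → Carrier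
  recip x x≉0 = proj₁ (inverse x x≉0)

  strictTotalOrder : StrictTotalOrder 0ℓ 0ℓ 0ℓ
  strictTotalOrder = record { isStrictTotalOrder = isStrictTotalOrder }

  open StrictTotalOrderProperties strictTotalOrder public
    using (decTotalOrder; totalOrder)
  open Max totalOrder public using (_⊔_)

  infix 8 ∣_∣
  ∣_∣ : Carrier → Carrier
  ∣ x ∣ = x ⊔ (- x)

module FieldProperties (ℝ : CompleteOrderedField) where

  open CompleteOrderedField ℝ
  open RingProperties ring public
    using (-0#≈0#; -‿involutive; -‿+-comm; -‿distribˡ-*; -‿distribʳ-*;
           x[y-z]≈xy-xz; [y-z]x≈yx-zx)
  open StrictTotalOrder strictTotalOrder public
    using (compare; strictPartialOrder; <-respˡ-≈; <-respʳ-≈)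
    renaming (irrefl to <-irrefl; trans to <-trans; asym to <-asym)
  open StrictTotalOrderProperties strictTotalOrder public
    using (antisym; total; _≤?_)
    renaming (trans to ≤-trans; reflexive to ≤-reflexive; refl to ≤-refl;
              ≤-respˡ-≈ to ≤-respˡ-≈; ≤-respʳ-≈ to ≤-respʳ-≈;
              isPartialOrder to ≤-isPartialOrder)
  open Max totalOrder public
    using (⊔-cong; ⊔-comm; ⊔-lub; x≤x⊔y; x≤y⊔x; ⊔-sel; x≤y⇒x⊔y≈y; x≤y⇒y⊔x≈y)
  open StrictReasoning strictPartialOrder

  <⇒≤ : ∀ {x y} → x < y → x ≤ y
  <⇒≤ = inj₁

  <-≤-trans : ∀ {x y z} → x < y → y ≤ z → x < z
  <-≤-trans x<y (inj₁ y<z) = <-trans x<y y<z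
  <-≤-trans x<y (inj₂ y≈z) = <-respʳ-≈ y≈z x<y

  ≤-<-trans : ∀ {x y z} → x ≤ y → y < z → x < z
  ≤-<-trans (inj₁ x<y) y<z = <-trans x<y y<z
  ≤-<-trans (inj₂ x≈y) y<z = <-respˡ-≈ (sym x≈y) y<z

  ≤⇒≯ : ∀ {x y} → x ≤ y → ¬ y < x
  ≤⇒≯ x≤y y<x = <-irrefl refl (≤-<-trans x≤y y<x)

  ≮⇒≥ : ∀ {x y} → ¬ x < y → y ≤ x
  ≮⇒≥ {x} {y} x≮y with compare x y
  ... | tri< x<y _ _ = ⊥-elim (x≮y x<y)
  ... | tri≈ _ x≈y _ = inj₂ (sym x≈y)
  ... | tri> _ _ y<x = inj₁ y<x

  <-or-≥ : ∀ x y → x < y ⊎ y ≤ x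
  <-or-≥ x y with compare x y
  ... | tri< x<y _ _ = inj₁ x<y
  ... | tri≈ _ x≈y _ = inj₂ (inj₂ (sym x≈y))
  ... | tri> _ _ y<x = inj₂ (inj₁ y<x)

  +-monoʳ-< : ∀ {x y} z → x < y → z + x < z + y
  +-monoʳ-< {x} {y} z x<y = begin-strict
    z + x ≈⟨ +-comm z x ⟩
    x + z <⟨ +-monoˡ-< z x<y ⟩
    y + z ≈⟨ +-comm y z ⟩
    z + y ∎

  +-monoˡ-≤ : ∀ {x y} z → x ≤ y → x + z ≤ y + z
  +-monoˡ-≤ z (inj₁ x<y) = inj₁ (+-monoˡ-< z x<y)
  +-monoˡ-≤ z (inj₂ x≈y) = inj₂ (+-congʳ x≈y)

  +-monoʳ-≤ : ∀ {x y} z → x ≤ y → z + x ≤ z + y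
  +-monoʳ-≤ z (inj₁ x<y) = inj₁ (+-monoʳ-< z x<y)
  +-monoʳ-≤ z (inj₂ x≈y) = inj₂ (+-congˡ x≈y)

  +-mono-≤ : ∀ {x y u v} → x ≤ y → u ≤ v → x + u ≤ y + v
  +-mono-≤ {y = y} {u} x≤y u≤v = ≤-trans (+-monoˡ-≤ u x≤y) (+-monoʳ-≤ y u≤v)

  x≤x+y : ∀ x y → 0# ≤ y → x ≤ x + y
  x≤x+y x y 0≤y = ≤-respˡ-≈ (+-identityʳ x) (+-monoʳ-≤ x 0≤y)

  +-mono-< : ∀ {x y u v} → x < y → u < v → x + u < y + v
  +-mono-< {y = y} {u} x<y u<v = <-trans (+-monoˡ-< u x<y) (+-monoʳ-< y u<v)

  telescope : ∀ x y z → (x - y) + (y - z) ≈ x - z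
  telescope x y z = begin-equality
    (x - y) + (y - z)   ≈⟨ +-assoc x (- y) (y - z) ⟩
    x + (- y + (y - z)) ≈⟨ +-congˡ (+-assoc (- y) y (- z)) ⟨
    x + ((- y + y) - z) ≈⟨ +-congˡ (+-congʳ (-‿inverseˡ y)) ⟩
    x + (0# - z)        ≈⟨ +-congˡ (+-identityˡ (- z)) ⟩
    x - z               ∎

  x-y+y≈x : ∀ x y → (x - y) + y ≈ x
  x-y+y≈x x y = begin-equality
    (x - y) + y   ≈⟨ +-assoc x (- y) y ⟩
    x + (- y + y) ≈⟨ +-congˡ (-‿inverseˡ y) ⟩
    x + 0#        ≈⟨ +-identityʳ x ⟩
    x             ∎

  x+y-y≈x : ∀ x y → (x + y) - y ≈ x
  x+y-y≈x x y = begin-equality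
    (x + y) - y   ≈⟨ +-assoc x y (- y) ⟩
    x + (y - y)   ≈⟨ +-congˡ (-‿inverseʳ y) ⟩
    x + 0#        ≈⟨ +-identityʳ x ⟩
    x             ∎

  -[x-y]≈y-x : ∀ x y → - (x - y) ≈ y - x
  -[x-y]≈y-x x y = begin-equality
    - (x - y)     ≈⟨ -‿+-comm x (- y) ⟨
    - x + - - y   ≈⟨ +-congˡ (-‿involutive y) ⟩
    - x + y       ≈⟨ +-comm (- x) y ⟩
    y - x         ∎

  x<y⇒0<y-x : ∀ {x y} → x < y → 0# < y - x
  x<y⇒0<y-x {x} x<y = <-respˡ-≈ (-‿inverseʳ x) (+-monoˡ-< (- x) x<y)

  x-y<z⇒x<z+y : ∀ {x y z} → x - y < z → x < z + y
  x-y<z⇒x<z+y {x} {y} lt = <-respˡ-≈ (x-y+y≈x x y) (+-monoˡ-< y lt)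

  x<z+y⇒x-y<z : ∀ {x y z} → x < z + y → x - y < z
  x<z+y⇒x-y<z {x} {y} {z} lt = <-respʳ-≈ (x+y-y≈x z y) (+-monoˡ-< (- y) lt)

  x-y≈0⇒x≈y : ∀ {x y} → x - y ≈ 0# → x ≈ y
  x-y≈0⇒x≈y {x} {y} eq = begin-equality
    x           ≈⟨ x-y+y≈x x y ⟨
    (x - y) + y ≈⟨ +-congʳ eq ⟩
    0# + y      ≈⟨ +-identityˡ y ⟩
    y           ∎

  x≉y⇒x-y≉0 : ∀ {x y} → ¬ x ≈ y → ¬ x - y ≈ 0#
  x≉y⇒x-y≉0 x≉y eq = x≉y (x-y≈0⇒x≈y eq)

  0<x⇒-x<0 : ∀ {x} → 0# < x → - x < 0#
  0<x⇒-x<0 {x} 0<x = begin-strict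
    - x      ≈⟨ +-identityˡ (- x) ⟨
    0# - x   <⟨ +-monoˡ-< (- x) 0<x ⟩
    x - x    ≈⟨ -‿inverseʳ x ⟩
    0#       ∎

  x<0⇒0<-x : ∀ {x} → x < 0# → 0# < - x
  x<0⇒0<-x {x} x<0 = begin-strict
    0#       ≈⟨ -‿inverseʳ x ⟨
    x - x    <⟨ +-monoˡ-< (- x) x<0 ⟩
    0# - x   ≈⟨ +-identityˡ (- x) ⟩
    - x      ∎

  x≤∣x∣ : ∀ x → x ≤ ∣ x ∣
  x≤∣x∣ x = x≤x⊔y x (- x)

  -x≤∣x∣ : ∀ x → - x ≤ ∣ x ∣
  -x≤∣x∣ x = x≤y⊔x x (- x)

  ∣∣-lub : ∀ {x b} → x ≤ b → - x ≤ b → ∣ x ∣ ≤ b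
  ∣∣-lub = ⊔-lub

  ∣∣-lub-< : ∀ {x b} → x < b → - x < b → ∣ x ∣ < b
  ∣∣-lub-< {x} p q with ⊔-sel x (- x)
  ... | inj₁ eq = <-respˡ-≈ (sym eq) p
  ... | inj₂ eq = <-respˡ-≈ (sym eq) q

  ∣∣-cong : ∀ {x y} → x ≈ y → ∣ x ∣ ≈ ∣ y ∣
  ∣∣-cong eq = ⊔-cong eq (-‿cong eq)

  ∣-x∣≈∣x∣ : ∀ x → ∣ - x ∣ ≈ ∣ x ∣
  ∣-x∣≈∣x∣ x = begin-equality
    (- x) ⊔ (- - x) ≈⟨ ⊔-cong refl (-‿involutive x) ⟩
    (- x) ⊔ x       ≈⟨ ⊔-comm (- x) x ⟩
    x ⊔ (- x)       ∎

  ∣x-y∣≈∣y-x∣ : ∀ x y → ∣ x - y ∣ ≈ ∣ y - x ∣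
  ∣x-y∣≈∣y-x∣ x y = trans (sym (∣-x∣≈∣x∣ (x - y))) (∣∣-cong (-[x-y]≈y-x x y))

  0≤x⇒∣x∣≈x : ∀ {x} → 0# ≤ x → ∣ x ∣ ≈ x
  0≤x⇒∣x∣≈x {x} 0≤x = x≤y⇒y⊔x≈y (≤-trans -x≤0 0≤x)
    where
    -x≤0 : - x ≤ 0#
    -x≤0 = begin
      - x    ≈⟨ +-identityˡ (- x) ⟨
      0# - x ≤⟨ +-monoˡ-≤ (- x) 0≤x ⟩
      x - x  ≈⟨ -‿inverseʳ x ⟩
      0#     ∎

  0≤∣x∣ : ∀ x → 0# ≤ ∣ x ∣
  0≤∣x∣ x with compare 0# x
  ... | tri< 0<x _ _ = ≤-trans (inj₁ 0<x) (x≤∣x∣ x)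
  ... | tri≈ _ 0≈x _ = ≤-trans (inj₂ 0≈x) (x≤∣x∣ x)
  ... | tri> _ _ x<0 = ≤-trans (inj₁ (x<0⇒0<-x x<0)) (-x≤∣x∣ x)

  ∣x∣≤0⇒x≈0 : ∀ {x} → ∣ x ∣ ≤ 0# → x ≈ 0#
  ∣x∣≤0⇒x≈0 {x} p with compare x 0#
  ... | tri< x<0 _ _ = ⊥-elim (≤⇒≯ (≤-trans (-x≤∣x∣ x) p) (x<0⇒0<-x x<0))
  ... | tri≈ _ x≈0 _ = x≈0
  ... | tri> _ _ 0<x = ⊥-elim (≤⇒≯ (≤-trans (x≤∣x∣ x) p) 0<x)

  x≈0⇒∣x∣≈0 : ∀ {x} → x ≈ 0# → ∣ x ∣ ≈ 0#
  x≈0⇒∣x∣≈0 x≈0 = trans (0≤x⇒∣x∣≈x (inj₂ (sym x≈0))) x≈0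

  ∣x+y∣≤∣x∣+∣y∣ : ∀ x y → ∣ x + y ∣ ≤ ∣ x ∣ + ∣ y ∣
  ∣x+y∣≤∣x∣+∣y∣ x y = ∣∣-lub
    (+-mono-≤ (x≤∣x∣ x) (x≤∣x∣ y))
    (≤-trans (inj₂ (sym (-‿+-comm x y))) (+-mono-≤ (-x≤∣x∣ x) (-x≤∣x∣ y)))

  ∣∣-triangle : ∀ x y z → ∣ x - z ∣ ≤ ∣ x - y ∣ + ∣ y - z ∣
  ∣∣-triangle x y z =
    ≤-trans (inj₂ (∣∣-cong (sym (telescope x y z)))) (∣x+y∣≤∣x∣+∣y∣ (x - y) (y - z))

  0≤x*y : ∀ {x y} → 0# ≤ x → 0# ≤ y → 0# ≤ x * y
  0≤x*y {x} {y} (inj₁ 0<x) (inj₁ 0<y) = inj₁ (*-pos 0<x 0<y)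
  0≤x*y {x} {y} (inj₁ 0<x) (inj₂ 0≈y) = inj₂ (trans (sym (zeroʳ x)) (*-congˡ 0≈y))
  0≤x*y {x} {y} (inj₂ 0≈x) _          = inj₂ (trans (sym (zeroˡ y)) (*-congʳ 0≈x))

  *-monoʳ-≤ : ∀ {x y z} → 0# ≤ z → x ≤ y → z * x ≤ z * y
  *-monoʳ-≤ {x} {y} {z} 0≤z x≤y = begin
    z * x                   ≈⟨ +-identityˡ (z * x) ⟨
    0# + z * x              ≤⟨ +-monoˡ-≤ (z * x) (0≤x*y 0≤z 0≤y-x) ⟩
    z * (y - x) + z * x     ≈⟨ distribˡ z (y - x) x ⟨
    z * ((y - x) + x)       ≈⟨ *-congˡ (x-y+y≈x y x) ⟩
    z * y                   ∎
    where
    0≤y-x : 0# ≤ y - x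
    0≤y-x = ≤-respˡ-≈ (-‿inverseʳ x) (+-monoˡ-≤ (- x) x≤y)

  *-monoˡ-≤ : ∀ {x y z} → 0# ≤ z → x ≤ y → x * z ≤ y * z
  *-monoˡ-≤ {x} {y} {z} 0≤z x≤y = begin
    x * z ≈⟨ *-comm x z ⟩
    z * x ≤⟨ *-monoʳ-≤ 0≤z x≤y ⟩
    z * y ≈⟨ *-comm z y ⟩
    y * z ∎

  ∣x*y∣≤∣x∣*∣y∣ : ∀ x y → ∣ x * y ∣ ≤ ∣ x ∣ * ∣ y ∣
  ∣x*y∣≤∣x∣*∣y∣ x y with total 0# x
  ... | inj₁ 0≤x = ∣∣-lub
    (*-mono′ 0≤x (x≤∣x∣ x) (x≤∣x∣ y))
    (≤-trans (inj₂ (-‿distribʳ-* x y)) (*-mono′ 0≤x (x≤∣x∣ x) (-x≤∣x∣ y)))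
    where
    *-mono′ : ∀ {a b c} → 0# ≤ a → a ≤ b → c ≤ ∣ y ∣ → a * c ≤ b * ∣ y ∣
    *-mono′ 0≤a a≤b c≤ = ≤-trans (*-monoʳ-≤ 0≤a c≤) (*-monoˡ-≤ (0≤∣x∣ y) a≤b)
  ... | inj₂ x≤0 = ∣∣-lub
    (≤-trans (inj₂ x*y≈-x*-y) (*-mono′ 0≤-x (-x≤∣x∣ x) (-x≤∣x∣ y)))
    (≤-trans (inj₂ (-‿distribˡ-* x y)) (*-mono′ 0≤-x (-x≤∣x∣ x) (x≤∣x∣ y)))
    where
    *-mono′ : ∀ {a b c} → 0# ≤ a → a ≤ b → c ≤ ∣ y ∣ → a * c ≤ b * ∣ y ∣
    *-mono′ 0≤a a≤b c≤ = ≤-trans (*-monoʳ-≤ 0≤a c≤) (*-monoˡ-≤ (0≤∣x∣ y) a≤b)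
    0≤-x : 0# ≤ - x
    0≤-x = begin
      0#       ≈⟨ -‿inverseʳ x ⟨
      x - x    ≤⟨ +-monoˡ-≤ (- x) x≤0 ⟩
      0# - x   ≈⟨ +-identityˡ (- x) ⟩
      - x      ∎
    x*y≈-x*-y : x * y ≈ - x * - y
    x*y≈-x*-y = begin-equality
      x * y         ≈⟨ -‿involutive (x * y) ⟨
      - - (x * y)   ≈⟨ -‿cong (-‿distribˡ-* x y) ⟩
      - (- x * y)   ≈⟨ -‿distribʳ-* (- x) y ⟩
      - x * - y     ∎

  recip-inverse : ∀ x x≉0 → x * recip x x≉0 ≈ 1#
  recip-inverse x x≉0 = proj₂ (inverse x x≉0)

  0<x⇒x≉0 : ∀ {x} → 0# < x → ¬ x ≈ 0#
  0<x⇒x≉0 0<x x≈0 = <-irrefl (sym x≈0) 0<x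

  recip-pos : ∀ {x} (0<x : 0# < x) x≉0 → 0# < recip x x≉0
  recip-pos {x} 0<x x≉0 with compare 0# (recip x x≉0)
  ... | tri< p _ _ = p
  ... | tri≈ _ eq _ = ⊥-elim (<-irrefl 0≈1 0<1)
    where
    0≈1 : 0# ≈ 1#
    0≈1 = trans (sym (zeroʳ x)) (trans (*-congˡ eq) (recip-inverse x x≉0))
  ... | tri> _ _ neg = ⊥-elim (<-asym 0<1 1<0)
    where
    1<0 : 1# < 0#
    1<0 = begin-strict
      1#                       ≈⟨ recip-inverse x x≉0 ⟨
      x * recip x x≉0          ≈⟨ -‿involutive (x * recip x x≉0) ⟨
      - - (x * recip x x≉0)    ≈⟨ -‿cong (-‿distribʳ-* x (recip x x≉0)) ⟩
      - (x * - recip x x≉0)    <⟨ 0<x⇒-x<0 (*-pos 0<x (x<0⇒0<-x neg)) ⟩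
      0#                       ∎

  recip-unique : ∀ {x y} x≉0 y≉0 → x ≈ y → recip x x≉0 ≈ recip y y≉0
  recip-unique {x} {y} x≉0 y≉0 x≈y = begin-equality
    r                 ≈⟨ *-identityʳ r ⟨
    r * 1#            ≈⟨ *-congˡ (recip-inverse y y≉0) ⟨
    r * (y * s)       ≈⟨ *-assoc r y s ⟨
    (r * y) * s       ≈⟨ *-congʳ (*-congˡ (sym x≈y)) ⟩
    (r * x) * s       ≈⟨ *-congʳ (trans (*-comm r x) (recip-inverse x x≉0)) ⟩
    1# * s            ≈⟨ *-identityˡ s ⟩
    s                 ∎
    where
    r = recip x x≉0
    s = recip y y≉0

  0<2 : 0# < 1# + 1#
  0<2 = <-trans 0<1 (<-respˡ-≈ (+-identityˡ 1#) (+-monoˡ-< 1# 0<1))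

  ½ : Carrier
  ½ = recip (1# + 1#) (0<x⇒x≉0 0<2)

  ½-pos : ∀ {x} → 0# < x → 0# < x * ½
  ½-pos 0<x = *-pos 0<x (recip-pos 0<2 (0<x⇒x≉0 0<2))

  ½+½ : ∀ x → x * ½ + x * ½ ≈ x
  ½+½ x = begin-equality
    x * ½ + x * ½      ≈⟨ distribˡ x ½ ½ ⟨
    x * (½ + ½)        ≈⟨ *-congˡ (+-cong (*-identityˡ ½) (*-identityˡ ½)) ⟨
    x * (1# * ½ + 1# * ½) ≈⟨ *-congˡ (distribʳ ½ 1# 1#) ⟨
    x * ((1# + 1#) * ½) ≈⟨ *-congˡ (recip-inverse (1# + 1#) (0<x⇒x≉0 0<2)) ⟩
    x * 1#             ≈⟨ *-identityʳ x ⟩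
    x                  ∎

  ½-< : ∀ {x} → 0# < x → x * ½ < x
  ½-< {x} 0<x = begin-strict
    x * ½          ≈⟨ +-identityʳ (x * ½) ⟨
    x * ½ + 0#     <⟨ +-monoʳ-< (x * ½) (½-pos 0<x) ⟩
    x * ½ + x * ½  ≈⟨ ½+½ x ⟩
    x              ∎

  dense : ∀ {x y} → x < y → ∃ λ z → x < z × z < y
  dense {x} {y} x<y = (y - x) * ½ + x , p , q
    where
    0<d = x<y⇒0<y-x x<y
    p : x < (y - x) * ½ + x
    p = <-respˡ-≈ (+-identityˡ x) (+-monoˡ-< x (½-pos 0<d))
    q : (y - x) * ½ + x < y
    q = <-respʳ-≈ (x-y+y≈x y x) (+-monoˡ-< x (½-< 0<d))

  common-bound : ∀ {x y} → 0# < x → 0# < y → ∃ λ z → 0# < z × z ≤ x × z ≤ y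
  common-bound {x} {y} 0<x 0<y with total x y
  ... | inj₁ x≤y = x , 0<x , ≤-refl , x≤y
  ... | inj₂ y≤x = y , 0<y , y≤x , ≤-refl

  ∣x-y∣-small⇒≈ : ∀ {x y} → (∀ ε → 0# < ε → ∣ x - y ∣ < ε) → x ≈ y
  ∣x-y∣-small⇒≈ {x} {y} small = x-y≈0⇒x≈y (∣x∣≤0⇒x≈0 (≮⇒≥ λ 0<d → <-irrefl refl (small _ 0<d)))

  ∣∣<⇒<+ : ∀ {x y e} → ∣ x - y ∣ < e → x < e + y
  ∣∣<⇒<+ {x} {y} p = x-y<z⇒x<z+y (≤-<-trans (x≤∣x∣ (x - y)) p)

  within : ∀ {x y e} → x < e + y → y < e + x → ∣ x - y ∣ < e
  within {x} {y} p q = ∣∣-lub-< (x<z+y⇒x-y<z p)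
    (<-respˡ-≈ (sym (-[x-y]≈y-x x y)) (x<z+y⇒x-y<z q))

  ∣x∣≤∣x-y∣+∣y∣ : ∀ x y → ∣ x ∣ ≤ ∣ x - y ∣ + ∣ y ∣
  ∣x∣≤∣x-y∣+∣y∣ x y =
    ≤-trans (inj₂ (∣∣-cong (sym (x-y+y≈x x y)))) (∣x+y∣≤∣x∣+∣y∣ (x - y) y)

  product-continuous : ∀ A B {ε} → 0# < ε → ∃ λ η → 0# < η ×
    (∀ a b → ∣ a - A ∣ < η → ∣ b - B ∣ < η → ∣ a * b - A * B ∣ < ε)
  product-continuous A B {ε} 0<ε = η , 0<η , bound
    where
    K = (1# + ∣ B ∣) + ∣ A ∣
    1≤1+∣B∣ : 1# ≤ 1# + ∣ B ∣
    1≤1+∣B∣ = ≤-respˡ-≈ (+-identityʳ 1#) (+-monoʳ-≤ 1# (0≤∣x∣ B))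
    0<K : 0# < K
    0<K = begin-strict
      0#                     <⟨ 0<1 ⟩
      1#                     ≤⟨ 1≤1+∣B∣ ⟩
      1# + ∣ B ∣             ≈⟨ +-identityʳ _ ⟨
      1# + ∣ B ∣ + 0#        ≤⟨ +-monoʳ-≤ _ (0≤∣x∣ A) ⟩
      K                      ∎
    K≉0 = 0<x⇒x≉0 0<K
    ε/K = (ε * ½) * recip K K≉0
    choice = common-bound 0<1 (*-pos (½-pos 0<ε) (recip-pos 0<K K≉0))
    η = proj₁ choice
    0<η = proj₁ (proj₂ choice)
    η≤1 = proj₁ (proj₂ (proj₂ choice))
    η≤ε/K = proj₂ (proj₂ (proj₂ choice))
    bound : ∀ a b → ∣ a - A ∣ < η → ∣ b - B ∣ < η → ∣ a * b - A * B ∣ < ε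
    bound a b pa pb = begin-strict
      ∣ a * b - A * B ∣
        ≈⟨ ∣∣-cong (telescope (a * b) (A * b) (A * B)) ⟨
      ∣ (a * b - A * b) + (A * b - A * B) ∣
        ≈⟨ ∣∣-cong (+-cong ([y-z]x≈yx-zx b a A) (x[y-z]≈xy-xz A b B)) ⟨
      ∣ (a - A) * b + A * (b - B) ∣
        ≤⟨ ∣x+y∣≤∣x∣+∣y∣ _ _ ⟩
      ∣ (a - A) * b ∣ + ∣ A * (b - B) ∣
        ≤⟨ +-mono-≤ (∣x*y∣≤∣x∣*∣y∣ _ _) (∣x*y∣≤∣x∣*∣y∣ _ _) ⟩
      ∣ a - A ∣ * ∣ b ∣ + ∣ A ∣ * ∣ b - B ∣
        ≤⟨ +-mono-≤ (*-monoʳ-≤ (0≤∣x∣ _) ∣b∣≤) (*-monoʳ-≤ (0≤∣x∣ A) (inj₁ pb)) ⟩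
      ∣ a - A ∣ * (1# + ∣ B ∣) + ∣ A ∣ * η
        ≤⟨ +-monoˡ-≤ _ (*-monoˡ-≤ (≤-trans (inj₁ 0<1) 1≤1+∣B∣) (inj₁ pa)) ⟩
      η * (1# + ∣ B ∣) + ∣ A ∣ * η
        ≈⟨ +-congˡ (*-comm ∣ A ∣ η) ⟩
      η * (1# + ∣ B ∣) + η * ∣ A ∣
        ≈⟨ distribˡ η _ _ ⟨
      η * K
        ≤⟨ *-monoˡ-≤ (inj₁ 0<K) η≤ε/K ⟩
      ((ε * ½) * recip K K≉0) * K
        ≈⟨ *-assoc _ _ _ ⟩
      (ε * ½) * (recip K K≉0 * K)
        ≈⟨ *-congˡ (trans (*-comm _ K) (recip-inverse K K≉0)) ⟩
      (ε * ½) * 1#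
        ≈⟨ *-identityʳ _ ⟩
      ε * ½
        <⟨ ½-< 0<ε ⟩
      ε ∎
      where
      ∣b∣≤ : ∣ b ∣ ≤ 1# + ∣ B ∣
      ∣b∣≤ = ≤-trans (∣x∣≤∣x-y∣+∣y∣ b B)
                     (+-monoˡ-≤ ∣ B ∣ (≤-trans (inj₁ pb) η≤1))

record Metric (ℝ : CompleteOrderedField) (S : Setoid 0ℓ 0ℓ) : Set where
  private
    module ℝ = CompleteOrderedField ℝ
    module S = Setoid S
  field
    dist            : S.Carrier → S.Carrier → ℝ.Carrier
    isGeneralMetric : IsGeneralMetric S._≈_ ℝ._≈_ ℝ._≤_ ℝ.0# ℝ._+_ dist

module MetricTopology (ℝ : CompleteOrderedField) (S : Setoid 0ℓ 0ℓ) (M : Metric ℝ S) where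

  open CompleteOrderedField ℝ using (0#; _<_) renaming (Carrier to R)
  open Setoid S using () renaming (Carrier to X)
  open Metric M

  Ball : X → R → Pred X 0ℓ
  Ball x ε y = dist x y < ε

  Interior : Pred X 0ℓ → Pred X 0ℓ
  Interior A x = ∃ λ ε → 0# < ε × Ball x ε ⊆ A

  Closure : Pred X 0ℓ → Pred X 0ℓ
  Closure A x = ∀ ε → 0# < ε → ∃ λ y → y ∈ A × y ∈ Ball x ε

  Open : Pred X 0ℓ → Set
  Open U = U ⊆ Interior U

  Dense : Pred X 0ℓ → Set
  Dense A = ∀ x → x ∈ Closure A

  SomewhereDense : Pred X 0ℓ → Set
  SomewhereDense A = Satisfiable (Interior (Closure A))

  NowhereDense : Pred X 0ℓ → Set
  NowhereDense A = Empty (Interior (Closure A))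

  Meager : Pred X 0ℓ → Set₁
  Meager A = ∃ λ (N : ℕ → Pred X 0ℓ) → (∀ n → NowhereDense (N n)) × A ⊆ ⋃ ℕ N

-- The metrics only serve to present the topologies of G and X. That these are
-- Polish is not part of the structure: turbulence does not refer to it.

record ContinuousAction (ℝ : CompleteOrderedField) : Set₁ where
  field
    group       : Group 0ℓ 0ℓ
    groupMetric : Metric ℝ (Group.setoid group)
    space       : Setoid 0ℓ 0ℓ
    spaceMetric : Metric ℝ space

  open CompleteOrderedField ℝ using (0#; _<_)
  open Group group public using (ε; _∙_) renaming (Carrier to G; _≈_ to _≈ᴳ_)
  open Setoid space public using () renaming (Carrier to X; _≈_ to _≈ˣ_)
  open Metric groupMetric public using () renaming (dist to distᴳ)
  open Metric spaceMetric public using () renaming (dist to distˣ)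

  infixr 7 _·_
  field
    _·_          : G → X → X
    ·-cong       : ∀ {g g′ x x′} → g ≈ᴳ g′ → x ≈ˣ x′ → g · x ≈ˣ g′ · x′
    ·-identity   : ∀ x → ε · x ≈ˣ x
    ·-assoc      : ∀ g h x → (g ∙ h) · x ≈ˣ g · (h · x)
    ·-continuous : ∀ g x e → 0# < e → ∃ λ d → 0# < d ×
                   (∀ g′ x′ → distᴳ g g′ < d → distˣ x x′ < d →
                    distˣ (g · x) (g′ · x′) < e)

module Turbulence (ℝ : CompleteOrderedField) (A : ContinuousAction ℝ) where

  open ContinuousAction A
  private
    module Topᴳ = MetricTopology ℝ (Group.setoid group) groupMetric
    module Topˣ = MetricTopology ℝ space spaceMetric

  Orbit : X → Pred X 0ℓ
  Orbit x y = ∃ λ g → g · x ≈ˣ y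

  -- The chain x₁, …, x_l is indexed from zero, with l = suc n.
  LocalOrbit : X → Pred X 0ℓ → Pred G 0ℓ → Pred X 0ℓ
  LocalOrbit x U V y = y ∈ U × (∃ λ (n : ℕ) →
    ∃ λ (points : Fin (suc n) → X) → ∃ λ (g : Fin n → G) →
      points zero ≈ˣ x × points (fromℕ n) ≈ˣ y
      × (∀ i → points i ∈ U) × (∀ i → g i ∈ V)
      × (∀ i → points (suc i) ≈ˣ g i · points (inject₁ i)))

  record Turbulent : Set₁ where
    field
      orbits-meager              : ∀ x → Topˣ.Meager (Orbit x)
      orbits-dense               : ∀ x → Topˣ.Dense (Orbit x)
      local-orbits-somewhere-dense :
        ∀ (U : Pred X 0ℓ) → Topˣ.Open U → ∀ x → x ∈ U →
        ∀ (V : Pred G 0ℓ) → Topᴳ.Open V → ε ∈ V →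
        Topˣ.SomewhereDense (LocalOrbit x U V)

module UnitInterval (ℝ : CompleteOrderedField) where

  open CompleteOrderedField ℝ
  open FieldProperties ℝ using (x≉y⇒x-y≉0)

  record 𝕀 : Set where
    constructor point
    field
      value   : Carrier
      0≤value : 0# ≤ value
      value≤1 : value ≤ 1#

  open 𝕀 public

  𝕀-setoid : Setoid 0ℓ 0ℓ
  𝕀-setoid = On.setoid setoid value

  Continuous : (𝕀 → Carrier) → Set
  Continuous φ = ∀ t ε → 0# < ε → ∃ λ δ → 0# < δ ×
    (∀ s → ∣ value s - value t ∣ < δ → ∣ φ s - φ t ∣ < ε)

  -- D is the limit of the difference quotients of φ at t; since s ranges over
  -- [0,1] only, this is the one-sided derivative at the endpoints.
  HasDerivative : (𝕀 → Carrier) → 𝕀 → Carrier → Set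
  HasDerivative φ t D = ∀ ε → 0# < ε → ∃ λ δ → 0# < δ ×
    (∀ s (s≉t : ¬ value s ≈ value t) → ∣ value s - value t ∣ < δ →
     ∣ (φ s - φ t) * recip (value s - value t) (x≉y⇒x-y≉0 s≉t) - D ∣ < ε)

  record ContinuousFunction : Set where
    field
      fun        : 𝕀 → Carrier
      continuous : Continuous fun

  open ContinuousFunction public

  record IncreasingHomeo : Set where
    field
      bijection : Inverse 𝕀-setoid 𝕀-setoid

    open Inverse bijection public

    field
      to-continuous   : Continuous (value ∘ to)
      from-continuous : Continuous (value ∘ from)
      increasing      : ∀ {s t} → value s < value t → value (to s) < value (to t)

  record Diffeo : Set where
    field
      homeo : IncreasingHomeo

    open IncreasingHomeo homeo public

    field
      to-deriv       : ContinuousFunction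
      to-hasDeriv    : ∀ t → HasDerivative (value ∘ to) t (fun to-deriv t)
      from-deriv     : ContinuousFunction
      from-hasDeriv  : ∀ t → HasDerivative (value ∘ from) t (fun from-deriv t)

  _≈ᴴ_ : Rel IncreasingHomeo 0ℓ
  f ≈ᴴ g = ∀ t → value (IncreasingHomeo.to f t) ≈ value (IncreasingHomeo.to g t)

  ContinuousFunction-setoid : Setoid 0ℓ 0ℓ
  ContinuousFunction-setoid = record
    { Carrier = ContinuousFunction
    ; _≈_ = λ φ ψ → ∀ t → fun φ t ≈ fun ψ t
    ; isEquivalence = record
      { refl = λ t → refl
      ; sym = λ p t → sym (p t)
      ; trans = λ p q t → trans (p t) (q t)
      }
    }

  IncreasingHomeo-setoid : Setoid 0ℓ 0ℓ
  IncreasingHomeo-setoid = record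
    { Carrier = IncreasingHomeo
    ; _≈_ = _≈ᴴ_
    ; isEquivalence = record
      { refl = λ t → refl
      ; sym = λ p t → sym (p t)
      ; trans = λ p q t → trans (p t) (q t)
      }
    }

  Diffeo-setoid : Setoid 0ℓ 0ℓ
  Diffeo-setoid = On.setoid IncreasingHomeo-setoid Diffeo.homeo

  toContinuous : IncreasingHomeo → ContinuousFunction
  toContinuous f = record { fun = value ∘ to ; continuous = to-continuous }
    where open IncreasingHomeo f

module DiffeoGroup (ℝ : CompleteOrderedField) where

  open CompleteOrderedField ℝ
  open FieldProperties ℝ
  open UnitInterval ℝ
  open StrictReasoning strictPartialOrder

  continuous-∘ : ∀ {φ : 𝕀 → Carrier} {g : 𝕀 → 𝕀} →
                 Continuous φ → Continuous (value ∘ g) → Continuous (φ ∘ g)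
  continuous-∘ {g = g} cφ cg t ε 0<ε =
    let δ , 0<δ , p = cφ (g t) ε 0<ε
        η , 0<η , q = cg t δ 0<δ
    in η , 0<η , λ s s~t → p (g s) (q s s~t)

  continuous-* : ∀ {φ ψ : 𝕀 → Carrier} →
                 Continuous φ → Continuous ψ → Continuous (λ t → φ t * ψ t)
  continuous-* {φ} {ψ} cφ cψ t ε 0<ε =
    let η , 0<η , prod = product-continuous (φ t) (ψ t) 0<ε
        δ₁ , 0<δ₁ , p = cφ t η 0<η
        δ₂ , 0<δ₂ , q = cψ t η 0<η
        δ , 0<δ , δ≤δ₁ , δ≤δ₂ = common-bound 0<δ₁ 0<δ₂
    in δ , 0<δ , λ s s~t →
         prod _ _ (p s (<-≤-trans s~t δ≤δ₁)) (q s (<-≤-trans s~t δ≤δ₂))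

  chain-rule : ∀ {φ : 𝕀 → Carrier} {g : 𝕀 → 𝕀} {t D E} →
               (∀ {s u} → ¬ value s ≈ value u → ¬ value (g s) ≈ value (g u)) →
               Continuous (value ∘ g) →
               HasDerivative φ (g t) D → HasDerivative (value ∘ g) t E →
               HasDerivative (φ ∘ g) t (D * E)
  chain-rule {φ} {g} {t} {D} {E} inj cg dφ dg ε 0<ε =
    let η , 0<η , prod = product-continuous D E 0<ε
        δ₀ , 0<δ₀ , p = dφ η 0<η
        δ₁ , 0<δ₁ , q = cg t δ₀ 0<δ₀
        δ₂ , 0<δ₂ , r = dg η 0<η
        δ , 0<δ , δ≤δ₁ , δ≤δ₂ = common-bound 0<δ₁ 0<δ₂
    in δ , 0<δ , λ s s≉t s~t →
         <-respˡ-≈ (∣∣-cong (+-congʳ (sym (split s s≉t))))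
           (prod _ _ (p (g s) (inj s≉t) (q s (<-≤-trans s~t δ≤δ₁)))
                     (r s s≉t (<-≤-trans s~t δ≤δ₂)))
    where
    split : ∀ s s≉t →
      (φ (g s) - φ (g t)) * recip (value s - value t) (x≉y⇒x-y≉0 s≉t)
      ≈ ((φ (g s) - φ (g t)) * recip (value (g s) - value (g t)) (x≉y⇒x-y≉0 (inj s≉t)))
        * ((value (g s) - value (g t)) * recip (value s - value t) (x≉y⇒x-y≉0 s≉t))
    split s s≉t = sym (begin-equality
      (a * q) * (b * r)   ≈⟨ *-assoc a q (b * r) ⟩
      a * (q * (b * r))   ≈⟨ *-congˡ (*-assoc q b r) ⟨
      a * ((q * b) * r)   ≈⟨ *-congˡ (*-congʳ (trans (*-comm q b) (recip-inverse b _))) ⟩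
      a * (1# * r)        ≈⟨ *-congˡ (*-identityˡ r) ⟩
      a * r               ∎)
      where
      a = φ (g s) - φ (g t)
      b = value (g s) - value (g t)
      q = recip b (x≉y⇒x-y≉0 (inj s≉t))
      r = recip (value s - value t) (x≉y⇒x-y≉0 s≉t)

  module _ (f : IncreasingHomeo) where
    open IncreasingHomeo f

    to-injective : ∀ {s u} → ¬ value s ≈ value u → ¬ value (to s) ≈ value (to u)
    to-injective {s} {u} s≉u eq = s≉u (trans (sym (strictlyInverseʳ s))
      (trans (from-cong eq) (strictlyInverseʳ u)))

    from-injective : ∀ {s u} → ¬ value s ≈ value u → ¬ value (from s) ≈ value (from u)
    from-injective {s} {u} s≉u eq = s≉u (trans (sym (strictlyInverseˡ s))
      (trans (to-cong eq) (strictlyInverseˡ u)))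

    from-increasing : ∀ {s t} → value s < value t → value (from s) < value (from t)
    from-increasing {s} {t} s<t with compare (value (from s)) (value (from t))
    ... | tri< p _ _ = p
    ... | tri≈ _ p _ = ⊥-elim (from-injective (λ eq → <-irrefl eq s<t) p)
    ... | tri> _ _ p = ⊥-elim (<-asym s<t (<-respˡ-≈ (strictlyInverseˡ t)
                         (<-respʳ-≈ (strictlyInverseˡ s) (increasing p))))

  continuous-id : Continuous value
  continuous-id t ε 0<ε = ε , 0<ε , λ s s~t → s~t

  continuous-1 : Continuous (λ _ → 1#)
  continuous-1 t ε 0<ε = ε , 0<ε , λ s s~t →
    <-respˡ-≈ (sym (x≈0⇒∣x∣≈0 (-‿inverseʳ 1#))) 0<ε

  derivative-id : ∀ t → HasDerivative value t 1#
  derivative-id t ε 0<ε = ε , 0<ε , λ s s≉t s~t →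
    <-respˡ-≈ (sym (x≈0⇒∣x∣≈0 (trans (+-congʳ (recip-inverse _ (x≉y⇒x-y≉0 s≉t))) (-‿inverseʳ 1#)))) 0<ε

  idᴴ : IncreasingHomeo
  idᴴ = record
    { bijection = Ident.inverse 𝕀-setoid
    ; to-continuous = continuous-id
    ; from-continuous = continuous-id
    ; increasing = λ s<t → s<t
    }

  _⁻¹ᴴ : IncreasingHomeo → IncreasingHomeo
  f ⁻¹ᴴ = record
    { bijection = Symm.inverse bijection
    ; to-continuous = from-continuous
    ; from-continuous = to-continuous
    ; increasing = from-increasing f
    }
    where open IncreasingHomeo f

  _∘ᴴ_ : IncreasingHomeo → IncreasingHomeo → IncreasingHomeo
  f ∘ᴴ g = record
    { bijection = Comp.inverse G.bijection F.bijection
    ; to-continuous = continuous-∘ {g = G.to} F.to-continuous G.to-continuous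
    ; from-continuous = continuous-∘ {g = F.from} G.from-continuous F.from-continuous
    ; increasing = λ s<t → F.increasing (G.increasing s<t)
    }
    where
    module F = IncreasingHomeo f
    module G = IncreasingHomeo g

  idᴰ : Diffeo
  idᴰ = record
    { homeo = idᴴ
    ; to-deriv = record { fun = λ _ → 1# ; continuous = continuous-1 }
    ; to-hasDeriv = derivative-id
    ; from-deriv = record { fun = λ _ → 1# ; continuous = continuous-1 }
    ; from-hasDeriv = derivative-id
    }

  _⁻¹ᴰ : Diffeo → Diffeo
  f ⁻¹ᴰ = record
    { homeo = homeo ⁻¹ᴴ
    ; to-deriv = from-deriv
    ; to-hasDeriv = from-hasDeriv
    ; from-deriv = to-deriv
    ; from-hasDeriv = to-hasDeriv
    }
    where open Diffeo f

  _∘ᴰ_ : Diffeo → Diffeo → Diffeo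
  f ∘ᴰ g = record
    { homeo = F.homeo ∘ᴴ G.homeo
    ; to-deriv = record
      { fun = λ t → fun F.to-deriv (G.to t) * fun G.to-deriv t
      ; continuous = continuous-* (continuous-∘ {g = G.to} (continuous F.to-deriv) G.to-continuous)
                                  (continuous G.to-deriv)
      }
    ; to-hasDeriv = λ t → chain-rule {g = G.to} (to-injective G.homeo) G.to-continuous
                            (F.to-hasDeriv (G.to t)) (G.to-hasDeriv t)
    ; from-deriv = record
      { fun = λ t → fun G.from-deriv (F.from t) * fun F.from-deriv t
      ; continuous = continuous-* (continuous-∘ {g = F.from} (continuous G.from-deriv) F.from-continuous)
                                  (continuous F.from-deriv)
      }
    ; from-hasDeriv = λ t → chain-rule {g = F.from} (from-injective F.homeo) F.from-continuous
                              (G.from-hasDeriv (F.from t)) (F.from-hasDeriv t)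
    }
    where
    module F = Diffeo f
    module G = Diffeo g

  ∘ᴴ-cong : ∀ {f f′ g g′} → f ≈ᴴ f′ → g ≈ᴴ g′ → (f ∘ᴴ g) ≈ᴴ (f′ ∘ᴴ g′)
  ∘ᴴ-cong {f} {f′} {g} {g′} p q t =
    trans (IncreasingHomeo.to-cong f (q t)) (p (IncreasingHomeo.to g′ t))

  ⁻¹ᴴ-cong : ∀ {f g} → f ≈ᴴ g → (f ⁻¹ᴴ) ≈ᴴ (g ⁻¹ᴴ)
  ⁻¹ᴴ-cong {f} {g} p t = begin-equality
    value (F.from t)                 ≈⟨ G.strictlyInverseʳ (F.from t) ⟨
    value (G.from (G.to (F.from t))) ≈⟨ G.from-cong (p (F.from t)) ⟨
    value (G.from (F.to (F.from t))) ≈⟨ G.from-cong (F.strictlyInverseˡ t) ⟩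
    value (G.from t)                 ∎
    where
    module F = IncreasingHomeo f
    module G = IncreasingHomeo g

  diffeoGroup : Group 0ℓ 0ℓ
  diffeoGroup = record
    { Carrier = Diffeo
    ; _≈_ = Setoid._≈_ Diffeo-setoid
    ; _∙_ = _∘ᴰ_
    ; ε = idᴰ
    ; _⁻¹ = _⁻¹ᴰ
    ; isGroup = record
      { isMonoid = record
        { isSemigroup = record
          { isMagma = record
            { isEquivalence = Setoid.isEquivalence Diffeo-setoid
            ; ∙-cong = λ {f} {f′} {g} {g′} p q → ∘ᴴ-cong {Diffeo.homeo f} {Diffeo.homeo f′}
                                                   {Diffeo.homeo g} {Diffeo.homeo g′} p q
            }
          ; assoc = λ f g h t → refl
          }
        ; identity = (λ f t → refl) , (λ f t → refl)
        }
      ; inverse = (λ f → Diffeo.strictlyInverseʳ f) , (λ f → Diffeo.strictlyInverseˡ f)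
      ; ⁻¹-cong = λ {f} {g} → ⁻¹ᴴ-cong {Diffeo.homeo f} {Diffeo.homeo g}
      }
    }

-- Excluded middle is used to see that continuous functions on [0,1] are
-- bounded and uniformly continuous.

module Shift (em : ExcludedMiddle 0ℓ) (ℝ : CompleteOrderedField) where

  open CompleteOrderedField ℝ
  open FieldProperties ℝ
  open UnitInterval ℝ
  open DiffeoGroup ℝ
  open StrictReasoning strictPartialOrder

  0𝕀 1𝕀 : 𝕀
  0𝕀 = point 0# ≤-refl (inj₁ 0<1)
  1𝕀 = point 1# (inj₁ 0<1) ≤-refl

  interval-induction : (P : 𝕀 → Set) → P 0𝕀 →
    (∀ s → ∃ λ δ → 0# < δ × (∀ p r → P p → value s < δ + value p →
                              value r < δ + value s → P r)) →
    P 1𝕀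
  interval-induction P P0 step = conclude (<-or-≥ 1# (δ + value s))
    where
    S : Pred Carrier 0ℓ
    S x = ∃ λ p → x ≈ value p × P p
    sup = supremum S (0# , 0𝕀 , refl , P0)
            (1# , λ { (p , x≈p , _) → ≤-respˡ-≈ (sym x≈p) (value≤1 p) })
    upper : ∀ p → P p → value p ≤ proj₁ sup
    upper p Pp = proj₁ (proj₂ sup) (p , refl , Pp)
    s : 𝕀
    s = point (proj₁ sup) (upper 0𝕀 P0)
          (proj₂ (proj₂ sup) λ { (p , x≈p , _) → ≤-respˡ-≈ (sym x≈p) (value≤1 p) })
    δ = proj₁ (step s)
    0<δ = proj₁ (proj₂ (step s))
    s<δ+s : value s < δ + value s
    s<δ+s = <-respˡ-≈ (+-identityˡ _) (+-monoˡ-< (value s) 0<δ)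
    near : ∃ λ p → P p × value s < δ + value p
    near with em {P = ∃ λ p → P p × value s < δ + value p}
    ... | yes found = found
    ... | no none = ⊥-elim (≤⇒≯ (proj₂ (proj₂ sup) bound) s-δ<s)
      where
      s-δ<s : value s - δ < value s
      s-δ<s = x<z+y⇒x-y<z (<-respʳ-≈ (+-comm _ _) s<δ+s)
      bound : IsUpperBound S (value s - δ)
      bound {x} (p , x≈p , Pp) = ≤-respˡ-≈ (sym x≈p) (≮⇒≥ λ s-δ<p →
        none (p , Pp , <-respʳ-≈ (+-comm _ _) (x-y<z⇒x<z+y s-δ<p)))
    extend : ∀ r → value r < δ + value s → P r
    extend r = proj₂ (proj₂ (step s)) (proj₁ near) r (proj₁ (proj₂ near)) (proj₂ (proj₂ near))
    conclude : 1# < δ + value s ⊎ δ + value s ≤ 1# → P 1𝕀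
    conclude (inj₁ 1<δ+s) = extend 1𝕀 1<δ+s
    conclude (inj₂ δ+s≤1) = ⊥-elim (≤⇒≯ (upper r (extend r r<δ+s)) s<r)
      where
      between = dense s<δ+s
      s<r = proj₁ (proj₂ between)
      r<δ+s = proj₂ (proj₂ between)
      r : 𝕀
      r = point (proj₁ between) (≤-trans (0≤value s) (inj₁ s<r))
            (≤-trans (inj₁ r<δ+s) δ+s≤1)

  bounded : (φ : ContinuousFunction) → ∃ λ M → ∀ t → ∣ fun φ t ∣ ≤ M
  bounded φ = let M , b = all in M , λ t → b t (value≤1 t)
    where
    P : 𝕀 → Set
    P r = ∃ λ M → ∀ t → value t ≤ value r → ∣ fun φ t ∣ ≤ M
    local : ∀ s → ∃ λ δ → 0# < δ ×
            (∀ t → ∣ value t - value s ∣ < δ → ∣ fun φ t ∣ ≤ 1# + ∣ fun φ s ∣)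
    local s = let δ , 0<δ , c = continuous φ s 1# 0<1 in
      δ , 0<δ , λ t t~s → ≤-trans (∣x∣≤∣x-y∣+∣y∣ _ _) (+-monoˡ-≤ _ (inj₁ (c t t~s)))
    base : P 0𝕀
    base = let δ , 0<δ , c = local 0𝕀 in 1# + ∣ fun φ 0𝕀 ∣ , λ t t≤0 →
      c t (<-respˡ-≈ (sym (x≈0⇒∣x∣≈0 (trans (+-congʳ (antisym t≤0 (0≤value t))) (-‿inverseʳ 0#)))) 0<δ)
    all : P 1𝕀
    all = interval-induction P base λ s → let δ , 0<δ , c = local s in
      δ , 0<δ , λ { p r (M , b) s<δ+p r<δ+s →
        M ⊔ (1# + ∣ fun φ s ∣) , λ t t≤r → case-bound s δ c p r M b s<δ+p r<δ+s t t≤r (<-or-≥ (value p) (value t)) }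
      where
      case-bound : ∀ s δ → (∀ t → ∣ value t - value s ∣ < δ → ∣ fun φ t ∣ ≤ 1# + ∣ fun φ s ∣) →
        ∀ p r M → (∀ t → value t ≤ value p → ∣ fun φ t ∣ ≤ M) →
        value s < δ + value p → value r < δ + value s →
        ∀ t → value t ≤ value r → value p < value t ⊎ value t ≤ value p →
        ∣ fun φ t ∣ ≤ M ⊔ (1# + ∣ fun φ s ∣)
      case-bound s δ c p r M b s<δ+p r<δ+s t t≤r (inj₁ p<t) =
        ≤-trans (c t (within (≤-<-trans t≤r r<δ+s) (<-trans s<δ+p (+-monoʳ-< δ p<t)))) (x≤y⊔x M _)
      case-bound s δ c p r M b s<δ+p r<δ+s t t≤r (inj₂ t≤p) =
        ≤-trans (b t t≤p) (x≤x⊔y M _)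

  uniformly-continuous : (φ : ContinuousFunction) → ∀ ε → 0# < ε → ∃ λ δ → 0# < δ ×
    (∀ t u → ∣ value t - value u ∣ < δ → ∣ fun φ t - fun φ u ∣ < ε)
  uniformly-continuous φ ε 0<ε =
    let δ , 0<δ , b = interval-induction P base step
    in δ , 0<δ , λ t u → b t u (value≤1 t) (value≤1 u)
    where
    P : 𝕀 → Set
    P r = ∃ λ δ → 0# < δ × (∀ t u → value t ≤ value r → value u ≤ value r →
            ∣ value t - value u ∣ < δ → ∣ fun φ t - fun φ u ∣ < ε)
    local : ∀ s → ∃ λ δ → 0# < δ × (∀ t u → ∣ value t - value s ∣ < δ →
              ∣ value u - value s ∣ < δ → ∣ fun φ t - fun φ u ∣ < ε)
    local s = let δ , 0<δ , c = continuous φ s (ε * ½) (½-pos 0<ε) in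
      δ , 0<δ , λ t u t~s u~s → begin-strict
        ∣ fun φ t - fun φ u ∣
          ≤⟨ ∣∣-triangle _ (fun φ s) _ ⟩
        ∣ fun φ t - fun φ s ∣ + ∣ fun φ s - fun φ u ∣
          ≈⟨ +-congˡ (∣x-y∣≈∣y-x∣ _ _) ⟩
        ∣ fun φ t - fun φ s ∣ + ∣ fun φ u - fun φ s ∣
          <⟨ +-mono-< (c t t~s) (c u u~s) ⟩
        ε * ½ + ε * ½
          ≈⟨ ½+½ ε ⟩
        ε ∎
    base : P 0𝕀
    base = let δ , 0<δ , c = local 0𝕀 in 1# , 0<1 , λ t u t≤0 u≤0 _ →
      c t u (at0 t t≤0 0<δ) (at0 u u≤0 0<δ)
      where
      at0 : ∀ t → value t ≤ 0# → ∀ {δ} → 0# < δ → ∣ value t - 0# ∣ < δ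
      at0 t t≤0 = <-respˡ-≈ (sym (x≈0⇒∣x∣≈0
        (trans (+-congʳ (antisym t≤0 (0≤value t))) (-‿inverseʳ 0#))))
    step : ∀ s → ∃ λ δ → 0# < δ × (∀ p r → P p → value s < δ + value p →
             value r < δ + value s → P r)
    step s = let δ , 0<δ , c = local s in δ , 0<δ , extend δ c
      where
      extend : ∀ δ → (∀ t u → ∣ value t - value s ∣ < δ →
                 ∣ value u - value s ∣ < δ → ∣ fun φ t - fun φ u ∣ < ε) →
               ∀ p r → P p → value s < δ + value p → value r < δ + value s → P r
      extend δ c p r (δ₁ , 0<δ₁ , b) s<δ+p r<δ+s = η , 0<η , λ t u t≤r u≤r t~u →
          cases t u t≤r u≤r t~u (<-or-≥ (value p) (value t)) (<-or-≥ (value p) (value u))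
        where
        choice = common-bound 0<δ₁ (x<y⇒0<y-x s<δ+p)
        η = proj₁ choice
        0<η = proj₁ (proj₂ choice)
        η≤δ₁ = proj₁ (proj₂ (proj₂ choice))
        η≤gap : η ≤ (δ + value p) - value s
        η≤gap = proj₂ (proj₂ (proj₂ choice))
        -- a point at distance < η from a point beyond p lies beyond s - δ
        beyond : ∀ t u → value p < value t → ∣ value t - value u ∣ < η → value s < δ + value u
        beyond t u p<t t~u = begin-strict
          value s                             ≈⟨ x+y-y≈x (value s) η ⟨
          (value s + η) - η                   ≤⟨ +-monoˡ-≤ (- η) (≤-trans (+-monoʳ-≤ (value s) η≤gap) (inj₂ (trans (+-comm _ _) (x-y+y≈x _ (value s))))) ⟩
          (δ + value p) - η                   <⟨ +-monoˡ-< (- η) (+-monoʳ-< δ (<-trans p<t (∣∣<⇒<+ t~u))) ⟩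
          (δ + (η + value u)) - η             ≈⟨ +-congʳ (+-congˡ (+-comm η (value u))) ⟩
          (δ + (value u + η)) - η             ≈⟨ +-congʳ (+-assoc δ (value u) η) ⟨
          ((δ + value u) + η) - η             ≈⟨ x+y-y≈x (δ + value u) η ⟩
          δ + value u                         ∎
        close : ∀ t → value t ≤ value r → value s < δ + value t → ∣ value t - value s ∣ < δ
        close t t≤r s<δ+t = within (≤-<-trans t≤r r<δ+s) s<δ+t
        beyond-p : ∀ t → value p < value t → value s < δ + value t
        beyond-p t p<t = <-trans s<δ+p (+-monoʳ-< δ p<t)
        cases : ∀ t u → value t ≤ value r → value u ≤ value r → ∣ value t - value u ∣ < η →
          value p < value t ⊎ value t ≤ value p → value p < value u ⊎ value u ≤ value p →
          ∣ fun φ t - fun φ u ∣ < ε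
        cases t u t≤r u≤r t~u (inj₁ p<t) _ =
          c t u (close t t≤r (beyond-p t p<t)) (close u u≤r (beyond t u p<t t~u))
        cases t u t≤r u≤r t~u (inj₂ t≤p) (inj₁ p<u) =
          c t u (close t t≤r (beyond u t p<u (<-respˡ-≈ (∣x-y∣≈∣y-x∣ _ _) t~u)))
                (close u u≤r (beyond-p u p<u))
        cases t u t≤r u≤r t~u (inj₂ t≤p) (inj₂ u≤p) = b t u t≤p u≤p (<-≤-trans t~u η≤δ₁)

  Differences : ContinuousFunction → ContinuousFunction → Pred Carrier 0ℓ
  Differences φ ψ x = ∃ λ t → x ≈ ∣ fun φ t - fun ψ t ∣

  Differences-bounded : ∀ φ ψ → ∃ (IsUpperBound (Differences φ ψ))
  Differences-bounded φ ψ = M + N , λ { (t , x≈) → begin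
      _                                            ≈⟨ x≈ ⟩
      ∣ fun φ t - fun ψ t ∣                        ≤⟨ ∣x+y∣≤∣x∣+∣y∣ _ _ ⟩
      ∣ fun φ t ∣ + ∣ - fun ψ t ∣                  ≈⟨ +-congˡ (∣-x∣≈∣x∣ _) ⟩
      ∣ fun φ t ∣ + ∣ fun ψ t ∣                    ≤⟨ +-mono-≤ (proj₂ (bounded φ) t) (proj₂ (bounded ψ) t) ⟩
      M + N                                        ∎ }
    where
    M = proj₁ (bounded φ)
    N = proj₁ (bounded ψ)

  -- Opaque only to keep type checking fast: dist∞-upper and dist∞-least
  -- characterise the supremum.
  opaque
    sup-Differences : ∀ φ ψ → ∃ λ s → IsUpperBound (Differences φ ψ) s ×
                        (∀ {b} → IsUpperBound (Differences φ ψ) b → s ≤ b)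
    sup-Differences φ ψ = supremum (Differences φ ψ)
      (∣ fun φ 0𝕀 - fun ψ 0𝕀 ∣ , 0𝕀 , refl) (Differences-bounded φ ψ)

  dist∞ : ContinuousFunction → ContinuousFunction → Carrier
  dist∞ φ ψ = proj₁ (sup-Differences φ ψ)

  dist∞-upper : ∀ φ ψ t → ∣ fun φ t - fun ψ t ∣ ≤ dist∞ φ ψ
  dist∞-upper φ ψ t = proj₁ (proj₂ (sup-Differences φ ψ)) (t , refl)

  dist∞-least : ∀ φ ψ {b} → (∀ t → ∣ fun φ t - fun ψ t ∣ ≤ b) → dist∞ φ ψ ≤ b
  dist∞-least φ ψ h = proj₂ (proj₂ (sup-Differences φ ψ))
    λ { (t , x≈) → ≤-respˡ-≈ (sym x≈) (h t) }

  private
    module Cf = Setoid ContinuousFunction-setoid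

  dist∞-nonNegative : ∀ {φ ψ} → 0# ≤ dist∞ φ ψ
  dist∞-nonNegative {φ} {ψ} = ≤-trans (0≤∣x∣ _) (dist∞-upper φ ψ 0𝕀)

  dist∞-triangle : ∀ φ χ ψ → dist∞ φ ψ ≤ dist∞ φ χ + dist∞ χ ψ
  dist∞-triangle φ χ ψ = dist∞-least φ ψ λ t →
    ≤-trans (∣∣-triangle _ (fun χ t) _) (+-mono-≤ (dist∞-upper φ χ t) (dist∞-upper χ ψ t))

  dist∞-sym : ∀ φ ψ → dist∞ φ ψ ≈ dist∞ ψ φ
  dist∞-sym φ ψ = antisym (half φ ψ) (half ψ φ)
    where
    half : ∀ φ ψ → dist∞ φ ψ ≤ dist∞ ψ φ
    half φ ψ = dist∞-least φ ψ λ t →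
      ≤-trans (inj₂ (∣x-y∣≈∣y-x∣ _ _)) (dist∞-upper ψ φ t)

  dist∞-definite : ∀ {φ ψ} → φ Cf.≈ ψ → dist∞ φ ψ ≈ 0#
  dist∞-definite {φ} {ψ} eq = antisym
    (dist∞-least φ ψ λ t → inj₂ (x≈0⇒∣x∣≈0 (trans (+-congʳ (eq t)) (-‿inverseʳ _))))
    (dist∞-nonNegative {φ} {ψ})

  dist∞-indiscernable : ∀ {φ ψ} → dist∞ φ ψ ≈ 0# → φ Cf.≈ ψ
  dist∞-indiscernable {φ} {ψ} eq t =
    x-y≈0⇒x≈y (∣x∣≤0⇒x≈0 (≤-trans (dist∞-upper φ ψ t) (inj₂ eq)))

  dist∞-cong : ∀ {φ φ′ ψ ψ′} → φ Cf.≈ φ′ → ψ Cf.≈ ψ′ → dist∞ φ ψ ≈ dist∞ φ′ ψ′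
  dist∞-cong {φ} {φ′} {ψ} {ψ′} p q = antisym
    (dist∞-least φ ψ λ t → ≤-trans (inj₂ (∣∣-cong (+-cong (p t) (-‿cong (q t)))))
                                   (dist∞-upper φ′ ψ′ t))
    (dist∞-least φ′ ψ′ λ t → ≤-trans (inj₂ (∣∣-cong (+-cong (sym (p t)) (-‿cong (sym (q t))))))
                                     (dist∞-upper φ ψ t))

  homeoMetric : Metric ℝ IncreasingHomeo-setoid
  homeoMetric = record
    { dist = λ f g → dist∞ (toContinuous f) (toContinuous g)
    ; isGeneralMetric = record
      { isSemiMetric = record
        { isQuasiSemiMetric = record
          { isPreMetric = record
            { isProtoMetric = record
              { isPartialOrder = ≤-isPartialOrder
              ; ≈-isEquivalence = Setoid.isEquivalence IncreasingHomeo-setoid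
              ; cong = λ {f} {f′} {g} {g′} → dist∞-cong {toContinuous f} {toContinuous f′}
                                               {toContinuous g} {toContinuous g′}
              ; nonNegative = λ {f} {g} → dist∞-nonNegative {toContinuous f} {toContinuous g}
              }
            ; ≈⇒0 = λ {f} {g} → dist∞-definite {toContinuous f} {toContinuous g}
            }
          ; 0⇒≈ = λ {f} {g} → dist∞-indiscernable {toContinuous f} {toContinuous g}
          }
        ; sym = λ f g → dist∞-sym (toContinuous f) (toContinuous g)
        }
      ; triangle = λ f g h → dist∞-triangle (toContinuous f) (toContinuous g) (toContinuous h)
      }
    }

  accumulation : ∀ t δ → 0# < δ →
    ∃ λ s → (¬ value s ≈ value t) × ∣ value s - value t ∣ < δ
  accumulation t δ 0<δ with <-or-≥ (value t) 1#
  ... | inj₁ t<1 =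
    let gap , 0<gap , gap≤δ , gap≤1-t = common-bound 0<δ (x<y⇒0<y-x t<1)
        x , t<x , x<gap+t = dense (<-respˡ-≈ (+-identityˡ _) (+-monoˡ-< (value t) 0<gap))
        x≤1 = ≤-trans (inj₁ x<gap+t) (≤-respʳ-≈ (x-y+y≈x 1# (value t)) (+-monoˡ-≤ (value t) gap≤1-t))
        t<δ+x = <-trans t<x (<-respˡ-≈ (+-identityˡ x) (+-monoˡ-< x 0<δ))
    in point x (≤-trans (0≤value t) (inj₁ t<x)) x≤1 , (λ x≈t → <-irrefl (sym x≈t) t<x) ,
       within (<-≤-trans x<gap+t (+-monoˡ-≤ (value t) gap≤δ)) t<δ+x
  ... | inj₂ 1≤t =
    let gap , 0<gap , gap≤δ , gap≤1 = common-bound 0<δ 0<1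
        t-gap<t : value t - gap < value t
        t-gap<t = <-respʳ-≈ (trans (+-comm _ _) (x-y+y≈x (value t) gap))
                    (<-respˡ-≈ (+-identityˡ _) (+-monoˡ-< (value t - gap) 0<gap))
        x , t-gap<x , x<t = dense t-gap<t
        0≤t-gap = ≤-respˡ-≈ (-‿inverseʳ gap) (+-monoˡ-≤ (- gap) (≤-trans gap≤1 1≤t))
        x<δ+t = <-trans x<t (<-respˡ-≈ (+-identityˡ _) (+-monoˡ-< (value t) 0<δ))
        t<x+gap = x-y<z⇒x<z+y t-gap<x
    in point x (≤-trans 0≤t-gap (inj₁ t-gap<x)) (≤-trans (inj₁ x<t) (value≤1 t)) ,
       (λ x≈t → <-irrefl x≈t x<t) ,
       within x<δ+t (<-respʳ-≈ (+-comm x δ) (<-≤-trans t<x+gap (+-monoʳ-≤ x gap≤δ)))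

  derivative-unique : ∀ {φ ψ : 𝕀 → Carrier} {t D E} → (∀ s → φ s ≈ ψ s) →
    HasDerivative φ t D → HasDerivative ψ t E → D ≈ E
  derivative-unique {φ} {ψ} {t} {D} {E} φ≈ψ dφ dψ = ∣x-y∣-small⇒≈ λ ε 0<ε →
    let δ₁ , 0<δ₁ , p = dφ (ε * ½) (½-pos 0<ε)
        δ₂ , 0<δ₂ , q = dψ (ε * ½) (½-pos 0<ε)
        δ , 0<δ , δ≤δ₁ , δ≤δ₂ = common-bound 0<δ₁ 0<δ₂
        s , s≉t , s~t = accumulation t δ 0<δ
        r = recip (value s - value t) (x≉y⇒x-y≉0 s≉t)
    in begin-strict
      ∣ D - E ∣
        ≤⟨ ∣∣-triangle D ((φ s - φ t) * r) E ⟩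
      ∣ D - (φ s - φ t) * r ∣ + ∣ (φ s - φ t) * r - E ∣
        ≈⟨ +-cong (∣x-y∣≈∣y-x∣ _ _) (∣∣-cong (+-congʳ (*-congʳ (+-cong (φ≈ψ s) (-‿cong (φ≈ψ t)))))) ⟩
      ∣ (φ s - φ t) * r - D ∣ + ∣ (ψ s - ψ t) * r - E ∣
        <⟨ +-mono-< (p s s≉t (<-≤-trans s~t δ≤δ₁)) (q s s≉t (<-≤-trans s~t δ≤δ₂)) ⟩
      ε * ½ + ε * ½
        ≈⟨ ½+½ ε ⟩
      ε ∎

  to-deriv-cong : ∀ f g → Diffeo.homeo f ≈ᴴ Diffeo.homeo g →
                  Diffeo.to-deriv f Cf.≈ Diffeo.to-deriv g
  to-deriv-cong f g eq t = derivative-unique eq (Diffeo.to-hasDeriv f t) (Diffeo.to-hasDeriv g t)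

  distᴰ : Diffeo → Diffeo → Carrier
  distᴰ f g = dist∞ (toContinuous (Diffeo.homeo f)) (toContinuous (Diffeo.homeo g))
            + dist∞ (Diffeo.to-deriv f) (Diffeo.to-deriv g)

  distᴴ≤distᴰ : ∀ f g → dist∞ (toContinuous (Diffeo.homeo f)) (toContinuous (Diffeo.homeo g)) ≤ distᴰ f g
  distᴴ≤distᴰ f g =
    x≤x+y (dist∞ (toContinuous (Diffeo.homeo f)) (toContinuous (Diffeo.homeo g)))
          (dist∞ (Diffeo.to-deriv f) (Diffeo.to-deriv g))
          (dist∞-nonNegative {Diffeo.to-deriv f} {Diffeo.to-deriv g})

  private
    open Diffeo using (homeo; to-deriv)

    interchange : ∀ a b c d → (a + b) + (c + d) ≈ (a + c) + (b + d)
    interchange a b c d = begin-equality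
      (a + b) + (c + d) ≈⟨ +-assoc a b (c + d) ⟩
      a + (b + (c + d)) ≈⟨ +-congˡ (+-assoc b c d) ⟨
      a + ((b + c) + d) ≈⟨ +-congˡ (+-congʳ (+-comm b c)) ⟩
      a + ((c + b) + d) ≈⟨ +-congˡ (+-assoc c b d) ⟩
      a + (c + (b + d)) ≈⟨ +-assoc a c (b + d) ⟨
      (a + c) + (b + d) ∎

  private
    c : Diffeo → ContinuousFunction
    c f = toContinuous (homeo f)

  distᴰ-nonNegative : ∀ f g → 0# ≤ distᴰ f g
  distᴰ-nonNegative f g = ≤-trans (dist∞-nonNegative {toContinuous (homeo f)} {toContinuous (homeo g)}) (distᴴ≤distᴰ f g)

  distᴰ-cong : ∀ f f′ g g′ → homeo f ≈ᴴ homeo f′ → homeo g ≈ᴴ homeo g′ →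
               distᴰ f g ≈ distᴰ f′ g′
  distᴰ-cong f f′ g g′ p q = +-cong
    (dist∞-cong {c f} {c f′} {c g} {c g′} p q)
    (dist∞-cong {to-deriv f} {to-deriv f′} {to-deriv g} {to-deriv g′}
      (to-deriv-cong f f′ p) (to-deriv-cong g g′ q))

  distᴰ-definite : ∀ f g → homeo f ≈ᴴ homeo g → distᴰ f g ≈ 0#
  distᴰ-definite f g p = trans
    (+-cong (dist∞-definite {toContinuous (homeo f)} {toContinuous (homeo g)} p)
            (dist∞-definite {to-deriv f} {to-deriv g} (to-deriv-cong f g p)))
    (+-identityʳ 0#)

  distᴰ-indiscernable : ∀ f g → distᴰ f g ≈ 0# → homeo f ≈ᴴ homeo g
  distᴰ-indiscernable f g eq = dist∞-indiscernable {toContinuous (homeo f)} {toContinuous (homeo g)}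
    (antisym (≤-trans (distᴴ≤distᴰ f g) (inj₂ eq)) (dist∞-nonNegative {toContinuous (homeo f)} {toContinuous (homeo g)}))

  distᴰ-sym : ∀ f g → distᴰ f g ≈ distᴰ g f
  distᴰ-sym f g = +-cong (dist∞-sym (toContinuous (homeo f)) (toContinuous (homeo g)))
                         (dist∞-sym (to-deriv f) (to-deriv g))

  distᴰ-triangle : ∀ f g h → distᴰ f h ≤ distᴰ f g + distᴰ g h
  distᴰ-triangle f g h = ≤-trans
    (+-mono-≤ (dist∞-triangle (c f) (c g) (c h))
              (dist∞-triangle (to-deriv f) (to-deriv g) (to-deriv h)))
    (inj₂ (interchange (dist∞ (c f) (c g)) (dist∞ (c g) (c h))
                       (dist∞ (to-deriv f) (to-deriv g)) (dist∞ (to-deriv g) (to-deriv h))))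

  diffeoMetric : Metric ℝ (Group.setoid diffeoGroup)
  diffeoMetric = record
    { dist = distᴰ
    ; isGeneralMetric = record
      { isSemiMetric = record
        { isQuasiSemiMetric = record
          { isPreMetric = record
            { isProtoMetric = record
              { isPartialOrder = ≤-isPartialOrder
              ; ≈-isEquivalence = Setoid.isEquivalence Diffeo-setoid
              ; cong = λ {f} {f′} {g} {g′} → distᴰ-cong f f′ g g′
              ; nonNegative = λ {f} {g} → distᴰ-nonNegative f g
              }
            ; ≈⇒0 = λ {f} {g} → distᴰ-definite f g
            }
          ; 0⇒≈ = λ {f} {g} → distᴰ-indiscernable f g
          }
        ; sym = distᴰ-sym
        }
      ; triangle = distᴰ-triangle
      }
    }

  shift : Diffeo → IncreasingHomeo → IncreasingHomeo
  shift g h = Diffeo.homeo g ∘ᴴ h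

  shift-continuous : ∀ g h ε → 0# < ε → ∃ λ δ → 0# < δ ×
    (∀ g′ h′ → distᴰ g g′ < δ → Metric.dist homeoMetric h h′ < δ →
     Metric.dist homeoMetric (shift g h) (shift g′ h′) < ε)
  shift-continuous g h ε 0<ε =
    let ε/4 = (ε * ½) * ½
        δ₁ , 0<δ₁ , uc = uniformly-continuous (toContinuous (Diffeo.homeo g)) ε/4 (½-pos (½-pos 0<ε))
        δ , 0<δ , δ≤δ₁ , δ≤ε/4 = common-bound 0<δ₁ (½-pos (½-pos 0<ε))
    in δ , 0<δ , λ g′ h′ g~g′ h~h′ → ≤-<-trans
      (dist∞-least (toContinuous (shift g h)) (toContinuous (shift g′ h′)) λ t → begin
        ∣ value (Diffeo.to g (to h t)) - value (Diffeo.to g′ (to h′ t)) ∣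
          ≤⟨ ∣∣-triangle _ (value (Diffeo.to g (to h′ t))) _ ⟩
        ∣ value (Diffeo.to g (to h t)) - value (Diffeo.to g (to h′ t)) ∣
        + ∣ value (Diffeo.to g (to h′ t)) - value (Diffeo.to g′ (to h′ t)) ∣
          ≤⟨ +-mono-≤
               (inj₁ (uc (to h t) (to h′ t)
                 (≤-<-trans (dist∞-upper (toContinuous h) (toContinuous h′) t) (<-≤-trans h~h′ δ≤δ₁))))
               (≤-trans (dist∞-upper (toContinuous (Diffeo.homeo g)) (toContinuous (Diffeo.homeo g′)) (to h′ t))
                 (≤-trans (distᴴ≤distᴰ g g′) (≤-trans (inj₁ g~g′) δ≤ε/4))) ⟩
        ε/4 + ε/4
          ≈⟨ ½+½ (ε * ½) ⟩
        ε * ½ ∎)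
      (½-< 0<ε)
    where open IncreasingHomeo using (to)

  shiftAction : ContinuousAction ℝ
  shiftAction = record
    { group = diffeoGroup
    ; groupMetric = diffeoMetric
    ; space = IncreasingHomeo-setoid
    ; spaceMetric = homeoMetric
    ; _·_ = shift
    ; ·-cong = λ {g} {g′} {h} {h′} → ∘ᴴ-cong {Diffeo.homeo g} {Diffeo.homeo g′} {h} {h′}
    ; ·-identity = λ h t → refl
    ; ·-assoc = λ g g′ h t → refl
    ; ·-continuous = shift-continuous
    }

{-# OPTIONS --safe #-}
module Submission where

-- The orbits. A diffeomorphism g satisfies g(u) ≤ n u for some n, because g′(0)
-- is finite; so the orbit of x lies in the union over n of the closed sets
-- { y | y ≤ n x }, each of which has empty interior: tilt y a little so that it
-- rises steeply at 0. Density of the orbit of x says that every y ∘ x⁻¹ is a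
-- uniform limit of diffeomorphisms: take a sum of smooth steps, one for each
-- interval between consecutive preimages of multiples of d, and add a small
-- multiple of the identity to keep the derivative positive.
--
-- The local orbits. If g ∘ x lies in a ball around x, then so does g_s ∘ x for
-- the diffeomorphisms g_s = (1 - s) id + s g, and for small d the increment
-- g_{s+d} ∘ g_s⁻¹ is C¹-close to the identity. Hence the local orbit contains
-- g ∘ x, and by density of the orbit its closure contains the whole ball.

open import Axiom.ExcludedMiddle using (ExcludedMiddle)
open import Level using (0ℓ)
open import Defs
open import Algebra.Bundles using (CommutativeRing; Group)
open import Algebra.Solver.Ring.AlmostCommutativeRing using (fromCommutativeRing; _-Raw-AlmostCommutative⟶_)
open import Data.Empty using (⊥-elim)
open import Data.Fin.Base using (Fin; inject₁; fromℕ; toℕ)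
open import Data.Fin.Properties using (toℕ-inject₁; toℕ-fromℕ; toℕ≤pred[n])
open import Data.Integer.Base as ℤ using (ℤ; +_; -[1+_]; _⊖_)
open import Data.Maybe.Base using (Maybe; nothing; just)
open import Data.Nat.Base as ℕ using (ℕ; zero; suc)
open import Data.Product.Base using (∃; _×_; _,_; proj₁; proj₂)
open import Data.Sum.Base using (_⊎_; inj₁; inj₂)
open import Function.Base using (_∘_)
open import Relation.Binary.Definitions using (tri<; tri≈; tri>)
open import Relation.Binary.PropositionalEquality as ≡ using (_≡_)
open import Relation.Nullary using (¬_; yes; no)
open import Relation.Unary using (Pred; _∈_; _⊆_; ⋃)
import Algebra.Construct.NaturalChoice.Min as Min
import Algebra.Properties.Ring
import Algebra.Properties.Semiring.Mult
import Algebra.Properties.Semiring.Mult.TCOptimised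
import Algebra.Solver.Ring
import Data.Integer.Properties as ℤ
import Data.Nat.Properties as ℕ
import Relation.Binary.Reasoning.Setoid
import Relation.Binary.Reasoning.StrictPartialOrder

-- The metric of the group sees derivatives, so the increments along a path must be close to the
-- identity in derivative too. At the point `g_s(u)` the increment has derivative
-- `g_{s+d}′(u) / g_s′(u)`, which differs from 1 by `d (g′(u) - 1) / g_s′(u)`. Hence a bound `m > 0`
-- below `g′` is needed that also lies below every `g_s′`; then one mesh `d` serves the whole path.
-- This is why density is proved not with arbitrary diffeomorphisms but with a class that carries
-- such an `m`: functions with Taylor remainder at most `K (s - t)²` and all difference quotients at
-- least `m`. The class is stable under convex combinations, and for `m > 0` the inverse again has a
-- quadratic remainder, so continuity of both derivatives is a matter of inequalities and the mean
-- value theorem is avoided. The only building block beyond the identity and constants is a clamped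
-- cubic. The same approximation also serves meagerness: an arbitrary `y` cannot be tilted inside
-- the class until it is replaced by a nearby member of it.

module IntegerCoefficientSolver (R : CommutativeRing 0ℓ 0ℓ) where
  private
    open CommutativeRing R
    open Algebra.Properties.Ring ring
    open Algebra.Properties.Semiring.Mult.TCOptimised semiring renaming (_×_ to _·_)
    open Relation.Binary.Reasoning.Setoid setoid

    -- Integer coefficients compute, so normal forms can be compared by `refl` over an abstract
    -- field. The optimised multiple has no trailing `0#`: `con (+ 3)` unfolds to `1# + 1# + 1#`,
    -- and the solver matches numerals written out in this way.
    ⟦_⟧ : ℤ → Carrier
    ⟦ + n ⟧      = n · 1#
    ⟦ -[1+ n ] ⟧ = - (suc n · 1#)

    reflexive′ : ∀ {i j} → i ≡ j → ⟦ i ⟧ ≈ ⟦ j ⟧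
    reflexive′ ≡.refl = refl

    neg-homo : ∀ i → ⟦ ℤ.- i ⟧ ≈ - ⟦ i ⟧
    neg-homo (+ zero)  = sym -0#≈0#
    neg-homo (+ suc n) = refl
    neg-homo -[1+ n ]  = sym (-‿involutive _)

    cancel : ∀ a b c → (a + b) - (a + c) ≈ b - c
    cancel a b c = begin
      (a + b) - (a + c)     ≈⟨ +-cong (+-comm a b) (sym (-‿+-comm a c)) ⟩
      (b + a) + (- a - c)   ≈⟨ +-assoc b a _ ⟩
      b + (a + (- a - c))   ≈⟨ +-congˡ (+-assoc a (- a) (- c)) ⟨
      b + ((a - a) - c)     ≈⟨ +-congˡ (+-congʳ (-‿inverseʳ a)) ⟩
      b + (0# - c)          ≈⟨ +-congˡ (+-identityˡ (- c)) ⟩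
      b - c                 ∎

    ⊖-homo : ∀ m n → ⟦ m ⊖ n ⟧ ≈ m · 1# - n · 1#
    ⊖-homo zero    zero    = sym (-‿inverseʳ 0#)
    ⊖-homo zero    (suc n) = sym (+-identityˡ _)
    ⊖-homo (suc m) zero    = sym (trans (+-congˡ -0#≈0#) (+-identityʳ _))
    ⊖-homo (suc m) (suc n) = begin
      ⟦ suc m ⊖ suc n ⟧                  ≈⟨ reflexive′ (ℤ.[1+m]⊖[1+n]≡m⊖n m n) ⟩
      ⟦ m ⊖ n ⟧                          ≈⟨ ⊖-homo m n ⟩
      m · 1# - n · 1#                    ≈⟨ cancel 1# _ _ ⟨
      (1# + m · 1#) - (1# + n · 1#)      ≈⟨ +-cong (1+× m 1#) (-‿cong (1+× n 1#)) ⟨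
      suc m · 1# - suc n · 1#            ∎

    +-homo : ∀ i j → ⟦ i ℤ.+ j ⟧ ≈ ⟦ i ⟧ + ⟦ j ⟧
    +-homo (+ m)    (+ n)    = ×-homo-+ 1# m n
    +-homo (+ m)    -[1+ n ] = ⊖-homo m (suc n)
    +-homo -[1+ m ] (+ n)    = trans (⊖-homo n (suc m)) (+-comm _ _)
    +-homo -[1+ m ] -[1+ n ] = begin
      - (suc (suc (m ℕ.+ n)) · 1#)       ≈⟨ -‿cong (reflexive (≡.cong (_· 1#) (≡.cong suc (ℕ.+-suc m n)))) ⟨
      - ((suc m ℕ.+ suc n) · 1#)         ≈⟨ -‿cong (×-homo-+ 1# (suc m) (suc n)) ⟩
      - (suc m · 1# + suc n · 1#)        ≈⟨ -‿+-comm _ _ ⟨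
      - (suc m · 1#) - suc n · 1#        ∎

    *-homo⁺ : ∀ m j → ⟦ + m ℤ.* j ⟧ ≈ m · 1# * ⟦ j ⟧
    *-homo⁺ m (+ n)    = trans (reflexive′ (≡.sym (ℤ.pos-* m n))) (×1-homo-* m n)
    *-homo⁺ m -[1+ n ] = begin
      ⟦ + m ℤ.* (ℤ.- + suc n) ⟧    ≈⟨ reflexive′ (ℤ.neg-distribʳ-* (+ m) (+ suc n)) ⟨
      ⟦ ℤ.- (+ m ℤ.* + suc n) ⟧    ≈⟨ neg-homo (+ m ℤ.* + suc n) ⟩
      - ⟦ + m ℤ.* + suc n ⟧        ≈⟨ -‿cong (*-homo⁺ m (+ suc n)) ⟩
      - (m · 1# * (suc n · 1#))    ≈⟨ -‿distribʳ-* _ _ ⟩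
      m · 1# * - (suc n · 1#)      ∎

    *-homo : ∀ i j → ⟦ i ℤ.* j ⟧ ≈ ⟦ i ⟧ * ⟦ j ⟧
    *-homo (+ m)    j = *-homo⁺ m j
    *-homo -[1+ m ] j = begin
      ⟦ (ℤ.- + suc m) ℤ.* j ⟧      ≈⟨ reflexive′ (ℤ.neg-distribˡ-* (+ suc m) j) ⟨
      ⟦ ℤ.- (+ suc m ℤ.* j) ⟧      ≈⟨ neg-homo (+ suc m ℤ.* j) ⟩
      - ⟦ + suc m ℤ.* j ⟧          ≈⟨ -‿cong (*-homo⁺ (suc m) j) ⟩
      - (suc m · 1# * ⟦ j ⟧)       ≈⟨ -‿distribˡ-* _ _ ⟩
      - (suc m · 1#) * ⟦ j ⟧       ∎

    morphism : ℤ.+-*-rawRing -Raw-AlmostCommutative⟶ fromCommutativeRing R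
    morphism = record
      { ⟦_⟧    = ⟦_⟧
      ; +-homo = +-homo
      ; *-homo = *-homo
      ; -‿homo = neg-homo
      ; 0-homo = refl
      ; 1-homo = refl
      }

    coeff≟ : (i j : ℤ) → Maybe (⟦ i ⟧ ≈ ⟦ j ⟧)
    coeff≟ i j with i ℤ.≟ j
    ... | yes i≡j = just (reflexive′ i≡j)
    ... | no  _   = nothing

  open Algebra.Solver.Ring ℤ.+-*-rawRing (fromCommutativeRing R) morphism
    coeff≟ public
    using (solve; _:=_; con; _:+_; _:*_; _:-_; :-_)

-- Inequalities in an ordered field and the Archimedean property

module OrderedField (ℝ : CompleteOrderedField) where

  open CompleteOrderedField ℝ
  open FieldProperties ℝ
  open IntegerCoefficientSolver commutativeRing
  open Algebra.Properties.Semiring.Mult semiring using () renaming (_×_ to _·_)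
  open Relation.Binary.Reasoning.StrictPartialOrder strictPartialOrder

  x≤y⇒0≤y-x : ∀ {x y} → x ≤ y → 0# ≤ y - x
  x≤y⇒0≤y-x {x} x≤y = ≤-respˡ-≈ (-‿inverseʳ x) (+-monoˡ-≤ (- x) x≤y)

  0≤y-x⇒x≤y : ∀ {x y} → 0# ≤ y - x → x ≤ y
  0≤y-x⇒x≤y {x} {y} p = ≤-respˡ-≈ (+-identityˡ x) (≤-respʳ-≈ (x-y+y≈x y x) (+-monoˡ-≤ x p))

  -- The standard way to prove polynomial inequalities below: the gap `c` is exhibited as an
  -- expression built from nonnegative factors, and the solver checks the identity.
  x+c≈y⇒x≤y : ∀ {x y c} → 0# ≤ c → x + c ≈ y → x ≤ y
  x+c≈y⇒x≤y {x} {c = c} 0≤c eq = ≤-respʳ-≈ eq (x≤x+y x c 0≤c)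

  x≤0⇒0≤-x : ∀ {x} → x ≤ 0# → 0# ≤ - x
  x≤0⇒0≤-x {x} x≤0 = ≤-respʳ-≈ (+-identityˡ (- x)) (x≤y⇒0≤y-x x≤0)

  0≤x+y : ∀ {u v} → 0# ≤ u → 0# ≤ v → 0# ≤ u + v
  0≤x+y {u} {v} p r = ≤-trans p (x≤x+y u v r)

  neg-mono-≤ : ∀ {x y} → x ≤ y → - y ≤ - x
  neg-mono-≤ {x} {y} x≤y = x+c≈y⇒x≤y (x≤y⇒0≤y-x x≤y)
    (solve 2 (λ x y → :- y :+ (y :- x) := :- x) refl x y)

  *-mono-≤ : ∀ {x y u v} → 0# ≤ x → 0# ≤ v → x ≤ y → u ≤ v → x * u ≤ y * v
  *-mono-≤ 0≤x 0≤v x≤y u≤v = ≤-trans (*-monoʳ-≤ 0≤x u≤v) (*-monoˡ-≤ 0≤v x≤y)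

  *-monoʳ-< : ∀ {x y z} → 0# < z → x < y → z * x < z * y
  *-monoʳ-< {x} {y} {z} 0<z x<y = begin-strict
    z * x               ≈⟨ +-identityʳ _ ⟨
    z * x + 0#          <⟨ +-monoʳ-< _ (*-pos 0<z (x<y⇒0<y-x x<y)) ⟩
    z * x + z * (y - x) ≈⟨ solve 3 (λ x y z → z :* x :+ z :* (y :- x) := z :* y) refl x y z ⟩
    z * y               ∎

  0≤x*x : ∀ x → 0# ≤ x * x
  0≤x*x x with total 0# x
  ... | inj₁ 0≤x = 0≤x*y 0≤x 0≤x
  ... | inj₂ x≤0 = ≤-respʳ-≈ (solve 1 (λ x → :- x :* :- x := x :* x) refl x)
                     (0≤x*y (x≤0⇒0≤-x x≤0) (x≤0⇒0≤-x x≤0))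

  x≤0⇒∣x∣≈-x : ∀ {x} → x ≤ 0# → ∣ x ∣ ≈ - x
  x≤0⇒∣x∣≈-x {x} x≤0 = trans (sym (∣-x∣≈∣x∣ x)) (0≤x⇒∣x∣≈x (x≤0⇒0≤-x x≤0))

  ∣x*y∣≈∣x∣*∣y∣ : ∀ x y → ∣ x * y ∣ ≈ ∣ x ∣ * ∣ y ∣
  ∣x*y∣≈∣x∣*∣y∣ x y = cases (total 0# x) (total 0# y)
    where
    cases : 0# ≤ x ⊎ x ≤ 0# → 0# ≤ y ⊎ y ≤ 0# → ∣ x * y ∣ ≈ ∣ x ∣ * ∣ y ∣
    cases (inj₁ 0≤x) (inj₁ 0≤y) = trans (0≤x⇒∣x∣≈x (0≤x*y 0≤x 0≤y))
      (*-cong (sym (0≤x⇒∣x∣≈x 0≤x)) (sym (0≤x⇒∣x∣≈x 0≤y)))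
    cases (inj₁ 0≤x) (inj₂ y≤0) = trans (sym (∣-x∣≈∣x∣ _))
      (trans (∣∣-cong (-‿distribʳ-* x y))
        (trans (0≤x⇒∣x∣≈x (0≤x*y 0≤x (x≤0⇒0≤-x y≤0)))
          (*-cong (sym (0≤x⇒∣x∣≈x 0≤x)) (sym (x≤0⇒∣x∣≈-x y≤0)))))
    cases (inj₂ x≤0) (inj₁ 0≤y) = trans (sym (∣-x∣≈∣x∣ _))
      (trans (∣∣-cong (-‿distribˡ-* x y))
        (trans (0≤x⇒∣x∣≈x (0≤x*y (x≤0⇒0≤-x x≤0) 0≤y))
          (*-cong (sym (x≤0⇒∣x∣≈-x x≤0)) (sym (0≤x⇒∣x∣≈x 0≤y)))))
    cases (inj₂ x≤0) (inj₂ y≤0) =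
      trans (∣∣-cong (solve 2 (λ x y → x :* y := :- x :* :- y) refl x y))
        (trans (0≤x⇒∣x∣≈x (0≤x*y (x≤0⇒0≤-x x≤0) (x≤0⇒0≤-x y≤0)))
          (*-cong (sym (x≤0⇒∣x∣≈-x x≤0)) (sym (x≤0⇒∣x∣≈-x y≤0))))

  ∣x∣*∣x∣≈x*x : ∀ x → ∣ x ∣ * ∣ x ∣ ≈ x * x
  ∣x∣*∣x∣≈x*x x = trans (sym (∣x*y∣≈∣x∣*∣y∣ x x)) (0≤x⇒∣x∣≈x (0≤x*x x))

  *-cancelˡ-≤ : ∀ {x y z} → 0# < z → z * x ≤ z * y → x ≤ y
  *-cancelˡ-≤ 0<z p = ≮⇒≥ λ y<x → ≤⇒≯ p (*-monoʳ-< 0<z y<x)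

  module _ {x} (0<x : 0# < x) where
    recip⁺ : Carrier
    recip⁺ = recip x (0<x⇒x≉0 0<x)

    *-recip⁺ : x * recip⁺ ≈ 1#
    *-recip⁺ = recip-inverse x (0<x⇒x≉0 0<x)

    0<recip⁺ : 0# < recip⁺
    0<recip⁺ = recip-pos 0<x (0<x⇒x≉0 0<x)

    recip⁺-cancel : ∀ y → x * (recip⁺ * y) ≈ y
    recip⁺-cancel y = trans (sym (*-assoc x recip⁺ y)) (trans (*-congʳ *-recip⁺) (*-identityˡ y))

  recip⁺-antitone : ∀ {x y} (0<x : 0# < x) (0<y : 0# < y) → x ≤ y → recip⁺ 0<y ≤ recip⁺ 0<x
  recip⁺-antitone {x} {y} 0<x 0<y x≤y = begin
    q             ≈⟨ trans (sym (*-identityʳ q)) (*-congˡ (sym (*-recip⁺ 0<x))) ⟩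
    q * (x * p)   ≤⟨ *-monoʳ-≤ (<⇒≤ (0<recip⁺ 0<y)) (*-monoˡ-≤ (<⇒≤ (0<recip⁺ 0<x)) x≤y) ⟩
    q * (y * p)   ≈⟨ solve 3 (λ q y p → q :* (y :* p) := y :* (q :* p)) refl q y p ⟩
    y * (q * p)   ≈⟨ recip⁺-cancel 0<y p ⟩
    p             ∎
    where
    p = recip⁺ 0<x
    q = recip⁺ 0<y

  x≤y+ε⇒x≤y : ∀ {x y} → (∀ e → 0# < e → x ≤ y + e) → x ≤ y
  x≤y+ε⇒x≤y {x} {y} h = ≮⇒≥ λ y<x →
    let z , y<z , z<x = dense y<x
    in ≤⇒≯ (h (z - y) (x<y⇒0<y-x y<z))
         (<-respˡ-≈ (solve 2 (λ y z → z := y :+ (z :- y)) refl y z) z<x)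

  ·-nonNegative : ∀ n {x} → 0# ≤ x → 0# ≤ n · x
  ·-nonNegative zero    0≤x = ≤-refl
  ·-nonNegative (suc n) 0≤x = ≤-trans 0≤x (x≤x+y _ _ (·-nonNegative n 0≤x))

  ·-monoˡ-≤ : ∀ {m n x} → 0# ≤ x → m ℕ.≤ n → m · x ≤ n · x
  ·-monoˡ-≤ {n = n} 0≤x ℕ.z≤n       = ·-nonNegative n 0≤x
  ·-monoˡ-≤         0≤x (ℕ.s≤s m≤n) = +-monoʳ-≤ _ (·-monoˡ-≤ 0≤x m≤n)

  module _ (em : ExcludedMiddle 0ℓ) where
    open Algebra.Properties.Semiring.Mult semiring using (×-congʳ; ×-assoc-*)

    archimedean : ∀ x → ∃ λ n → x < n · 1#
    archimedean x with em {P = ∃ λ n → x < n · 1#}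
    ... | yes found = found
    ... | no none = ⊥-elim (≤⇒≯ (proj₂ (proj₂ sup) bound) (s-1<s))
      where
      Multiples : Pred Carrier 0ℓ
      Multiples y = ∃ λ n → y ≈ n · 1#
      sup = supremum Multiples (0# , 0 , refl)
        (x , λ { (n , y≈n) → ≤-respˡ-≈ (sym y≈n) (≮⇒≥ λ x<n → none (n , x<n)) })
      s = proj₁ sup
      s-1<s : s - 1# < s
      s-1<s = x<z+y⇒x-y<z (<-respˡ-≈ (+-identityʳ s) (+-monoʳ-< s 0<1))
      -- The `n`-th multiple is one less than the next, which is at most `s`. So `s - 1#` would be a
      -- smaller upper bound.
      bound : IsUpperBound Multiples (s - 1#)
      bound {y} (n , y≈n) = ≤-respˡ-≈ (trans (solve 1 (λ a → (con (+ 1) :+ a) :- con (+ 1) := a) refl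
        (n · 1#)) (sym y≈n))
        (+-monoˡ-≤ (- 1#) (proj₁ (proj₂ sup) (suc n , refl)))

    -- An exact divisor of 1 is wanted, not just a small number: both the staircase and the
    -- subdivided path have to end precisely at 1.
    unit-fraction : ∀ {x} → 0# < x → ∃ λ n → ∃ λ d → 0# < d × d < x × n · d ≈ 1#
    unit-fraction {x} 0<x = n , d , 0<recip⁺ 0<n , d<x , n·d≈1
      where
      arch = archimedean (recip⁺ 0<x)
      n = proj₁ arch
      0<n : 0# < n · 1#
      0<n = <-trans (0<recip⁺ 0<x) (proj₂ arch)
      d = recip⁺ 0<n
      n·d≈1 : n · d ≈ 1#
      n·d≈1 = begin-equality
        n · d          ≈⟨ ×-congʳ n (*-identityˡ d) ⟨
        n · (1# * d)   ≈⟨ ×-assoc-* n 1# d ⟨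
        (n · 1#) * d   ≈⟨ *-recip⁺ 0<n ⟩
        1#             ∎
      d<x : d < x
      d<x = begin-strict
        d                            ≈⟨ trans (sym (recip⁺-cancel 0<x d))
          (solve 3 (λ x r d → x :* (r :* d) := (x :* d) :* r) refl x (recip⁺ 0<x) d) ⟩
        (x * d) * recip⁺ 0<x         <⟨ *-monoʳ-< (*-pos 0<x (0<recip⁺ 0<n)) (proj₂ arch) ⟩
        (x * d) * (n · 1#)           ≈⟨ solve 3 (λ x d m → (x :* d) :* m := (m :* d) :* x) refl x d (n · 1#) ⟩
        (n · 1# * d) * x             ≈⟨ trans (*-congʳ (*-recip⁺ 0<n)) (*-identityˡ x) ⟩
        x                            ∎

-- Functions with a quadratic Taylor remainder

module QuadraticApproximation (em : ExcludedMiddle 0ℓ) (ℝ : CompleteOrderedField) where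

  open CompleteOrderedField ℝ
  open FieldProperties ℝ
  open OrderedField ℝ
  open UnitInterval ℝ
  open Shift em ℝ using (bounded)
  open IntegerCoefficientSolver commutativeRing
  open Relation.Binary.Reasoning.StrictPartialOrder strictPartialOrder

  ∣s-t∣≤1 : ∀ s t → ∣ value s - value t ∣ ≤ 1#
  ∣s-t∣≤1 s t = ∣∣-lub (bound s t) (≤-respˡ-≈ (sym (-[x-y]≈y-x _ _)) (bound t s))
    where
    bound : ∀ s t → value s - value t ≤ 1#
    bound s t = ≤-trans (+-mono-≤ (value≤1 s) (neg-mono-≤ (0≤value t)))
      (inj₂ (solve 0 (con (+ 1) :- con (+ 0) := con (+ 1)) refl))

  Lipschitz : (𝕀 → Carrier) → Carrier → Set
  Lipschitz f L = ∀ s t → ∣ f s - f t ∣ ≤ L * ∣ value s - value t ∣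

  lipschitz⇒continuous : ∀ {f L} → 0# < L → Lipschitz f L → Continuous f
  lipschitz⇒continuous {f} {L} 0<L lip t ε 0<ε = recip⁺ 0<L * ε , *-pos (0<recip⁺ 0<L) 0<ε ,
    λ s s~t → begin-strict
      ∣ f s - f t ∣               ≤⟨ lip s t ⟩
      L * ∣ value s - value t ∣   <⟨ *-monoʳ-< 0<L s~t ⟩
      L * (recip⁺ 0<L * ε)        ≈⟨ recip⁺-cancel 0<L ε ⟩
      ε                           ∎

  -- A first-order Taylor expansion with uniformly quadratic remainder. Unlike
  -- differentiability it is verified by inequalities alone, and it already
  -- makes the derivative Lipschitz.
  record QuadraticApprox (f f′ : 𝕀 → Carrier) (K : Carrier) : Set where
    no-eta-equality
    field
      0<K         : 0# < K
      deriv-cong  : ∀ {s t} → value s ≈ value t → f′ s ≈ f′ t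
      remainder   : ∀ s t → ∣ (f s - f t) - f′ t * (value s - value t) ∣
                            ≤ K * ((value s - value t) * (value s - value t))

    -- Dividing the remainder by `value s - value t` leaves at most `K` times the distance, so
    -- `δ = ε / K` works at every point.
    hasDerivative : ∀ t → HasDerivative f t (f′ t)
    hasDerivative t ε 0<ε = recip⁺ 0<K * ε , *-pos (0<recip⁺ 0<K) 0<ε , λ s s≉t s~t →
      let d = value s - value t
          r = recip d (x≉y⇒x-y≉0 s≉t)
          d*r≈1 = recip-inverse d (x≉y⇒x-y≉0 s≉t)
      in begin-strict
        ∣ (f s - f t) * r - f′ t ∣
          ≈⟨ ∣∣-cong (+-congˡ (-‿cong (trans (sym (*-identityʳ _)) (*-congˡ (sym d*r≈1))))) ⟩
        ∣ (f s - f t) * r - f′ t * (d * r) ∣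
          ≈⟨ ∣∣-cong (solve 4 (λ a r D d → a :* r :- D :* (d :* r) := (a :- D :* d) :* r) refl
            (f s - f t) r (f′ t) d) ⟩
        ∣ ((f s - f t) - f′ t * d) * r ∣
          ≈⟨ ∣x*y∣≈∣x∣*∣y∣ _ r ⟩
        ∣ (f s - f t) - f′ t * d ∣ * ∣ r ∣
          ≤⟨ *-monoˡ-≤ (0≤∣x∣ r) (remainder s t) ⟩
        (K * (d * d)) * ∣ r ∣
          ≈⟨ *-congʳ (*-congˡ (sym (∣x∣*∣x∣≈x*x d))) ⟩
        (K * (∣ d ∣ * ∣ d ∣)) * ∣ r ∣
          ≈⟨ solve 3 (λ K d r → (K :* (d :* d)) :* r := (K :* d) :* (d :* r)) refl K ∣ d ∣ ∣ r ∣ ⟩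
        (K * ∣ d ∣) * (∣ d ∣ * ∣ r ∣)
          ≈⟨ *-congˡ (trans (sym (∣x*y∣≈∣x∣*∣y∣ d r)) (trans (∣∣-cong d*r≈1) (0≤x⇒∣x∣≈x (<⇒≤ 0<1)))) ⟩
        (K * ∣ d ∣) * 1#
          ≈⟨ *-identityʳ _ ⟩
        K * ∣ d ∣
          <⟨ *-monoʳ-< 0<K s~t ⟩
        K * (recip⁺ 0<K * ε)
          ≈⟨ recip⁺-cancel 0<K ε ⟩
        ε ∎

    -- Adding the expansion of `f s` around `t` to that of `f t` around `s` cancels the values of
    -- `f`. What remains is `d * (f′ s - f′ t)`, bounded by `2 K d²`, and one factor `∣ d ∣` can be
    -- cancelled. When `d` vanishes there is nothing to cancel, and `deriv-cong` is used instead.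
    deriv-lipschitz : Lipschitz f′ (K + K)
    deriv-lipschitz s t with em {P = value s ≈ value t}
    ... | yes s≈t = begin
      ∣ f′ s - f′ t ∣                     ≈⟨ x≈0⇒∣x∣≈0 (trans (+-congʳ (deriv-cong s≈t)) (-‿inverseʳ _)) ⟩
      0#                                  ≤⟨ 0≤x*y
        (<⇒≤ (<-trans 0<K (<-respˡ-≈ (+-identityʳ K) (+-monoʳ-< K 0<K)))) (0≤∣x∣ _) ⟩
      (K + K) * ∣ value s - value t ∣     ∎
    ... | no s≉t = *-cancelˡ-≤ 0<∣d∣ (begin
      ∣ d ∣ * ∣ f′ s - f′ t ∣
        ≈⟨ ∣x*y∣≈∣x∣*∣y∣ d _ ⟨
      ∣ d * (f′ s - f′ t) ∣
        ≈⟨ ∣∣-cong (solve 6 (λ x y a b D E →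
             (x :- y) :* (E :- D) := ((a :- b) :- D :* (x :- y)) :+ ((b :- a) :- E :* (y :- x)))
             refl (value s) (value t) (f s) (f t) (f′ t) (f′ s)) ⟩
      ∣ ((f s - f t) - f′ t * d) + ((f t - f s) - f′ s * (value t - value s)) ∣
        ≤⟨ ∣x+y∣≤∣x∣+∣y∣ _ _ ⟩
      ∣ (f s - f t) - f′ t * d ∣ + ∣ (f t - f s) - f′ s * (value t - value s) ∣
        ≤⟨ +-mono-≤ (remainder s t) (remainder t s) ⟩
      K * (d * d) + K * ((value t - value s) * (value t - value s))
        ≈⟨ solve 3 (λ K x y → K :* ((x :- y) :* (x :- y)) :+ K :* ((y :- x) :* (y :- x))
                              := (K :+ K) :* ((x :- y) :* (x :- y))) refl K (value s) (value t) ⟩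
      (K + K) * (d * d)
        ≈⟨ *-congˡ (∣x∣*∣x∣≈x*x d) ⟨
      (K + K) * (∣ d ∣ * ∣ d ∣)
        ≈⟨ solve 2 (λ K d → K :* (d :* d) := d :* (K :* d)) refl (K + K) ∣ d ∣ ⟩
      ∣ d ∣ * ((K + K) * ∣ d ∣) ∎)
      where
      d = value s - value t
      0<∣d∣ : 0# < ∣ d ∣
      0<∣d∣ with compare 0# ∣ d ∣
      ... | tri< p _ _ = p
      ... | tri≈ _ p _ = ⊥-elim (x≉y⇒x-y≉0 s≉t (∣x∣≤0⇒x≈0 (inj₂ (sym p))))
      ... | tri> _ _ p = ⊥-elim (≤⇒≯ (0≤∣x∣ d) p)

    deriv : ContinuousFunction
    deriv = record
      { fun = f′
      ; continuous = lipschitz⇒continuous (<-trans 0<K (<-respˡ-≈ (+-identityʳ K) (+-monoʳ-< K 0<K)))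
        deriv-lipschitz
      }

    -- On the unit interval `∣ d ∣ ≤ 1`, so the quadratic remainder is at most `K * ∣ d ∣`; the
    -- linear term contributes the bound `B` of the derivative.
    lipschitz : ∃ λ L → 0# < L × Lipschitz f L
    lipschitz = B + K , 0<L , λ s t →
      let d = value s - value t in begin
        ∣ f s - f t ∣
          ≤⟨ ∣x∣≤∣x-y∣+∣y∣ (f s - f t) (f′ t * d) ⟩
        ∣ (f s - f t) - f′ t * d ∣ + ∣ f′ t * d ∣
          ≤⟨ +-mono-≤ (remainder s t) (inj₂ (∣x*y∣≈∣x∣*∣y∣ (f′ t) d)) ⟩
        K * (d * d) + ∣ f′ t ∣ * ∣ d ∣
          ≤⟨ +-mono-≤ (inj₂ (*-congˡ (sym (∣x∣*∣x∣≈x*x d)))) (*-monoˡ-≤ (0≤∣x∣ d) (proj₂ (bounded deriv) t)) ⟩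
        K * (∣ d ∣ * ∣ d ∣) + B * ∣ d ∣
          ≤⟨ +-monoˡ-≤ _ (*-monoʳ-≤ (<⇒≤ 0<K) (≤-respʳ-≈ (*-identityˡ _) (*-monoˡ-≤ (0≤∣x∣ d) (∣s-t∣≤1 s t)))) ⟩
        K * ∣ d ∣ + B * ∣ d ∣
          ≈⟨ solve 3 (λ K B d → K :* d :+ B :* d := (B :+ K) :* d) refl K B ∣ d ∣ ⟩
        (B + K) * ∣ d ∣ ∎
      where
      B = proj₁ (bounded deriv)
      0≤B : 0# ≤ B
      0≤B = ≤-trans (0≤∣x∣ _) (proj₂ (bounded deriv) (point 0# ≤-refl (<⇒≤ 0<1)))
      0<L : 0# < B + K
      0<L = <-≤-trans 0<K (x+c≈y⇒x≤y 0≤B (+-comm K B))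

-- Smooth functions with a lower bound on the slope

module SmoothFunctions (em : ExcludedMiddle 0ℓ) (ℝ : CompleteOrderedField) where

  open CompleteOrderedField ℝ
  open FieldProperties ℝ
  open OrderedField ℝ
  open UnitInterval ℝ
  open QuadraticApproximation em ℝ
  open IntegerCoefficientSolver commutativeRing
  open Relation.Binary.Reasoning.StrictPartialOrder strictPartialOrder

  -- The bound `m` is recorded both for difference quotients and for the derivative. Either form
  -- passes directly to sums and nonnegative multiples, so neither has to be recovered from the
  -- other. As an index, `m` is computed along with the function.
  record Smooth (m : Carrier) : Set where
    no-eta-equality
    field
      fun     : 𝕀 → Carrier
      deriv   : 𝕀 → Carrier
      K       : Carrier
      approx  : QuadraticApprox fun deriv K
      slope   : ∀ {s t} → value t ≤ value s → m * (value s - value t) ≤ fun s - fun t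
      m≤deriv : ∀ t → m ≤ deriv t

    open QuadraticApprox approx public using (0<K; deriv-cong; remainder)
    module Approx = QuadraticApprox approx

  open Smooth

  -- Also used to replace an index by an equal one, such as `0# + d * 0#` by `0#`, because field
  -- arithmetic does not reduce in types.
  weaken : ∀ {m n} → m ≤ n → Smooth n → Smooth m
  weaken m≤n F = record
    { fun = fun F ; deriv = deriv F ; K = K F ; approx = approx F
    ; slope = λ t≤s → ≤-trans (*-monoˡ-≤ (x≤y⇒0≤y-x t≤s) m≤n) (slope F t≤s)
    ; m≤deriv = λ t → ≤-trans m≤n (m≤deriv F t)
    }

  zeroˢ : Smooth 0#
  zeroˢ = record
    { fun = λ _ → 0# ; deriv = λ _ → 0# ; K = 1#
    ; approx = record
      { 0<K = 0<1
      ; deriv-cong = λ _ → refl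
      ; remainder = λ s t → let d = value s - value t in begin
          ∣ (0# - 0#) - 0# * d ∣  ≈⟨ x≈0⇒∣x∣≈0 (solve 1
            (λ d → (con (+ 0) :- con (+ 0)) :- con (+ 0) :* d := con (+ 0)) refl d) ⟩
          0#                      ≤⟨ 0≤x*y (<⇒≤ 0<1) (0≤x*x d) ⟩
          1# * (d * d)            ∎
      }
    ; slope = λ _ → inj₂ (trans (zeroˡ _) (sym (-‿inverseʳ 0#)))
    ; m≤deriv = λ _ → ≤-refl
    }

  idˢ : Smooth 1#
  idˢ = record
    { fun = value ; deriv = λ _ → 1# ; K = 1#
    ; approx = record
      { 0<K = 0<1
      ; deriv-cong = λ _ → refl
      ; remainder = λ s t → let d = value s - value t in begin
          ∣ d - 1# * d ∣   ≈⟨ x≈0⇒∣x∣≈0 (solve 1 (λ d → d :- con (+ 1) :* d := con (+ 0)) refl d) ⟩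
          0#               ≤⟨ 0≤x*y (<⇒≤ 0<1) (0≤x*x d) ⟩
          1# * (d * d)     ∎
      }
    ; slope = λ _ → inj₂ (*-identityˡ _)
    ; m≤deriv = λ _ → ≤-refl
    }

  infixl 6 _⊕_
  _⊕_ : ∀ {m n} → Smooth m → Smooth n → Smooth (m + n)
  F ⊕ G = record
    { fun = λ t → fun F t + fun G t
    ; deriv = λ t → deriv F t + deriv G t
    ; K = K F + K G
    ; approx = record
      { 0<K = <-trans (0<K F) (<-respˡ-≈ (+-identityʳ _) (+-monoʳ-< (K F) (0<K G)))
      ; deriv-cong = λ eq → +-cong (deriv-cong F eq) (deriv-cong G eq)
      ; remainder = λ s t → let d = value s - value t in begin
          ∣ ((fun F s + fun G s) - (fun F t + fun G t)) - (deriv F t + deriv G t) * d ∣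
            ≈⟨ ∣∣-cong (solve 7 (λ a b a′ b′ D E d → ((a :+ b) :- (a′ :+ b′)) :- (D :+ E) :* d
                 := ((a :- a′) :- D :* d) :+ ((b :- b′) :- E :* d)) refl _ _ _ _ _ _ _) ⟩
          ∣ ((fun F s - fun F t) - deriv F t * d) + ((fun G s - fun G t) - deriv G t * d) ∣
            ≤⟨ ∣x+y∣≤∣x∣+∣y∣ _ _ ⟩
          ∣ (fun F s - fun F t) - deriv F t * d ∣ + ∣ (fun G s - fun G t) - deriv G t * d ∣
            ≤⟨ +-mono-≤ (remainder F s t) (remainder G s t) ⟩
          K F * (d * d) + K G * (d * d)
            ≈⟨ distribʳ _ _ _ ⟨
          (K F + K G) * (d * d) ∎
      }
    ; slope = λ t≤s → ≤-respˡ-≈ (sym (distribʳ _ _ _)) (≤-respʳ-≈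
        (solve 4 (λ a a′ b b′ → (a :- a′) :+ (b :- b′) := (a :+ b) :- (a′ :+ b′)) refl _ _ _ _)
        (+-mono-≤ (slope F t≤s) (slope G t≤s)))
    ; m≤deriv = λ t → +-mono-≤ (m≤deriv F t) (m≤deriv G t)
    }

  scale : ∀ {m} c → 0# ≤ c → Smooth m → Smooth (c * m)
  scale {m} c 0≤c F = record
    { fun = λ t → c * fun F t
    ; deriv = λ t → c * deriv F t
    -- The summand `1#` keeps the constant positive when `c` is zero, as happens at the ends of a
    -- path of convex combinations.
    ; K = c * K F + 1#
    ; approx = record
      { 0<K = <-≤-trans 0<1 (x+c≈y⇒x≤y (0≤x*y 0≤c (<⇒≤ (0<K F))) (+-comm _ _))
      ; deriv-cong = λ eq → *-congˡ (deriv-cong F eq)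
      ; remainder = λ s t → let d = value s - value t in begin
          ∣ (c * fun F s - c * fun F t) - (c * deriv F t) * d ∣
            ≈⟨ ∣∣-cong (solve 5 (λ c a b D d → (c :* a :- c :* b) :- (c :* D) :* d := c :*
              ((a :- b) :- D :* d)) refl c _ _ _ _) ⟩
          ∣ c * ((fun F s - fun F t) - deriv F t * d) ∣
            ≈⟨ trans (∣x*y∣≈∣x∣*∣y∣ c _) (*-congʳ (0≤x⇒∣x∣≈x 0≤c)) ⟩
          c * ∣ (fun F s - fun F t) - deriv F t * d ∣
            ≤⟨ *-monoʳ-≤ 0≤c (remainder F s t) ⟩
          c * (K F * (d * d))
            ≤⟨ x+c≈y⇒x≤y (0≤x*x d) (solve 3 (λ c k e → c :* (k :* e) :+ e := (c :* k :+ con (+ 1)) :* e)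
              refl c (K F) (d * d)) ⟩
          (c * K F + 1#) * (d * d) ∎
      }
    ; slope = λ t≤s → ≤-respˡ-≈ (sym (*-assoc c m _)) (≤-respʳ-≈ (x[y-z]≈xy-xz c _ _)
        (*-monoʳ-≤ 0≤c (slope F t≤s)))
    ; m≤deriv = λ t → *-monoʳ-≤ 0≤c (m≤deriv F t)
    }

  private
    0<x+1 : ∀ {x} → 0# < x → 0# < x + 1#
    0<x+1 {x} 0<x = <-trans 0<1 (<-respˡ-≈ (+-identityˡ 1#) (+-monoˡ-< 1# 0<x))

    0≤3 : 0# ≤ 1# + 1# + 1#
    0≤3 = <⇒≤ (0<x+1 0<2)

    0≤4 : 0# ≤ 1# + 1# + 1# + 1#
    0≤4 = <⇒≤ (0<x+1 (0<x+1 0<2))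

    0<6 : 0# < 1# + 1# + 1# + 1# + 1# + 1#
    0<6 = 0<x+1 (0<x+1 (0<x+1 (0<x+1 0<2)))

    0≤6 = <⇒≤ 0<6

    0<9 : 0# < 1# + 1# + 1# + (1# + 1# + 1# + 1# + 1# + 1#)
    0<9 = <-respˡ-≈ (+-identityˡ 0#) (+-mono-< (0<x+1 0<2) 0<6)

  -- The clamped cubic step

  module Smoothstep where
    open Min totalOrder using (_⊓_; ⊓-cong; ⊓-sel; x⊓y≤x; x⊓y≤y; x≤y⇒x⊓y≈x; x≤y⇒y⊓x≈x)

    clamp : Carrier → Carrier
    clamp x = 0# ⊔ (x ⊓ 1#)

    clamp-cong : ∀ {x y} → x ≈ y → clamp x ≈ clamp y
    clamp-cong x≈y = ⊔-cong refl (⊓-cong x≈y refl)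

    clamp-below : ∀ {x} → x ≤ 0# → clamp x ≈ 0#
    clamp-below {x} x≤0 = x≤y⇒y⊔x≈y (≤-trans (x⊓y≤x x 1#) x≤0)

    clamp-above : ∀ {x} → 1# ≤ x → clamp x ≈ 1#
    clamp-above 1≤x = trans (⊔-cong refl (x≤y⇒y⊓x≈x 1≤x)) (x≤y⇒x⊔y≈y (<⇒≤ 0<1))

    clamp-inside : ∀ {x} → 0# ≤ x → x ≤ 1# → clamp x ≈ x
    clamp-inside 0≤x x≤1 = trans (⊔-cong refl (x≤y⇒x⊓y≈x x≤1)) (x≤y⇒x⊔y≈y 0≤x)

    0≤clamp : ∀ x → 0# ≤ clamp x
    0≤clamp x = x≤x⊔y 0# (x ⊓ 1#)

    clamp≤1 : ∀ x → clamp x ≤ 1#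
    clamp≤1 x = ⊔-lub (<⇒≤ 0<1) (x⊓y≤y x 1#)

    clamp-mono : ∀ {x y} → x ≤ y → clamp x ≤ clamp y
    clamp-mono {x} {y} x≤y = ⊔-lub (0≤clamp y) (bound (⊓-sel y 1#))
      where
      bound : y ⊓ 1# ≈ y ⊎ y ⊓ 1# ≈ 1# → x ⊓ 1# ≤ clamp y
      bound (inj₁ eq) = ≤-trans (x⊓y≤x x 1#) (≤-trans x≤y (≤-respˡ-≈ eq (x≤y⊔x 0# (y ⊓ 1#))))
      bound (inj₂ eq) = ≤-trans (x⊓y≤y x 1#) (≤-respˡ-≈ eq (x≤y⊔x 0# (y ⊓ 1#)))

    clamp-nonexpansive : ∀ {x y} → x ≤ y → clamp y - clamp x ≤ y - x
    clamp-nonexpansive {x} {y} x≤y = ≤-respʳ-≈ (x+y-y≈x (y - x) (clamp x))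
      (+-monoˡ-≤ (- clamp x) (⊔-lub nonneg (bound (⊓-sel x 1#))))
      where
      0≤d = x≤y⇒0≤y-x x≤y
      nonneg : 0# ≤ (y - x) + clamp x
      nonneg = ≤-trans 0≤d (x≤x+y _ _ (0≤clamp x))
      bound : x ⊓ 1# ≈ x ⊎ x ⊓ 1# ≈ 1# → y ⊓ 1# ≤ (y - x) + clamp x
      bound (inj₁ eq) = ≤-trans (x⊓y≤x y 1#) (≤-respˡ-≈ (x-y+y≈x y x)
        (+-monoʳ-≤ (y - x) (≤-respˡ-≈ eq (x≤y⊔x 0# (x ⊓ 1#)))))
      bound (inj₂ eq) = ≤-trans (x⊓y≤y y 1#) (≤-trans (≤-respˡ-≈ eq (x≤y⊔x 0# (x ⊓ 1#)))
        (x+c≈y⇒x≤y 0≤d (+-comm _ _)))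

    -- Both `clamp x` and `x - clamp x` are nondecreasing in `x`. Their increments therefore have
    -- the sign of the increment of `x` and add up to it, so neither exceeds it in absolute value.
    ∣clamp∣-nonexpansive : ∀ x y →
      ∣ clamp x - clamp y ∣ ≤ ∣ x - y ∣ × ∣ (x - y) - (clamp x - clamp y) ∣ ≤ ∣ x - y ∣
    ∣clamp∣-nonexpansive x y = cases (total x y)
      where
      ∣∣-bounds : ∀ {b d} → 0# ≤ b → b ≤ d → ∣ b ∣ ≤ ∣ d ∣ × ∣ d - b ∣ ≤ ∣ d ∣
      ∣∣-bounds {b} {d} 0≤b b≤d =
        ≤-respˡ-≈ (sym (0≤x⇒∣x∣≈x 0≤b)) (≤-trans b≤d (x≤∣x∣ d)) ,
        ≤-respˡ-≈ (sym (0≤x⇒∣x∣≈x (x≤y⇒0≤y-x b≤d)))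
          (≤-trans (x+c≈y⇒x≤y 0≤b (x-y+y≈x d b)) (x≤∣x∣ d))
      ordered : ∀ {x y} → y ≤ x →
        ∣ clamp x - clamp y ∣ ≤ ∣ x - y ∣ × ∣ (x - y) - (clamp x - clamp y) ∣ ≤ ∣ x - y ∣
      ordered y≤x = ∣∣-bounds (x≤y⇒0≤y-x (clamp-mono y≤x)) (clamp-nonexpansive y≤x)
      cases : x ≤ y ⊎ y ≤ x →
        ∣ clamp x - clamp y ∣ ≤ ∣ x - y ∣ × ∣ (x - y) - (clamp x - clamp y) ∣ ≤ ∣ x - y ∣
      cases (inj₂ y≤x) = ordered y≤x
      cases (inj₁ x≤y) = let p , r = ordered x≤y in
        ≤-respˡ-≈ (∣x-y∣≈∣y-x∣ _ _) (≤-respʳ-≈ (∣x-y∣≈∣y-x∣ y x) p) ,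
        ≤-respˡ-≈ (trans (sym (∣-x∣≈∣x∣ _)) (∣∣-cong (solve 4 (λ a b x y →
          :- ((y :- x) :- (b :- a)) := (x :- y) :- (a :- b)) refl (clamp x) (clamp y) x y)))
          (≤-respʳ-≈ (∣x-y∣≈∣y-x∣ y x) r)

    -- The parabola `x (1 - x)` on the unit interval and zero outside; six times it is the
    -- derivative of the step.
    q : Carrier → Carrier
    q x = clamp x * (1# - clamp x)

    0≤q : ∀ x → 0# ≤ q x
    0≤q x = 0≤x*y (0≤clamp x) (x≤y⇒0≤y-x (clamp≤1 x))

    -- This dichotomy replaces a case distinction on the position of `x` in every later estimate:
    -- outside the unit interval one factor of `q` vanishes, inside `clamp` does nothing.
    fixed-or-flat : ∀ x → q x ≈ 0# ⊎ x ≈ clamp x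
    fixed-or-flat x = cases (total x 0#) (total x 1#)
      where
      cases : x ≤ 0# ⊎ 0# ≤ x → x ≤ 1# ⊎ 1# ≤ x → q x ≈ 0# ⊎ x ≈ clamp x
      cases (inj₁ x≤0) _          = inj₁ (trans (*-congʳ (clamp-below x≤0)) (zeroˡ _))
      cases (inj₂ 0≤x) (inj₁ x≤1) = inj₂ (sym (clamp-inside 0≤x x≤1))
      cases (inj₂ _)   (inj₂ 1≤x) = inj₁ (trans
        (*-congˡ (trans (+-congˡ (-‿cong (clamp-above 1≤x))) (-‿inverseʳ 1#))) (zeroʳ _))

    q*excess : ∀ x → q x * (x - clamp x) ≈ 0#
    q*excess x with fixed-or-flat x
    ... | inj₁ q≈0 = trans (*-congʳ q≈0) (zeroˡ _)
    ... | inj₂ x≈c = trans (*-congˡ (trans (+-congʳ x≈c) (-‿inverseʳ _))) (zeroʳ _)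

    -- The defect `g` of `clamp` alone is only of first order. If `q x` does not vanish, then `x` is
    -- fixed by `clamp`, so `g` equals `y - clamp y` and is annihilated by `q y`. Hence
    -- `q x * g = (q x - q y) * g`, and with `a = clamp x`, `b = clamp y` the factor
    -- `q x - q y = (1 - a - b) (a - b)` supplies the missing order.
    q*clamp-defect : ∀ x y →
      ∣ q x * ((y - x) - (clamp y - clamp x)) ∣ ≤ (y - x) * (y - x)
    q*clamp-defect x y with fixed-or-flat x
    ... | inj₁ q≈0 = ≤-respˡ-≈ (sym (x≈0⇒∣x∣≈0 (trans (*-congʳ q≈0) (zeroˡ _)))) (0≤x*x _)
    ... | inj₂ x≈c = begin
      ∣ q x * g ∣
        ≈⟨ ∣∣-cong qg ⟩
      ∣ (1# - a - b) * ((a - b) * g) ∣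
        ≈⟨ trans (∣x*y∣≈∣x∣*∣y∣ _ _) (*-congˡ (∣x*y∣≈∣x∣*∣y∣ _ _)) ⟩
      ∣ 1# - a - b ∣ * (∣ a - b ∣ * ∣ g ∣)
        ≤⟨ *-mono-≤ (0≤∣x∣ _) (0≤x*y (0≤∣x∣ _) (0≤∣x∣ _))
             (∣∣-lub (x+c≈y⇒x≤y (0≤x+y (0≤clamp x) (0≤clamp y))
               (solve 2 (λ a b → (con (+ 1) :- a :- b) :+ (a :+ b) := con (+ 1)) refl a b))
                     (x+c≈y⇒x≤y (0≤x+y (x≤y⇒0≤y-x (clamp≤1 x)) (x≤y⇒0≤y-x (clamp≤1 y)))
                       (solve 2 (λ a b → :- (con (+ 1) :- a :- b) :+
                         ((con (+ 1) :- a) :+ (con (+ 1) :- b)) := con (+ 1)) refl a b)))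
             (*-mono-≤ (0≤∣x∣ _) (0≤∣x∣ _) (≤-trans (inj₂ (∣x-y∣≈∣y-x∣ a b))
               (proj₁ (∣clamp∣-nonexpansive y x))) (proj₂ (∣clamp∣-nonexpansive y x))) ⟩
      1# * (∣ y - x ∣ * ∣ y - x ∣)
        ≈⟨ trans (*-identityˡ _) (∣x∣*∣x∣≈x*x _) ⟩
      (y - x) * (y - x) ∎
      where
      a = clamp x
      b = clamp y
      g = (y - x) - (b - a)
      -- q y annihilates the defect as well, since x is fixed by clamp.
      qg : q x * g ≈ (1# - a - b) * ((a - b) * g)
      qg = begin-equality
        q x * g
          ≈⟨ solve 4 (λ a b x y → let g = (y :- x) :- (b :- a) in
               a :* (con (+ 1) :- a) :* g :=
               (con (+ 1) :- a :- b) :* ((a :- b) :* g)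
               :+ ((b :* (con (+ 1) :- b)) :* (y :- b) :+ (b :* (con (+ 1) :- b)) :* (a :- x)))
               refl a b x y ⟩
        (1# - a - b) * ((a - b) * g) + (q y * (y - b) + q y * (a - x))
          ≈⟨ +-congˡ (+-cong (q*excess y) (trans (*-congˡ (trans (+-congˡ (-‿cong x≈c)) (-‿inverseʳ a)))
            (zeroʳ _))) ⟩
        (1# - a - b) * ((a - b) * g) + (0# + 0#)
          ≈⟨ trans (+-congˡ (+-identityʳ 0#)) (+-identityʳ _) ⟩
        (1# - a - b) * ((a - b) * g) ∎

    -- With `c = clamp x` this is the cubic `3c² - 2c³`. Its derivative `6c(1 - c)` vanishes at 0
    -- and 1, so the cubic joins the constants on either side with a continuous derivative.
    smoothstep smoothstep′ : Carrier → Carrier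
    smoothstep x = clamp x * clamp x * ((1# + 1# + 1#) - (1# + 1#) * clamp x)
    smoothstep′ x = (1# + 1# + 1# + 1# + 1# + 1#) * q x

    smoothstep-below : ∀ {x} → x ≤ 0# → smoothstep x ≈ 0#
    smoothstep-below x≤0 = trans (*-congʳ (trans (*-congʳ (clamp-below x≤0)) (zeroˡ _))) (zeroˡ _)

    smoothstep-above : ∀ {x} → 1# ≤ x → smoothstep x ≈ 1#
    smoothstep-above {x} 1≤x = trans
      (*-cong (*-cong c≈1 c≈1) (+-congˡ (-‿cong (*-congˡ c≈1))))
      (solve 0 (con (+ 1) :* con (+ 1) :* (con (+ 3) :- con (+ 2) :* con (+ 1)) := con (+ 1)) refl)
      where c≈1 = clamp-above 1≤x

    0≤smoothstep : ∀ x → 0# ≤ smoothstep x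
    0≤smoothstep x = 0≤x*y (0≤x*x _) (≤-respʳ-≈
      (solve 1 (λ a → con (+ 1) :+ con (+ 2) :* (con (+ 1) :- a) := con (+ 3) :- con (+ 2) :* a) refl (clamp x))
      (0≤x+y (<⇒≤ 0<1) (0≤x*y (<⇒≤ 0<2) (x≤y⇒0≤y-x (clamp≤1 x)))))

    smoothstep≤1 : ∀ x → smoothstep x ≤ 1#
    smoothstep≤1 x = x+c≈y⇒x≤y
      (0≤x*y (0≤x*x (1# - clamp x)) (0≤x+y (<⇒≤ 0<1) (0≤x*y (<⇒≤ 0<2) (0≤clamp x))))
      (solve 1 (λ a → a :* a :* (con (+ 3) :- con (+ 2) :* a)
        :+ ((con (+ 1) :- a) :* (con (+ 1) :- a)) :* (con (+ 1) :+ con (+ 2) :* a) := con (+ 1)) refl (clamp x))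

    -- The divided difference of the cubic is `3(a + b) - 2(a² + ab + b²)`. It is regrouped as `2a(1
    -- - a) + 2b(1 - b) + a(1 - b) + b(1 - a)`, where each term is nonnegative for `a` and `b`
    -- between 0 and 1.
    smoothstep-mono : ∀ {x y} → x ≤ y → smoothstep x ≤ smoothstep y
    smoothstep-mono {x} {y} x≤y = x+c≈y⇒x≤y
      (0≤x*y (x≤y⇒0≤y-x (clamp-mono x≤y))
        (0≤x+y (0≤x+y (*-monoʳ-nonNegative (0≤q x)) (*-monoʳ-nonNegative (0≤q y)))
          (0≤x+y (0≤x*y (0≤clamp x) (x≤y⇒0≤y-x (clamp≤1 y)))
                         (0≤x*y (0≤clamp y) (x≤y⇒0≤y-x (clamp≤1 x))))))
      (solve 2 (λ a b →
         a :* a :* (con (+ 3) :- con (+ 2) :* a)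
         :+ (b :- a) :* ((con (+ 2) :* (a :* (con (+ 1) :- a)) :+ con (+ 2) :* (b :* (con (+ 1) :- b)))
                         :+ (a :* (con (+ 1) :- b) :+ b :* (con (+ 1) :- a)))
         := b :* b :* (con (+ 3) :- con (+ 2) :* b)) refl (clamp x) (clamp y))
      where
      *-monoʳ-nonNegative : ∀ {x} → 0# ≤ x → 0# ≤ (1# + 1#) * x
      *-monoʳ-nonNegative = 0≤x*y (<⇒≤ 0<2)

    0≤smoothstep′ : ∀ x → 0# ≤ smoothstep′ x
    0≤smoothstep′ x = 0≤x*y 0≤6 (0≤q x)

    smoothstep′-cong : ∀ {x y} → x ≈ y → smoothstep′ x ≈ smoothstep′ y
    smoothstep′-cong x≈y = *-congˡ (*-cong (clamp-cong x≈y) (+-congˡ (-‿cong (clamp-cong x≈y))))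

    -- The constant 9 is 3 + 6. The cubic in the clamped variables has remainder
    -- `(b - a)² (3 - 2b - 4a)`, whose last factor lies between -3 and 3. Passing from `b - a` to
    -- `y - x` in the linear term costs six times the quantity bounded by `q*clamp-defect`.
    smoothstep-remainder : ∀ x y →
      ∣ (smoothstep y - smoothstep x) - smoothstep′ x * (y - x) ∣
      ≤ (1# + 1# + 1# + (1# + 1# + 1# + 1# + 1# + 1#)) * ((y - x) * (y - x))
    smoothstep-remainder x y = begin
      ∣ (smoothstep y - smoothstep x) - smoothstep′ x * (y - x) ∣
        ≈⟨ ∣∣-cong (solve 4 (λ a b x y →
             ((b :* b :* (con (+ 3) :- con (+ 2) :* b)) :- (a :* a :* (con (+ 3) :- con (+ 2) :* a)))
             :- con (+ 6) :* (a :* (con (+ 1) :- a)) :* (y :- x)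
             := ((b :- a) :* (b :- a)) :* (con (+ 3) :- con (+ 2) :* b :- con (+ 4) :* a)
                :- con (+ 6) :* ((a :* (con (+ 1) :- a)) :* ((y :- x) :- (b :- a)))) refl a b x y) ⟩
      ∣ ((b - a) * (b - a)) * (1+1+1 - (1# + 1#) * b - (1# + 1# + 1# + 1#) * a) - 6# * (q x * g) ∣
        ≤⟨ ∣x+y∣≤∣x∣+∣y∣ _ _ ⟩
      ∣ ((b - a) * (b - a)) * (1+1+1 - (1# + 1#) * b - (1# + 1# + 1# + 1#) * a) ∣ + ∣ - (6# * (q x * g)) ∣
        ≈⟨ +-cong (trans (∣x*y∣≈∣x∣*∣y∣ _ _) (*-congʳ (∣x*y∣≈∣x∣*∣y∣ _ _)))
             (trans (∣-x∣≈∣x∣ _) (trans (∣x*y∣≈∣x∣*∣y∣ _ _) (*-congʳ (0≤x⇒∣x∣≈x 0≤6)))) ⟩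
      (∣ b - a ∣ * ∣ b - a ∣) * ∣ 1+1+1 - (1# + 1#) * b - (1# + 1# + 1# + 1#) * a ∣ + 6# * ∣ q x * g ∣
        ≤⟨ +-mono-≤
             (*-mono-≤ (0≤x*y (0≤∣x∣ _) (0≤∣x∣ _)) 0≤3
               (*-mono-≤ (0≤∣x∣ _) (0≤∣x∣ _) (proj₁ (∣clamp∣-nonexpansive y x))
                 (proj₁ (∣clamp∣-nonexpansive y x)))
               (∣∣-lub
                 (x+c≈y⇒x≤y (0≤x+y (0≤x*y (<⇒≤ 0<2) (0≤clamp y)) (0≤x*y 0≤4 (0≤clamp x)))
                   (solve 2 (λ a b → (con (+ 3) :- con (+ 2) :* b :- con (+ 4) :* a) :+
                     (con (+ 2) :* b :+ con (+ 4) :* a) := con (+ 3)) refl a b))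
                 (x+c≈y⇒x≤y (0≤x+y (0≤x*y (<⇒≤ 0<2) (x≤y⇒0≤y-x (clamp≤1 y)))
                   (0≤x*y 0≤4 (x≤y⇒0≤y-x (clamp≤1 x))))
                   (solve 2 (λ a b → :- (con (+ 3) :- con (+ 2) :* b :- con (+ 4) :* a)
                      :+ (con (+ 2) :* (con (+ 1) :- b) :+ con (+ 4) :* (con (+ 1) :- a)) := con (+ 3))
                        refl a b))))
             (*-monoʳ-≤ 0≤6 (q*clamp-defect x y)) ⟩
      (∣ y - x ∣ * ∣ y - x ∣) * 1+1+1 + 6# * ((y - x) * (y - x))
        ≈⟨ +-congʳ (*-congʳ (∣x∣*∣x∣≈x*x (y - x))) ⟩
      ((y - x) * (y - x)) * 1+1+1 + 6# * ((y - x) * (y - x))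
        ≈⟨ trans (+-congʳ (*-comm _ _)) (sym (distribʳ _ _ _)) ⟩
      (1+1+1 + 6#) * ((y - x) * (y - x)) ∎
      where
      a = clamp x
      b = clamp y
      g = (y - x) - (b - a)
      1+1+1 = 1# + 1# + 1#
      6# = 1# + 1# + 1# + 1# + 1# + 1#

  module _ {a b : Carrier} (a<b : a < b) where
    open Smoothstep

    private
      c = recip⁺ (x<y⇒0<y-x a<b)
      0<c = 0<recip⁺ (x<y⇒0<y-x a<b)
      9# = 1# + 1# + 1# + (1# + 1# + 1# + 1# + 1# + 1#)

      rescale : Carrier → Carrier
      rescale x = (x - a) * c

      rescale-mono : ∀ {x y} → x ≤ y → rescale x ≤ rescale y
      rescale-mono x≤y = *-monoˡ-≤ (<⇒≤ 0<c) (+-monoˡ-≤ (- a) x≤y)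

      rescale-difference : ∀ x y → rescale y - rescale x ≈ c * (y - x)
      rescale-difference x y =
        solve 4 (λ a c x y → (y :- a) :* c :- (x :- a) :* c := c :* (y :- x)) refl a c x y

    stepˢ : Smooth 0#
    stepˢ = record
      { fun = λ t → smoothstep (rescale (value t))
      ; deriv = λ t → smoothstep′ (rescale (value t)) * c
      ; K = 9# * (c * c)
      ; approx = record
        { 0<K = *-pos 0<9 (*-pos 0<c 0<c)
        ; deriv-cong = λ eq → *-congʳ (smoothstep′-cong (*-congʳ (+-congʳ eq)))
        ; remainder = λ s t →
            let d = value s - value t
                x = rescale (value t)
                y = rescale (value s)
                y-x≈cd = rescale-difference (value t) (value s)
            in begin
              ∣ (smoothstep y - smoothstep x) - (smoothstep′ x * c) * d ∣
                ≈⟨ ∣∣-cong (+-congˡ (-‿cong (trans (*-assoc _ c d) (*-congˡ (sym y-x≈cd))))) ⟩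
              ∣ (smoothstep y - smoothstep x) - smoothstep′ x * (y - x) ∣
                ≤⟨ smoothstep-remainder x y ⟩
              9# * ((y - x) * (y - x))
                ≈⟨ *-congˡ (*-cong y-x≈cd y-x≈cd) ⟩
              9# * ((c * d) * (c * d))
                ≈⟨ solve 3 (λ n c d → n :* ((c :* d) :* (c :* d)) := n :* (c :* c) :* (d :* d)) refl 9# c d ⟩
              9# * (c * c) * (d * d) ∎
        }
      ; slope = λ t≤s → ≤-respˡ-≈ (sym (zeroˡ _)) (x≤y⇒0≤y-x (smoothstep-mono (rescale-mono t≤s)))
      ; m≤deriv = λ t → 0≤x*y (0≤smoothstep′ _) (<⇒≤ 0<c)
      }

    step-below : ∀ t → value t ≤ a → fun stepˢ t ≈ 0#
    step-below t t≤a = smoothstep-below (≤-respʳ-≈ (trans (*-congʳ (-‿inverseʳ a)) (zeroˡ c))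
      (rescale-mono t≤a))

    step-above : ∀ t → b ≤ value t → fun stepˢ t ≈ 1#
    step-above t b≤t = smoothstep-above (≤-respˡ-≈ (*-recip⁺ (x<y⇒0<y-x a<b)) (rescale-mono b≤t))

    0≤step : ∀ t → 0# ≤ fun stepˢ t
    0≤step t = 0≤smoothstep _

    step≤1 : ∀ t → fun stepˢ t ≤ 1#
    step≤1 t = smoothstep≤1 _

-- From smooth functions with positive slope to diffeomorphisms

module Profiles (em : ExcludedMiddle 0ℓ) (ℝ : CompleteOrderedField) where

  open CompleteOrderedField ℝ
  open FieldProperties ℝ
  open OrderedField ℝ
  open UnitInterval ℝ hiding (fun)
  open QuadraticApproximation em ℝ
  open SmoothFunctions em ℝ
  open Shift em ℝ using (0𝕀; 1𝕀)
  open IntegerCoefficientSolver commutativeRing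
  open Relation.Binary.Reasoning.StrictPartialOrder strictPartialOrder

  record Normalised {m} (F : Smooth m) : Set where
    no-eta-equality
    open Smooth F
    field
      fun-0 : fun 0𝕀 ≈ 0#
      fun-1 : fun 1𝕀 ≈ 1#

  -- Positivity of `m` gives strict monotonicity, a Lipschitz inverse and a derivative bounded away
  -- from zero; the normalisation fixes both endpoints.
  record Profile : Set where
    no-eta-equality
    field
      {m}        : Carrier
      0<m        : 0# < m
      smooth     : Smooth m
      normalised : Normalised smooth

    open Smooth smooth public
    open Normalised normalised public

  module ProfileDiffeo (F : Profile) where
    open Profile F

    private
      L = proj₁ Approx.lipschitz
      0<L = proj₁ (proj₂ Approx.lipschitz)
      L-lipschitz = proj₂ (proj₂ Approx.lipschitz)
      r = recip⁺ 0<m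
      0<r = 0<recip⁺ 0<m

    increment : ∀ {s t} → value t ≤ value s → fun s - fun t ≤ L * (value s - value t)
    increment {s} {t} t≤s = ≤-trans (x≤∣x∣ _)
      (≤-respʳ-≈ (*-congˡ (0≤x⇒∣x∣≈x (x≤y⇒0≤y-x t≤s))) (L-lipschitz s t))

    fun-mono : ∀ {s t} → value t ≤ value s → fun t ≤ fun s
    fun-mono t≤s = 0≤y-x⇒x≤y (≤-trans (0≤x*y (<⇒≤ 0<m) (x≤y⇒0≤y-x t≤s)) (slope t≤s))

    fun-strict : ∀ {s t} → value t < value s → fun t < fun s
    fun-strict {s} {t} t<s = begin-strict
      fun t                   ≈⟨ +-identityˡ _ ⟨
      0# + fun t              <⟨ +-monoˡ-< _ (<-≤-trans (*-pos 0<m (x<y⇒0<y-x t<s)) (slope (<⇒≤ t<s))) ⟩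
      (fun s - fun t) + fun t ≈⟨ x-y+y≈x _ _ ⟩
      fun s                   ∎

    fun-cong : ∀ {s t} → value s ≈ value t → fun s ≈ fun t
    fun-cong s≈t = antisym (fun-mono (inj₂ s≈t)) (fun-mono (inj₂ (sym s≈t)))

    fun-injective : ∀ {s t} → fun s ≈ fun t → value s ≈ value t
    fun-injective {s} {t} eq with compare (value s) (value t)
    ... | tri< s<t _ _ = ⊥-elim (<-irrefl eq (fun-strict s<t))
    ... | tri≈ _ s≈t _ = s≈t
    ... | tri> _ _ t<s = ⊥-elim (<-irrefl (sym eq) (fun-strict t<s))

    to : 𝕀 → 𝕀
    to t = point (fun t) (≤-respˡ-≈ fun-0 (fun-mono (0≤value t))) (≤-respʳ-≈ fun-1 (fun-mono (value≤1 t)))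

    -- An intermediate value argument at the supremum `s` of the points sent to at most `y`. The
    -- Lipschitz constant makes it quantitative: if `fun s` misses `y` by `e`, then `fun` cannot
    -- cross the level `y` within distance `e / L` of `s`.
    surjective : ∀ y → ∃ λ t → fun t ≈ value y
    surjective y = s , fs≈y
      where
      Below : Pred Carrier 0ℓ
      Below x = ∃ λ t → x ≈ value t × fun t ≤ value y
      0∈Below : Below 0#
      0∈Below = 0𝕀 , refl , ≤-respˡ-≈ (sym fun-0) (0≤value y)
      1-upper : IsUpperBound Below 1#
      1-upper (t , x≈t , _) = ≤-respˡ-≈ (sym x≈t) (value≤1 t)
      sup = supremum Below (0# , 0∈Below) (1# , 1-upper)
      s : 𝕀
      s = point (proj₁ sup) (proj₁ (proj₂ sup) 0∈Below) (proj₂ (proj₂ sup) 1-upper)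
      upper : ∀ t → fun t ≤ value y → value t ≤ value s
      upper t ft≤y = proj₁ (proj₂ sup) (t , refl , ft≤y)

      shift-by : Carrier → Carrier
      shift-by e = recip⁺ 0<L * e

      too-small : ¬ fun s < value y
      too-small fs<y = ≤⇒≯ (upper t ft≤y) s<t
        where
        e = value y - fun s
        0<e = x<y⇒0<y-x fs<y
        0<h : 0# < shift-by e
        0<h = *-pos (0<recip⁺ 0<L) 0<e
        -- There is room to the right of `s`: on the way to the endpoint `1𝕀`, `fun` still has to
        -- rise by at least `e`.
        h≤1-s : shift-by e ≤ 1# - value s
        h≤1-s = *-cancelˡ-≤ 0<L (begin
          L * shift-by e       ≈⟨ recip⁺-cancel 0<L e ⟩
          value y - fun s      ≤⟨ +-monoˡ-≤ _ (≤-respʳ-≈ (sym fun-1) (value≤1 y)) ⟩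
          fun 1𝕀 - fun s       ≤⟨ increment (value≤1 s) ⟩
          L * (1# - value s)   ∎)
        s<t : value s < shift-by e + value s
        s<t = <-respˡ-≈ (+-identityˡ _) (+-monoˡ-< (value s) 0<h)
        t : 𝕀
        t = point (shift-by e + value s) (≤-trans (0≤value s) (<⇒≤ s<t))
              (≤-respʳ-≈ (x-y+y≈x 1# (value s)) (+-monoˡ-≤ (value s) h≤1-s))
        ft≤y : fun t ≤ value y
        ft≤y = begin
          fun t                                    ≈⟨ x-y+y≈x (fun t) (fun s) ⟨
          (fun t - fun s) + fun s                  ≤⟨ +-monoˡ-≤ _ (increment (<⇒≤ s<t)) ⟩
          L * ((shift-by e + value s) - value s) + fun s
            ≈⟨ +-congʳ (trans (*-congˡ (x+y-y≈x _ _)) (recip⁺-cancel 0<L e)) ⟩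
          (value y - fun s) + fun s                ≈⟨ x-y+y≈x _ _ ⟩
          value y                                  ∎

      too-large : ¬ value y < fun s
      too-large y<fs = ≤⇒≯ (proj₂ (proj₂ sup) bound) b<s
        where
        e = fun s - value y
        b = value s - shift-by e
        b<s : b < value s
        b<s = x<z+y⇒x-y<z (<-respˡ-≈ (+-identityʳ _)
          (+-monoʳ-< (value s) (*-pos (0<recip⁺ 0<L) (x<y⇒0<y-x y<fs))))
        -- From any point of `Below` to `s`, `fun` rises by at least `e`, so the point lies at least
        -- `e / L` to the left and `s` is not the least upper bound.
        bound : IsUpperBound Below b
        bound {x} (t , x≈t , ft≤y) = ≤-respˡ-≈ (sym x≈t) (begin
          value t
            ≈⟨ solve 2 (λ s t → t := s :- (s :- t)) refl (value s) (value t) ⟩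
          value s - (value s - value t)
            ≤⟨ +-monoʳ-≤ (value s) (neg-mono-≤ (*-cancelˡ-≤ 0<L (begin
                 L * shift-by e              ≈⟨ recip⁺-cancel 0<L e ⟩
                 fun s - value y             ≤⟨ +-monoʳ-≤ (fun s) (neg-mono-≤ ft≤y) ⟩
                 fun s - fun t               ≤⟨ increment (upper t ft≤y) ⟩
                 L * (value s - value t)     ∎))) ⟩
          b ∎)

      fs≈y : fun s ≈ value y
      fs≈y with compare (fun s) (value y)
      ... | tri< fs<y _ _ = ⊥-elim (too-small fs<y)
      ... | tri≈ _ eq _   = eq
      ... | tri> _ _ y<fs = ⊥-elim (too-large y<fs)

    from : 𝕀 → 𝕀
    from y = proj₁ (surjective y)

    fun-from : ∀ y → fun (from y) ≈ value y
    fun-from y = proj₂ (surjective y)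

    from-cong : ∀ {y z} → value y ≈ value z → value (from y) ≈ value (from z)
    from-cong {y} {z} y≈z = fun-injective (trans (fun-from y) (trans y≈z (sym (fun-from z))))

    expanding : ∀ s t → m * ∣ value s - value t ∣ ≤ ∣ fun s - fun t ∣
    expanding s t with total (value t) (value s)
    ... | inj₁ t≤s = begin
      m * ∣ value s - value t ∣   ≈⟨ *-congˡ (0≤x⇒∣x∣≈x (x≤y⇒0≤y-x t≤s)) ⟩
      m * (value s - value t)     ≤⟨ slope t≤s ⟩
      fun s - fun t               ≤⟨ x≤∣x∣ _ ⟩
      ∣ fun s - fun t ∣           ∎
    ... | inj₂ s≤t = begin
      m * ∣ value s - value t ∣   ≈⟨ *-congˡ (trans (∣x-y∣≈∣y-x∣ _ _) (0≤x⇒∣x∣≈x (x≤y⇒0≤y-x s≤t))) ⟩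
      m * (value t - value s)     ≤⟨ slope s≤t ⟩
      fun t - fun s               ≤⟨ x≤∣x∣ _ ⟩
      ∣ fun t - fun s ∣           ≈⟨ ∣x-y∣≈∣y-x∣ _ _ ⟩
      ∣ fun s - fun t ∣           ∎

    from-lipschitz : Lipschitz (value ∘ from) r
    from-lipschitz z y = *-cancelˡ-≤ 0<m (begin
      m * ∣ value (from z) - value (from y) ∣   ≤⟨ expanding (from z) (from y) ⟩
      ∣ fun (from z) - fun (from y) ∣           ≈⟨ ∣∣-cong (+-cong (fun-from z) (-‿cong (fun-from y))) ⟩
      ∣ value z - value y ∣                     ≈⟨ recip⁺-cancel 0<m _ ⟨
      m * (r * ∣ value z - value y ∣)           ∎)

    0<deriv : ∀ t → 0# < deriv t
    0<deriv t = <-≤-trans 0<m (m≤deriv t)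

    -- The remainder of the inverse is `- R / fun′(t)`, where `R` is the remainder of `fun` at
    -- `t = from y`. With `r = 1 / m`, the reciprocal of the derivative contributes one factor `r`,
    -- and rewriting `R ≤ K d²` by `∣ d ∣ ≤ r ∣ e ∣` contributes two more.
    from-approx : QuadraticApprox (value ∘ from) (λ y → recip⁺ (0<deriv (from y))) (r * (K * (r * r)))
    from-approx = record
      { 0<K = *-pos 0<r (*-pos 0<K (*-pos 0<r 0<r))
      ; deriv-cong = λ {y} {z} eq → recip-unique (0<x⇒x≉0 (0<deriv (from y))) (0<x⇒x≉0 (0<deriv (from z)))
                                      (deriv-cong (from-cong {y} {z} eq))
      ; remainder = λ z y →
          let t = from y
              s = from z
              d = value s - value t
              e = value z - value y
              ρ = recip⁺ (0<deriv t)
              R = (fun s - fun t) - deriv t * d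
          in begin
            ∣ d - ρ * e ∣
              ≈⟨ ∣∣-cong (+-cong (sym (trans (*-congʳ (trans (*-comm ρ _) (*-recip⁺ (0<deriv t))))
                (*-identityˡ d)))
                   (-‿cong (*-congˡ (sym (+-cong (fun-from z) (-‿cong (fun-from y))))))) ⟩
            ∣ (ρ * deriv t) * d - ρ * (fun s - fun t) ∣
              ≈⟨ ∣∣-cong (solve 4 (λ ρ D d e → (ρ :* D) :* d :- ρ :* e := ρ :* (:- (e :- D :* d)))
                refl ρ (deriv t) d (fun s - fun t)) ⟩
            ∣ ρ * - R ∣
              ≈⟨ trans (∣x*y∣≈∣x∣*∣y∣ ρ (- R)) (*-cong (0≤x⇒∣x∣≈x (<⇒≤ (0<recip⁺ (0<deriv t)))) (∣-x∣≈∣x∣ R)) ⟩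
            ρ * ∣ R ∣
              ≤⟨ *-mono-≤ (<⇒≤ (0<recip⁺ (0<deriv t))) (0≤x*y (<⇒≤ 0<K) (0≤x*x d))
                (recip⁺-antitone 0<m (0<deriv t) (m≤deriv t)) (remainder s t) ⟩
            r * (K * (d * d))
              ≈⟨ *-congˡ (*-congˡ (∣x∣*∣x∣≈x*x d)) ⟨
            r * (K * (∣ d ∣ * ∣ d ∣))
              ≤⟨ *-monoʳ-≤ (<⇒≤ 0<r) (*-monoʳ-≤ (<⇒≤ 0<K)
                (*-mono-≤ (0≤∣x∣ d) (0≤x*y (<⇒≤ 0<r) (0≤∣x∣ e)) (from-lipschitz z y) (from-lipschitz z y))) ⟩
            r * (K * ((r * ∣ e ∣) * (r * ∣ e ∣)))
              ≈⟨ solve 3 (λ r K e → r :* (K :* ((r :* e) :* (r :* e))) := (r :* (K :* (r :* r))) :*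
                (e :* e)) refl r K ∣ e ∣ ⟩
            (r * (K * (r * r))) * (∣ e ∣ * ∣ e ∣)
              ≈⟨ *-congˡ (∣x∣*∣x∣≈x*x e) ⟩
            (r * (K * (r * r))) * (e * e) ∎
      }

    diffeo : Diffeo
    diffeo = record
      { homeo = record
        { bijection = record
          { to = to
          ; from = from
          ; to-cong = fun-cong
          ; from-cong = λ {y} {z} → from-cong {y} {z}
          ; inverse = (λ {y} {t} t≈ → trans (fun-cong {t} {from y} t≈) (fun-from y))
                    , (λ {t} {y} y≈ → fun-injective (trans (fun-from y) y≈))
          }
        ; to-continuous = lipschitz⇒continuous 0<L L-lipschitz
        ; from-continuous = lipschitz⇒continuous 0<r from-lipschitz
        ; increasing = fun-strict
        }
      ; to-deriv = Approx.deriv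
      ; to-hasDeriv = Approx.hasDerivative
      ; from-deriv = QuadraticApprox.deriv from-approx
      ; from-hasDeriv = QuadraticApprox.hasDerivative from-approx
      }

  open ProfileDiffeo public using (diffeo)

-- Uniform approximation of homeomorphisms by profiles

module Density (em : ExcludedMiddle 0ℓ) (ℝ : CompleteOrderedField) where

  open CompleteOrderedField ℝ
  open FieldProperties ℝ
  open OrderedField ℝ
  open UnitInterval ℝ hiding (fun)
  open DiffeoGroup ℝ using (from-increasing)
  open SmoothFunctions em ℝ
  open Profiles em ℝ
  open Shift em ℝ using (0𝕀; 1𝕀)
  open Algebra.Properties.Semiring.Mult semiring using () renaming (_×_ to _·_)
  open IntegerCoefficientSolver commutativeRing
  open Relation.Binary.Reasoning.StrictPartialOrder strictPartialOrder
  open Smooth using (fun; slope)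
  open Normalised

  module _ {s} (0≤s : 0# ≤ s) (s≤1 : s ≤ 1#) where

    mix : ∀ {m n} → Smooth m → Smooth n → Smooth ((1# - s) * m + s * n)
    mix F G = scale (1# - s) (x≤y⇒0≤y-x s≤1) F ⊕ scale s 0≤s G

    mix-normalised : ∀ {m n} {F : Smooth m} {G : Smooth n} →
                     Normalised F → Normalised G → Normalised (mix F G)
    mix-normalised F₁ G₁ = record
      { fun-0 = trans (+-cong (*-congˡ (fun-0 F₁)) (*-congˡ (fun-0 G₁)))
          (solve 1 (λ s → (con (+ 1) :- s) :* con (+ 0) :+ s :* con (+ 0) := con (+ 0)) refl s)
      ; fun-1 = trans (+-cong (*-congˡ (fun-1 F₁)) (*-congˡ (fun-1 G₁)))
          (solve 1 (λ s → (con (+ 1) :- s) :* con (+ 1) :+ s :* con (+ 1) := con (+ 1)) refl s)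
      }

    mixProfile : ∀ {m n} {F : Smooth m} {G : Smooth n} → 0# < (1# - s) * m + s * n →
                 Normalised F → Normalised G → Profile
    mixProfile {m} {n} {F} {G} 0<m F₁ G₁ = record
      { 0<m = 0<m ; smooth = mix F G ; normalised = mix-normalised {m} {n} {F} {G} F₁ G₁ }

    -- The difference is `s * (y - x)`, and two numbers between 0 and 1 differ by at most 1.
    mix-close : ∀ {x y} → 0# ≤ x → x ≤ 1# → 0# ≤ y → y ≤ 1# →
                ∣ ((1# - s) * x + s * y) - x ∣ ≤ s
    mix-close {x} {y} 0≤x x≤1 0≤y y≤1 = ∣∣-lub
      (x+c≈y⇒x≤y (0≤x*y 0≤s (≤-trans (x≤y⇒0≤y-x y≤1) (x≤x+y _ x 0≤x)))
        (solve 3 (λ s x y → (((con (+ 1) :- s) :* x :+ s :* y) :- x) :+ s :*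
          ((con (+ 1) :- y) :+ x) := s) refl s x y))
      (x+c≈y⇒x≤y (0≤x*y 0≤s (≤-trans (x≤y⇒0≤y-x x≤1) (x≤x+y _ y 0≤y)))
        (solve 3 (λ s x y → :- (((con (+ 1) :- s) :* x :+ s :* y) :- x) :+ s :*
          ((con (+ 1) :- x) :+ y) := s) refl s x y))

  module _ {m} (0≤m : 0# ≤ m) {F : Smooth m} (F₁ : Normalised F) where

    private
      monotone : ∀ {s t} → value t ≤ value s → fun F t ≤ fun F s
      monotone t≤s = 0≤y-x⇒x≤y (≤-trans (0≤x*y 0≤m (x≤y⇒0≤y-x t≤s)) (slope F t≤s))

    0≤fun : ∀ t → 0# ≤ fun F t
    0≤fun t = ≤-respˡ-≈ (fun-0 F₁) (monotone (0≤value t))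

    fun≤1 : ∀ t → fun F t ≤ 1#
    fun≤1 t = ≤-respʳ-≈ (fun-1 F₁) (monotone (value≤1 t))

  module _ (φ : IncreasingHomeo) where
    open IncreasingHomeo φ

    to-mono : ∀ {s t} → value s ≤ value t → value (to s) ≤ value (to t)
    to-mono         (inj₁ s<t) = <⇒≤ (increasing s<t)
    to-mono {s} {t} (inj₂ s≈t) = inj₂ (to-cong {s} {t} s≈t)

    from-mono : ∀ {s t} → value s ≤ value t → value (from s) ≤ value (from t)
    from-mono         (inj₁ s<t) = <⇒≤ (from-increasing φ s<t)
    from-mono {s} {t} (inj₂ s≈t) = inj₂ (from-cong {s} {t} s≈t)

    to-0 : value (to 0𝕀) ≈ 0#
    to-0 = antisym (≤-respʳ-≈ (strictlyInverseˡ 0𝕀) (to-mono (0≤value (from 0𝕀)))) (0≤value (to 0𝕀))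

    to-1 : value (to 1𝕀) ≈ 1#
    to-1 = antisym (value≤1 (to 1𝕀)) (≤-respˡ-≈ (strictlyInverseˡ 1𝕀) (to-mono (value≤1 (from 1𝕀))))

    to≤⇒≤from : ∀ {t y} → value (to t) ≤ value y → value t ≤ value (from y)
    to≤⇒≤from {t} p = ≤-respˡ-≈ (strictlyInverseʳ t) (from-mono p)

    ≤to⇒from≤ : ∀ {t y} → value y ≤ value (to t) → value (from y) ≤ value t
    ≤to⇒from≤ {t} p = ≤-respʳ-≈ (strictlyInverseʳ t) (from-mono p)

    module Staircase {d} (0<d : 0# < d) where

      -- The induction invariant for a staircase built up to height `r`. Closeness is claimed only
      -- where the homeomorphism has not passed `r`; beyond that the function is constant, which
      -- leaves a level floor for the next step.
      record Stairs (r : Carrier) : Set where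
        no-eta-equality
        field
          smooth : Smooth 0#
          at-0   : fun smooth 0𝕀 ≈ 0#
          close  : ∀ t → value (to t) ≤ r → ∣ fun smooth t - value (to t) ∣ ≤ d
          flat   : ∀ t → r ≤ value (to t) → fun smooth t ≈ r

      ground : Stairs 0#
      ground = record
        { smooth = zeroˢ
        ; at-0   = refl
        ; close  = λ t φt≤0 → ≤-trans (inj₂ (x≈0⇒∣x∣≈0
          (trans (+-congˡ (-‿cong (antisym φt≤0 (0≤value (to t))))) (-‿inverseʳ 0#)))) (<⇒≤ 0<d)
        ; flat   = λ t _ → refl
        }

      -- The new step has height `d` and rises between the preimages of `r` and `d + r`. Before that
      -- interval it is zero and the old estimate survives; on it, both the staircase and the
      -- homeomorphism lie between `r` and `d + r`.
      climb : ∀ {r} → 0# ≤ r → d + r ≤ 1# → Stairs r → Stairs (d + r)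
      climb {r} 0≤r d+r≤1 S = record
        { smooth = weaken (inj₂ (solve 1 (λ d → con (+ 0) := con (+ 0) :+ d :* con (+ 0)) refl d))
          (smooth ⊕ scale d (<⇒≤ 0<d) step)
        ; at-0   = trans (+-cong at-0 (trans (*-congˡ (step-below a<b 0𝕀 (0≤value (from lo))))
          (zeroʳ d))) (+-identityʳ 0#)
        ; close  = λ t φt≤d+r → near t φt≤d+r (total (value (to t)) r)
        ; flat   = λ t d+r≤φt → trans
            (+-cong (flat t (≤-trans (<⇒≤ r<d+r) d+r≤φt))
                    (trans (*-congˡ (step-above a<b t (≤to⇒from≤ {y = hi} d+r≤φt))) (*-identityʳ d)))
            (+-comm r d)
        }
        where
        open Stairs S
        r<d+r : r < d + r
        r<d+r = <-respˡ-≈ (+-identityˡ r) (+-monoˡ-< r 0<d)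
        lo hi : 𝕀
        lo = point r 0≤r (≤-trans (<⇒≤ r<d+r) d+r≤1)
        hi = point (d + r) (≤-trans 0≤r (<⇒≤ r<d+r)) d+r≤1
        a<b : value (from lo) < value (from hi)
        a<b = from-increasing φ r<d+r
        step = stepˢ a<b
        near : ∀ t → value (to t) ≤ d + r → value (to t) ≤ r ⊎ r ≤ value (to t) →
               ∣ (fun smooth t + d * fun step t) - value (to t) ∣ ≤ d
        near t _ (inj₁ φt≤r) = ≤-respˡ-≈
          (∣∣-cong (+-congʳ (sym (trans (+-congˡ (trans
            (*-congˡ (step-below a<b t (to≤⇒≤from {y = lo} φt≤r))) (zeroʳ d))) (+-identityʳ _)))))
          (close t φt≤r)
        near t φt≤d+r (inj₂ r≤φt) = ≤-respˡ-≈ (∣∣-cong (+-congʳ (+-congʳ (sym (flat t r≤φt)))))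
          (∣∣-lub
            (x+c≈y⇒x≤y (0≤x+y (x≤y⇒0≤y-x r≤φt) (0≤x*y (<⇒≤ 0<d) (x≤y⇒0≤y-x (step≤1 a<b t))))
              (solve 4 (λ r d σ y → ((r :+ d :* σ) :- y) :+ ((y :- r) :+ d :* (con (+ 1) :- σ)) := d)
                refl r d _ _))
            (x+c≈y⇒x≤y (0≤x+y (x≤y⇒0≤y-x φt≤d+r) (0≤x*y (<⇒≤ 0<d) (0≤step a<b t)))
              (solve 4 (λ r d σ y → :- ((r :+ d :* σ) :- y) :+ (((d :+ r) :- y) :+ d :* σ) := d) refl r d _ _)))

      stairs : ∀ n → n · d ≤ 1# → Stairs (n · d)
      stairs zero    _     = ground
      stairs (suc n) nd≤1 = climb (·-nonNegative n (<⇒≤ 0<d)) nd≤1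
        (stairs n (≤-trans (<⇒≤ (<-respˡ-≈ (+-identityˡ _) (+-monoˡ-< _ 0<d))) nd≤1))

      module _ {n} (d≤1 : d ≤ 1#) (n·d≈1 : n · d ≈ 1#) where
        open Stairs (stairs n (inj₂ n·d≈1))

        private
          G₁ : Normalised smooth
          G₁ = record { fun-0 = at-0 ; fun-1 = trans (flat 1𝕀 (inj₂ (trans n·d≈1 (sym to-1)))) n·d≈1 }

        -- A convex combination with the identity keeps the endpoint values 0 and 1. The weight `d`
        -- of the identity becomes the slope bound.
        tilted : Profile
        tilted = mixProfile (<⇒≤ 0<d) d≤1 {0#} {1#} {smooth} {idˢ}
          (<-respʳ-≈ (solve 1 (λ d → d := (con (+ 1) :- d) :* con (+ 0) :+ d :* con (+ 1)) refl d) 0<d)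
          G₁ (record { fun-0 = refl ; fun-1 = refl })

        -- One `d` is the error of the staircase, the other the cost of mixing in the identity.
        tilted-close : ∀ t → ∣ Profile.fun tilted t - value (to t) ∣ ≤ d + d
        tilted-close t = ≤-trans (∣∣-triangle _ (fun smooth t) _)
          (+-mono-≤ (mix-close (<⇒≤ 0<d) d≤1 (0≤fun ≤-refl {smooth} G₁ t) (fun≤1 ≤-refl {smooth} G₁ t)
            (0≤value t) (value≤1 t))
                    (close t (≤-respʳ-≈ (sym n·d≈1) (value≤1 (to t)))))

    approximation : ∀ {e} → 0# < e → ∃ λ (F : Profile) → ∀ t → ∣ Profile.fun F t - value (to t) ∣ ≤ e
    approximation {e} 0<e =
      -- Half of `e` because the error is `d + d`; the bound by 1 because `d` also serves as the
      -- weight of a convex combination.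
      let x , 0<x , x≤e/2 , x≤1 = common-bound (½-pos 0<e) 0<1
      in refine x≤e/2 x≤1 (unit-fraction em 0<x)
      where
      refine : ∀ {x} → x ≤ e * ½ → x ≤ 1# → (∃ λ n → ∃ λ d → 0# < d × d < x × n · d ≈ 1#) →
               ∃ λ (F : Profile) → ∀ t → ∣ Profile.fun F t - value (to t) ∣ ≤ e
      refine x≤e/2 x≤1 (n , d , 0<d , d<x , n·d≈1) =
        Staircase.tilted 0<d {n} d≤1 n·d≈1 , λ t → ≤-trans (Staircase.tilted-close 0<d {n} d≤1 n·d≈1 t)
          (≤-respʳ-≈ (½+½ e) (+-mono-≤ d≤e/2 d≤e/2))
        where
        d≤e/2 = ≤-trans (<⇒≤ d<x) x≤e/2
        d≤1 = ≤-trans (<⇒≤ d<x) x≤1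

-- Turbulence of the shift action, beginning with dense orbits

module ShiftTurbulence (em : ExcludedMiddle 0ℓ) (ℝ : CompleteOrderedField) where

  open CompleteOrderedField ℝ
  open FieldProperties ℝ
  open OrderedField ℝ
  open UnitInterval ℝ
  open DiffeoGroup ℝ
  open QuadraticApproximation em ℝ using (∣s-t∣≤1)
  open SmoothFunctions em ℝ
  open Profiles em ℝ
  open Density em ℝ
  open Shift em ℝ
  open Algebra.Properties.Semiring.Mult semiring using (×-congˡ) renaming (_×_ to _·_)
  open IntegerCoefficientSolver commutativeRing
  open Relation.Binary.Reasoning.StrictPartialOrder strictPartialOrder

  private
    module A = ContinuousAction (Shift.shiftAction em ℝ)
    module Topᴳ = MetricTopology ℝ (Group.setoid A.group) A.groupMetric
    module Topˣ = MetricTopology ℝ A.space A.spaceMetric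
    module H = IncreasingHomeo
    module P = Profile

  distᴴ : IncreasingHomeo → IncreasingHomeo → Carrier
  distᴴ = Metric.dist homeoMetric

  open Turbulence ℝ (Shift.shiftAction em ℝ) using (Orbit; LocalOrbit)

  distᴴ-upper : ∀ f g t → ∣ value (H.to f t) - value (H.to g t) ∣ ≤ distᴴ f g
  distᴴ-upper f g = dist∞-upper (toContinuous f) (toContinuous g)

  distᴴ-least : ∀ f g {b} → (∀ t → ∣ value (H.to f t) - value (H.to g t) ∣ ≤ b) → distᴴ f g ≤ b
  distᴴ-least f g = dist∞-least (toContinuous f) (toContinuous g)

  -- Substituting `u = x t` turns a uniform approximation of `y ∘ x⁻¹` into one of `y`. The result
  -- keeps the profile and not just its diffeomorphism, since the path inside a local orbit depends
  -- on its slope bound.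
  shift-approximation : ∀ x y {e} → 0# < e →
    ∃ λ (F : Profile) → distᴴ y (shift (diffeo F) x) ≤ e
  shift-approximation x y {e} 0<e =
    let F , F-close = approximation (y ∘ᴴ (x ⁻¹ᴴ)) 0<e
    in F , distᴴ-least y (shift (diffeo F) x) λ t → begin
      ∣ value (H.to y t) - P.fun F (H.to x t) ∣
        ≈⟨ ∣x-y∣≈∣y-x∣ _ _ ⟩
      ∣ P.fun F (H.to x t) - value (H.to y t) ∣
        ≈⟨ ∣∣-cong (+-congˡ (-‿cong (H.to-cong y {H.from x (H.to x t)} {t} (H.strictlyInverseʳ x t)))) ⟨
      ∣ P.fun F (H.to x t) - value (H.to y (H.from x (H.to x t))) ∣
        ≤⟨ F-close (H.to x t) ⟩
      e ∎

  orbit-dense : ∀ x → Topˣ.Dense (Orbit x)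
  orbit-dense x y ε 0<ε =
    let F , F-close = shift-approximation x y (½-pos 0<ε)
    in shift (diffeo F) x , (diffeo F , λ t → refl) , ≤-<-trans F-close (½-< 0<ε)

  -- Orbits are meager

  linear-bound : (g : Diffeo) → ∃ λ n → ∀ u → value (Diffeo.to g u) ≤ (n · 1#) * value u
  linear-bound g = proj₁ arch , λ u → bound u (compare (value u) 0#) (<-or-≥ (value u) δ)
    where
    D = fun (Diffeo.to-deriv g) 0𝕀
    near-0 = Diffeo.to-hasDeriv g 0𝕀 1# 0<1
    δ = proj₁ near-0
    0<δ = proj₁ (proj₂ near-0)
    -- For `0 < u < δ` the difference quotient at 0 is within 1 of `D`, hence below `C₁`. For
    -- `u ≥ δ` the trivial bound `g u ≤ 1 ≤ C₂ * u` suffices. The sum `C₁ + C₂` is a convenient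
    -- number above both.
    C₁ = 1# + ∣ D ∣
    C₂ = recip⁺ 0<δ
    0≤C₁ : 0# ≤ C₁
    0≤C₁ = 0≤x+y (<⇒≤ 0<1) (0≤∣x∣ D)
    arch = archimedean em (C₁ + C₂)
    N = proj₁ arch · 1#
    C₁≤N : C₁ ≤ N
    C₁≤N = ≤-trans (x≤x+y C₁ C₂ (<⇒≤ (0<recip⁺ 0<δ))) (<⇒≤ (proj₂ arch))
    C₂≤N : C₂ ≤ N
    C₂≤N = ≤-trans (x+c≈y⇒x≤y 0≤C₁ (+-comm C₂ C₁)) (<⇒≤ (proj₂ arch))
    g-0 = to-0 (Diffeo.homeo g)
    bound : ∀ u → _ → value u < δ ⊎ δ ≤ value u → value (Diffeo.to g u) ≤ N * value u
    bound u (tri< u<0 _ _) _ = ⊥-elim (≤⇒≯ (0≤value u) u<0)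
    bound u (tri≈ _ u≈0 _) _ = inj₂ (begin-equality
      value (Diffeo.to g u)    ≈⟨ Diffeo.to-cong g {u} {0𝕀} u≈0 ⟩
      value (Diffeo.to g 0𝕀)   ≈⟨ g-0 ⟩
      0#                       ≈⟨ trans (*-congˡ u≈0) (zeroʳ N) ⟨
      N * value u              ∎)
    bound u (tri> _ _ 0<u) (inj₂ δ≤u) = begin
      value (Diffeo.to g u)    ≤⟨ value≤1 (Diffeo.to g u) ⟩
      1#                       ≈⟨ trans (*-comm C₂ δ) (*-recip⁺ 0<δ) ⟨
      C₂ * δ                   ≤⟨ *-mono-≤ (<⇒≤ (0<recip⁺ 0<δ)) (0≤value u) C₂≤N δ≤u ⟩
      N * value u              ∎
    bound u (tri> _ _ 0<u) (inj₁ u<δ) = begin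
      value (Diffeo.to g u)    ≈⟨ recip-cancel ⟨
      (gu * ρ) * value u       ≤⟨ *-monoˡ-≤ (0≤value u) (≤-trans (<⇒≤ gu*ρ<C₁) C₁≤N) ⟩
      N * value u              ∎
      where
      gu = value (Diffeo.to g u)
      u≉0 : ¬ value u ≈ 0#
      u≉0 u≈0 = <-irrefl (sym u≈0) 0<u
      u-0≈u : value u - 0# ≈ value u
      u-0≈u = solve 1 (λ u → u :- con (+ 0) := u) refl (value u)
      ρ = recip (value u - 0#) (x≉y⇒x-y≉0 u≉0)
      recip-cancel : (gu * ρ) * value u ≈ gu
      recip-cancel = begin-equality
        (gu * ρ) * value u          ≈⟨ *-congˡ u-0≈u ⟨
        (gu * ρ) * (value u - 0#)   ≈⟨ solve 3 (λ g r u → (g :* r) :* u := g :* (u :* r)) refl gu ρ _ ⟩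
        gu * ((value u - 0#) * ρ)   ≈⟨ trans (*-congˡ (recip-inverse _ _)) (*-identityʳ gu) ⟩
        gu                          ∎
      u~0 : ∣ value u - 0# ∣ < δ
      u~0 = <-respˡ-≈ (sym (trans (∣∣-cong u-0≈u) (0≤x⇒∣x∣≈x (0≤value u)))) u<δ
      gu*ρ<C₁ : gu * ρ < C₁
      gu*ρ<C₁ = begin-strict
        gu * ρ
          ≈⟨ *-congʳ (trans (+-congˡ (-‿cong g-0)) (solve 1 (λ g → g :- con (+ 0) := g) refl gu)) ⟨
        (gu - value (Diffeo.to g 0𝕀)) * ρ
          <⟨ ∣∣<⇒<+ (proj₂ (proj₂ near-0) u u≉0 u~0) ⟩
        1# + D
          ≤⟨ +-monoʳ-≤ 1# (x≤∣x∣ D) ⟩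
        C₁ ∎

  DominatedBy : IncreasingHomeo → ℕ → Pred IncreasingHomeo 0ℓ
  DominatedBy x n y = ∀ t → value (H.to y t) ≤ (n · 1#) * value (H.to x t)

  dominated-closed : ∀ x n → Topˣ.Closure (DominatedBy x n) ⊆ DominatedBy x n
  dominated-closed x n {y} y∈ t = x≤y+ε⇒x≤y λ e 0<e →
    let z , z-dominated , y~z = y∈ e 0<e in begin
      value (H.to y t)
        ≈⟨ x-y+y≈x _ _ ⟨
      (value (H.to y t) - value (H.to z t)) + value (H.to z t)
        ≤⟨ +-mono-≤ (≤-trans (x≤∣x∣ _) (≤-trans (distᴴ-upper y z t) (<⇒≤ y~z))) (z-dominated t) ⟩
      e + (n · 1#) * value (H.to x t)
        ≈⟨ +-comm _ _ ⟩
      (n · 1#) * value (H.to x t) + e ∎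

  -- The perturbed function must again be a homeomorphism. Convex combinations with a step are
  -- available for profiles, so `y` is first replaced by a profile `F` close to it.
  undominated-nearby : ∀ x n y {ε} → 0# < ε →
    ∃ λ z → distᴴ y z < ε × ¬ DominatedBy x n z
  undominated-nearby x n y {ε} 0<ε =
    -- Approximating and mixing cost `δ` each, and together they have to stay strictly below `ε`.
    -- Keeping `δ` below 1 leaves `F` a positive weight, which carries the whole slope because the
    -- step has slope bound zero.
    let δ , 0<δ , δ≤ε/4 , δ≤½ = common-bound (½-pos (½-pos 0<ε)) (½-pos 0<1)
        F , F-close = approximation y 0<δ
    in perturb 0<δ δ≤ε/4 (≤-<-trans δ≤½ (½-< 0<1)) F F-close
    where
    N = n · 1#
    0<1+N : 0# < 1# + N
    0<1+N = <-≤-trans 0<1 (x≤x+y 1# N (·-nonNegative n (<⇒≤ 0<1)))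
    perturb : ∀ {δ} → 0# < δ → δ ≤ (ε * ½) * ½ → δ < 1# → (F : Profile) →
      (∀ t → ∣ P.fun F t - value (H.to y t) ∣ ≤ δ) →
      ∃ λ z → distᴴ y z < ε × ¬ DominatedBy x n z
    perturb {δ} 0<δ δ≤ε/4 δ<1 F F-close = Diffeo.homeo (diffeo k) , k-close , k-undominated
      where
      -- Chosen so that `N * u + u = δ`. The added step reaches its full height `δ` already at the
      -- point `p` with `x p = u`, where domination would allow only `N * u`.
      u = δ * recip⁺ 0<1+N
      0<u : 0# < u
      0<u = *-pos 0<δ (0<recip⁺ 0<1+N)
      [1+N]u≈δ : (1# + N) * u ≈ δ
      [1+N]u≈δ = trans (*-congˡ (*-comm δ _)) (recip⁺-cancel 0<1+N δ)
      N*u+u≈δ : N * u + u ≈ δ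
      N*u+u≈δ = trans (solve 2 (λ n u → n :* u :+ u := (con (+ 1) :+ n) :* u) refl N u) [1+N]u≈δ
      u≤1 : u ≤ 1#
      u≤1 = ≤-trans (x+c≈y⇒x≤y (0≤x*y (·-nonNegative n (<⇒≤ 0<1)) (<⇒≤ 0<u))
        (trans (+-comm u _) N*u+u≈δ)) (<⇒≤ δ<1)
      û p : 𝕀
      û = point u (<⇒≤ 0<u) u≤1
      p = H.from x û
      0<p : 0# < value p
      0<p = <-respˡ-≈ (to-0 (x ⁻¹ᴴ)) (from-increasing x {0𝕀} {û} 0<u)
      step₁ : Normalised (stepˢ 0<p)
      step₁ = record { fun-0 = step-below 0<p 0𝕀 ≤-refl ; fun-1 = step-above 0<p 1𝕀 (value≤1 p) }
      0<m : 0# < (1# - δ) * P.m F + δ * 0#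
      0<m = <-respʳ-≈ (solve 2 (λ d m → (con (+ 1) :- d) :* m := (con (+ 1) :- d) :* m :+ d :* con
        (+ 0)) refl δ (P.m F))
        (*-pos (x<y⇒0<y-x δ<1) (P.0<m F))
      k : Profile
      k = mixProfile (<⇒≤ 0<δ) (<⇒≤ δ<1) {P.m F} {0#} {P.smooth F} {stepˢ 0<p} 0<m (P.normalised F) step₁
      k-close : distᴴ y (Diffeo.homeo (diffeo k)) < ε
      k-close = ≤-<-trans (distᴴ-least y (Diffeo.homeo (diffeo k)) λ t → begin
          ∣ value (H.to y t) - P.fun k t ∣
            ≤⟨ ∣∣-triangle _ (P.fun F t) _ ⟩
          ∣ value (H.to y t) - P.fun F t ∣ + ∣ P.fun F t - P.fun k t ∣
            ≈⟨ +-cong (∣x-y∣≈∣y-x∣ _ _) (∣x-y∣≈∣y-x∣ _ _) ⟩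
          ∣ P.fun F t - value (H.to y t) ∣ + ∣ P.fun k t - P.fun F t ∣
            ≤⟨ +-mono-≤ (F-close t) (mix-close (<⇒≤ 0<δ) (<⇒≤ δ<1)
                 (0≤fun (<⇒≤ (P.0<m F)) {P.smooth F} (P.normalised F) t)
                 (fun≤1 (<⇒≤ (P.0<m F)) {P.smooth F} (P.normalised F) t)
                 (0≤step 0<p t) (step≤1 0<p t)) ⟩
          δ + δ
            ≤⟨ +-mono-≤ δ≤ε/4 δ≤ε/4 ⟩
          (ε * ½) * ½ + (ε * ½) * ½
            ≈⟨ ½+½ (ε * ½) ⟩
          ε * ½ ∎)
        (½-< 0<ε)
      k-undominated : ¬ DominatedBy x n (Diffeo.homeo (diffeo k))
      k-undominated k≤ = <-irrefl refl (begin-strict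
        δ
          ≈⟨ *-identityʳ δ ⟨
        δ * 1#
          ≈⟨ *-congˡ (step-above 0<p p ≤-refl) ⟨
        δ * Smooth.fun (stepˢ 0<p) p
          ≤⟨ x+c≈y⇒x≤y (0≤x*y (x≤y⇒0≤y-x (<⇒≤ δ<1))
            (0≤fun (<⇒≤ (P.0<m F)) {P.smooth F} (P.normalised F) p)) (+-comm _ _) ⟩
        P.fun k p
          ≤⟨ k≤ p ⟩
        N * value (H.to x p)
          ≈⟨ *-congˡ (H.strictlyInverseˡ x û) ⟩
        N * u
          ≈⟨ +-identityʳ _ ⟨
        N * u + 0#
          <⟨ +-monoʳ-< _ 0<u ⟩
        N * u + u
          ≈⟨ N*u+u≈δ ⟩
        δ ∎)

  orbit-dominated : ∀ x y → Orbit x y → ∃ λ n → DominatedBy x n y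
  orbit-dominated x y (g , gx≈y) = dominated g gx≈y (linear-bound g)
    where
    dominated : (g : Diffeo) → shift g x ≈ᴴ y → (∃ λ n → ∀ u → value (Diffeo.to g u) ≤ (n · 1#) * value u) →
                ∃ λ n → DominatedBy x n y
    dominated g gx≈y (n , bound) = n , λ t → ≤-respˡ-≈ (gx≈y t) (bound (H.to x t))

  dominated-nowhereDense : ∀ x n → Topˣ.NowhereDense (DominatedBy x n)
  dominated-nowhereDense x n y (ε , 0<ε , ball⊆) =
    let z , y~z , z-undominated = undominated-nearby x n y 0<ε
    in z-undominated (dominated-closed x n {z} (ball⊆ {z} y~z))

  orbit-meager : ∀ x → Topˣ.Meager (Orbit x)
  orbit-meager x = DominatedBy x , dominated-nowhereDense x , λ {y} → orbit-dominated x y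

  -- Local orbits: the straight path from the identity to a profile

  module LinearPath (F : Profile) where

    private
      D = P.deriv F
      r = recip⁺ (P.0<m F)
      B = proj₁ (bounded (P.Approx.deriv F))

    -- The average slope over the whole interval is 1. Consequently every convex combination of `1#`
    -- and `m` is still at least `m`, which gives a slope bound valid along the entire path.
    m≤1 : P.m F ≤ 1#
    m≤1 = begin
      P.m F                        ≈⟨ solve 1 (λ m → m :* (con (+ 1) :- con (+ 0)) := m) refl (P.m F) ⟨
      P.m F * (1# - 0#)            ≤⟨ P.slope F {1𝕀} {0𝕀} (<⇒≤ 0<1) ⟩
      P.fun F 1𝕀 - P.fun F 0𝕀      ≈⟨ +-cong (P.fun-1 F) (-‿cong (P.fun-0 F)) ⟩
      1# - 0#                      ≈⟨ solve 0 (con (+ 1) :- con (+ 0) := con (+ 1)) refl ⟩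
      1#                           ∎

    module _ {s} (0≤s : 0# ≤ s) (s≤1 : s ≤ 1#) where

      m≤mixed : P.m F ≤ (1# - s) * 1# + s * P.m F
      m≤mixed = x+c≈y⇒x≤y (0≤x*y (x≤y⇒0≤y-x s≤1) (x≤y⇒0≤y-x m≤1))
        (solve 2 (λ s m → m :+ (con (+ 1) :- s) :* (con (+ 1) :- m) := (con (+ 1) :- s) :* con
          (+ 1) :+ s :* m) refl s (P.m F))

      path : Profile
      path = mixProfile 0≤s s≤1 {1#} {P.m F} {idˢ} {P.smooth F} (<-≤-trans (P.0<m F) m≤mixed)
        (record { fun-0 = refl ; fun-1 = refl }) (P.normalised F)

      m≤deriv-path : ∀ t → P.m F ≤ P.deriv path t
      m≤deriv-path t = ≤-trans m≤mixed (P.m≤deriv path t)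

      -- At each point the displacement is `s` times that of `F`, so a ball around `x` that contains
      -- the endpoint contains the whole path.
      path-between : ∀ x → distᴴ x (shift (diffeo path) x) ≤ distᴴ x (shift (diffeo F) x)
      path-between x = distᴴ-least x (shift (diffeo path) x) λ t → let u = H.to x t in begin
        ∣ value u - P.fun path u ∣
          ≈⟨ ∣∣-cong (solve 3 (λ s u f → u :- ((con (+ 1) :- s) :* u :+ s :* f) := s :* (u :- f)) refl s
            (value u) (P.fun F u)) ⟩
        ∣ s * (value u - P.fun F u) ∣
          ≈⟨ trans (∣x*y∣≈∣x∣*∣y∣ s _) (*-congʳ (0≤x⇒∣x∣≈x 0≤s)) ⟩
        s * ∣ value u - P.fun F u ∣
          ≤⟨ *-monoˡ-≤ (0≤∣x∣ _) s≤1 ⟩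
        1# * ∣ value u - P.fun F u ∣
          ≈⟨ *-identityˡ _ ⟩
        ∣ value u - P.fun F u ∣
          ≤⟨ distᴴ-upper x (shift (diffeo F) x) t ⟩
        distᴴ x (shift (diffeo F) x) ∎

    -- Bounds the group distance covered per unit of time. The summand 1 bounds the displacement
    -- `∣ u - F u ∣`. The rest bounds the change of derivative: `∣ 1 - F′ ∣ ≤ 1 + B`, divided by a
    -- path derivative that is at least `m`. It does not depend on `s`.
    speed : Carrier
    speed = 1# + (1# + B) * r

    0≤B : 0# ≤ B
    0≤B = ≤-trans (0≤∣x∣ _) (proj₂ (bounded (P.Approx.deriv F)) 0𝕀)

    0<speed : 0# < speed
    0<speed = <-≤-trans 0<1 (x≤x+y 1# _ (0≤x*y (0≤x+y (<⇒≤ 0<1) 0≤B) (<⇒≤ (0<recip⁺ (P.0<m F)))))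

    module _ {s s′ d} (0≤s : 0# ≤ s) (s≤1 : s ≤ 1#) (0≤s′ : 0# ≤ s′) (s′≤1 : s′ ≤ 1#)
             (0≤d : 0# ≤ d) (s′≈d+s : s′ ≈ d + s) where

      private
        Pₛ = path 0≤s s≤1
        Pₛ′ = path 0≤s′ s′≤1

      pathStep : Diffeo
      pathStep = diffeo Pₛ′ ∘ᴰ (diffeo Pₛ ⁻¹ᴰ)

      pathStep-shift : ∀ x → shift (diffeo Pₛ′) x ≈ᴴ shift pathStep (shift (diffeo Pₛ) x)
      pathStep-shift x t = Diffeo.to-cong (diffeo Pₛ′) {H.to x t}
        {Diffeo.from (diffeo Pₛ) (Diffeo.to (diffeo Pₛ) (H.to x t))}
        (sym (Diffeo.strictlyInverseʳ (diffeo Pₛ) (H.to x t)))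

      -- Both errors are evaluated at `u = g_s⁻¹ t`, where `g_s` is the diffeomorphism at time `s`.
      -- Since value and derivative of the path are affine in `s`, they change between the two times
      -- by exactly `d` times `u - F u` and `1 - F′ u`; the latter is then divided by `g_s′ u`.
      pathStep-close : distᴰ idᴰ pathStep ≤ d * speed
      pathStep-close = ≤-respʳ-≈ (solve 2 (λ d c → d :+ d :* c := d :* (con (+ 1) :+ c)) refl d ((1# + B) * r))
        (+-mono-≤
          (dist∞-least (toContinuous idᴴ) (toContinuous (Diffeo.homeo pathStep)) displacement)
          (dist∞-least (Diffeo.to-deriv idᴰ) (Diffeo.to-deriv pathStep) distortion))
        where
        scaled : ∀ {x y b} → x - y ≈ d * b → ∣ x - y ∣ ≈ d * ∣ b ∣
        scaled eq = trans (∣∣-cong eq) (trans (∣x*y∣≈∣x∣*∣y∣ d _) (*-congʳ (0≤x⇒∣x∣≈x 0≤d)))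
        from : 𝕀 → 𝕀
        from = Diffeo.from (diffeo Pₛ)
        displacement : ∀ t → ∣ value t - P.fun Pₛ′ (from t) ∣ ≤ d
        displacement t = let u = from t in begin
          ∣ value t - P.fun Pₛ′ u ∣
            ≈⟨ ∣∣-cong (+-congʳ (Diffeo.strictlyInverseˡ (diffeo Pₛ) t)) ⟨
          ∣ P.fun Pₛ u - P.fun Pₛ′ u ∣
            ≈⟨ scaled {P.fun Pₛ u} {P.fun Pₛ′ u} (trans
              (+-congˡ (-‿cong (+-cong (*-congʳ (+-congˡ (-‿cong s′≈d+s))) (*-congʳ s′≈d+s))))
                 (solve 4 (λ s d u f → ((con (+ 1) :- s) :* u :+ s :* f) :-
                   ((con (+ 1) :- (d :+ s)) :* u :+ (d :+ s) :* f) := d :* (u :- f)) refl s d (value u)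
                     (P.fun F u))) ⟩
          d * ∣ value u - P.fun F u ∣
            ≤⟨ *-monoʳ-≤ 0≤d (∣s-t∣≤1 u (Diffeo.to (diffeo F) u)) ⟩
          d * 1#
            ≈⟨ *-identityʳ d ⟩
          d ∎
        distortion : ∀ t → ∣ 1# - fun (Diffeo.to-deriv pathStep) t ∣ ≤ d * ((1# + B) * r)
        distortion t = begin
          ∣ 1# - P.deriv Pₛ′ u * ρ ∣
            ≈⟨ ∣∣-cong (+-congʳ (*-recip⁺ 0<Dₛ)) ⟨
          ∣ P.deriv Pₛ u * ρ - P.deriv Pₛ′ u * ρ ∣
            ≈⟨ scaled {P.deriv Pₛ u * ρ} {P.deriv Pₛ′ u * ρ}
              (trans (+-congˡ (-‿cong (*-congʳ (+-cong (*-congʳ (+-congˡ (-‿cong s′≈d+s))) (*-congʳ s′≈d+s)))))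
                 (solve 4 (λ s d D r → ((con (+ 1) :- s) :* con (+ 1) :+ s :* D) :* r :-
                   ((con (+ 1) :- (d :+ s)) :* con (+ 1) :+ (d :+ s) :* D) :* r
                   := d :* ((con (+ 1) :- D) :* r)) refl s d (D u) ρ)) ⟩
          d * ∣ (1# - D u) * ρ ∣
            ≈⟨ *-congˡ (trans (∣x*y∣≈∣x∣*∣y∣ _ _) (*-congˡ (0≤x⇒∣x∣≈x (<⇒≤ (0<recip⁺ 0<Dₛ))))) ⟩
          d * (∣ 1# - D u ∣ * ρ)
            ≤⟨ *-monoʳ-≤ 0≤d (*-mono-≤ (0≤∣x∣ _) (<⇒≤ (0<recip⁺ (P.0<m F)))
                 (≤-trans (∣x+y∣≤∣x∣+∣y∣ _ _) (+-mono-≤ (inj₂ (0≤x⇒∣x∣≈x (<⇒≤ 0<1)))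
                   (≤-trans (inj₂ (∣-x∣≈∣x∣ _)) (proj₂ (bounded (P.Approx.deriv F)) u))))
                 (recip⁺-antitone (P.0<m F) 0<Dₛ (m≤deriv-path 0≤s s≤1 u))) ⟩
          d * ((1# + B) * r) ∎
          where
          u = from t
          0<Dₛ = ProfileDiffeo.0<deriv Pₛ u
          ρ = recip⁺ 0<Dₛ

    module _ {U : Pred IncreasingHomeo 0ℓ} {V : Pred Diffeo 0ℓ} {x ε η}
             (ball⊆U : Topˣ.Ball x ε ⊆ U) (ball⊆V : Topᴳ.Ball idᴰ η ⊆ V)
             (endpoint-close : distᴴ x (shift (diffeo F) x) < ε)
             {n d} (0<d : 0# < d) (d*speed<η : d * speed < η) (n·d≈1 : n · d ≈ 1#) where

      private
        time : ∀ {N} → Fin N → Carrier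
        time i = toℕ i · d

        0≤time : ∀ {N} (i : Fin N) → 0# ≤ time i
        0≤time i = ·-nonNegative (toℕ i) (<⇒≤ 0<d)

        time≤1 : ∀ (i : Fin (suc n)) → time i ≤ 1#
        time≤1 i = ≤-respʳ-≈ n·d≈1 (·-monoˡ-≤ (<⇒≤ 0<d) (toℕ≤pred[n] i))

        points : Fin (suc n) → IncreasingHomeo
        points i = shift (diffeo (path (0≤time i) (time≤1 i))) x

        points∈U : ∀ i → points i ∈ U
        points∈U i = ball⊆U {points i} (≤-<-trans (path-between (0≤time i) (time≤1 i) x) endpoint-close)

        -- The two sides agree only through `toℕ-inject₁`. This is why `pathStep` takes both times
        -- separately, together with a proof that they differ by `d`.
        next : ∀ (i : Fin n) → time (Fin.suc i) ≈ d + time (inject₁ i)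
        next i = +-congˡ (×-congˡ (≡.sym (toℕ-inject₁ i)))

        steps : Fin n → Diffeo
        steps i = pathStep (0≤time (inject₁ i)) (time≤1 (inject₁ i)) (0≤time (Fin.suc i))
          (time≤1 (Fin.suc i)) (<⇒≤ 0<d) (next i)

      endpoint∈localOrbit : LocalOrbit x U V (shift (diffeo F) x)
      endpoint∈localOrbit = ball⊆U {shift (diffeo F) x} endpoint-close , n , points , steps , first ,
        last , points∈U ,
        (λ i → ball⊆V {steps i} (≤-<-trans (pathStep-close (0≤time (inject₁ i)) (time≤1 (inject₁ i))
          (0≤time (Fin.suc i)) (time≤1 (Fin.suc i)) (<⇒≤ 0<d) (next i)) d*speed<η)) ,
        (λ i → pathStep-shift (0≤time (inject₁ i)) (time≤1 (inject₁ i)) (0≤time (Fin.suc i))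
          (time≤1 (Fin.suc i)) (<⇒≤ 0<d) (next i) x)
        where
        first : points Fin.zero ≈ᴴ x
        first t = solve 2 (λ u f → (con (+ 1) :- con (+ 0)) :* u :+ con (+ 0) :* f := u) refl
          (value (H.to x t)) _
        last≈1 : time (fromℕ n) ≈ 1#
        last≈1 = trans (×-congˡ (toℕ-fromℕ n)) n·d≈1
        last : points (fromℕ n) ≈ᴴ shift (diffeo F) x
        last t = trans (+-cong (*-congʳ (+-congˡ (-‿cong last≈1))) (*-congʳ last≈1))
          (solve 2 (λ u f → (con (+ 1) :- con (+ 1)) :* u :+ con (+ 1) :* f := f) refl (value (H.to x t)) _)

  module _ {U : Pred IncreasingHomeo 0ℓ} {V : Pred Diffeo 0ℓ} {x ε η}
           (ball⊆U : Topˣ.Ball x ε ⊆ U) (0<η : 0# < η) (ball⊆V : Topᴳ.Ball idᴰ η ⊆ V) where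

    -- The mesh is chosen after `F`, because `speed` depends on its slope bound and on the bound of
    -- its derivative. The number of steps is thus not uniform over the ball, which local orbits
    -- permit.
    shift∈localOrbit : ∀ F → distᴴ x (shift (diffeo F) x) < ε → LocalOrbit x U V (shift (diffeo F) x)
    shift∈localOrbit F endpoint-close = traverse (unit-fraction em (*-pos 0<η (0<recip⁺ 0<speed)))
      where
      open LinearPath F
      traverse : (∃ λ n → ∃ λ d → 0# < d × d < η * recip⁺ 0<speed × n · d ≈ 1#) →
                 LocalOrbit x U V (shift (diffeo F) x)
      traverse (n , d , 0<d , d<η/speed , n·d≈1) =
        endpoint∈localOrbit {U} {V} {x} {ε} {η} (λ {z} → ball⊆U {z}) (λ {g} → ball⊆V {g}) endpoint-close
          {n} {d} 0<d d*speed<η n·d≈1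
        where
        d*speed<η : d * speed < η
        d*speed<η = begin-strict
          d * speed                     ≈⟨ *-comm d speed ⟩
          speed * d                     <⟨ *-monoʳ-< 0<speed d<η/speed ⟩
          speed * (η * recip⁺ 0<speed)  ≈⟨ *-congˡ (*-comm η _) ⟩
          speed * (recip⁺ 0<speed * η)  ≈⟨ recip⁺-cancel 0<speed η ⟩
          η                             ∎

    ball⊆closure-localOrbit : ∀ y → distᴴ x y < ε → Topˣ.Closure (LocalOrbit x U V) y
    ball⊆closure-localOrbit y x~y e 0<e =
      -- Half of `e` brings the approximant close to `y`; half of the room `ε - distᴴ x y` keeps it
      -- inside the ball around `x`, so that the path to it stays in `U`.
      approach (common-bound (½-pos 0<e) (½-pos (x<y⇒0<y-x x~y)))
      where
      approach : (∃ λ e′ → 0# < e′ × e′ ≤ e * ½ × e′ ≤ (ε - distᴴ x y) * ½) →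
                 ∃ λ z → z ∈ LocalOrbit x U V × z ∈ Topˣ.Ball y e
      approach (e′ , 0<e′ , e′≤e/2 , e′≤room) = conclude (shift-approximation x y 0<e′)
        where
        conclude : (∃ λ F → distᴴ y (shift (diffeo F) x) ≤ e′) →
                   ∃ λ z → z ∈ LocalOrbit x U V × z ∈ Topˣ.Ball y e
        conclude (F , F-close) = gx , shift∈localOrbit F x~gx , ≤-<-trans F-close (≤-<-trans e′≤e/2 (½-< 0<e))
          where
          gx = shift (diffeo F) x
          x~gx : distᴴ x gx < ε
          x~gx = begin-strict
            distᴴ x gx                      ≤⟨ dist∞-triangle (toContinuous x) (toContinuous y)
              (toContinuous gx) ⟩
            distᴴ x y + distᴴ y gx          ≤⟨ +-monoʳ-≤ _ (≤-trans F-close e′≤room) ⟩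
            distᴴ x y + (ε - distᴴ x y) * ½ <⟨ +-monoʳ-< _ (½-< (x<y⇒0<y-x x~y)) ⟩
            distᴴ x y + (ε - distᴴ x y)     ≈⟨ solve 2 (λ a e → a :+ (e :- a) := e) refl _ _ ⟩
            ε                               ∎

  localOrbit-somewhereDense : ∀ (U : Pred IncreasingHomeo 0ℓ) → Topˣ.Open U → ∀ x → x ∈ U →
    ∀ (V : Pred Diffeo 0ℓ) → Topᴳ.Open V → idᴰ ∈ V → Topˣ.SomewhereDense (LocalOrbit x U V)
  localOrbit-somewhereDense U U-open x x∈U V V-open id∈V = inside (U-open {x} x∈U) (V-open {idᴰ} id∈V)
    where
    inside : Topˣ.Interior U x → Topᴳ.Interior V idᴰ → Topˣ.SomewhereDense (LocalOrbit x U V)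
    inside (ε , 0<ε , ball⊆U) (η , 0<η , ball⊆V) =
      x , ε , 0<ε , λ {y} → ball⊆closure-localOrbit {U} {V} {x} {ε} {η} (λ {z} → ball⊆U {z}) 0<η
        (λ {g} → ball⊆V {g}) y

  shift-turbulent : Turbulence.Turbulent ℝ (Shift.shiftAction em ℝ)
  shift-turbulent = record
    { orbits-meager = orbit-meager
    ; orbits-dense = orbit-dense
    ; local-orbits-somewhere-dense = localOrbit-somewhereDense
    }

proposition3p21 : (em : ExcludedMiddle 0ℓ) (ℝ : CompleteOrderedField) →
    Turbulence.Turbulent ℝ (Shift.shiftAction em ℝ)
proposition3p21 = ShiftTurbulence.shift-turbulent
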